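{- Let $n\ge 1$ be an integer and let $G$ be a graph which is cospectral with the friendship graph $F_n$. Then $G$ is either connected or it is the disjoint union of some copies of $K_2$ and one connected component.
   Context: All graphs are finite, simple and undirected. The friendship graph $F_n$ ($n\ge 1$) is the graph with $2n+1$ vertices and $3n$ edges obtained from $n$ copies of the triangle $C_3$ by identifying one vertex of each copy into a single common vertex. Two graphs are cospectral if their $(0,1)$-adjacency matrices have the same multiset of eigenvalues. -}

module Defs where

open import Algebra.Bundles using (CommutativeMonoid; RawRing)
import Algebra.Definitions.RawSemiring as RawSemiringDefs
import Algebra.Properties.CommutativeSemigroup as CommutativeSemigroupProperties
open import Data.Bool.Base using (Bool; true; false; _∧_; not; if_then_else_)
open import Data.Bool.Properties using (∧-zeroʳ)
open import Data.Fin.Base using (Fin; zero; suc; toℕ; punchIn; splitAt; remQuot)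
open import Data.Fin.Properties using (_≟_)
open import Data.List.Base as List using (List; length)
open import Data.List.Relation.Binary.Permutation.Homogeneous using (Permutation)
open import Data.Nat.Base as ℕ using (ℕ; zero; suc)
import Data.Nat.Properties as ℕₚ
open import Data.Product.Base using (Σ; ∃-syntax; _×_; _,_; proj₁; proj₂)
open import Data.Rational.Base hiding (_⊔_)
import Data.Rational.Properties as ℚₚ
open import Data.Sum.Base using (_⊎_; inj₁; inj₂)
open import Function.Bundles using (_↔_; Inverse)
open import Level using (0ℓ; _⊔_)
open import Relation.Binary.Construct.Closure.ReflexiveTransitive using (Star)
open import Relation.Binary.PropositionalEquality
open import Relation.Nullary using (does; yes; no; contradiction)

-- A real number is a Cauchy sequence of rationals; two are equal (_≃ᴿ_) when
-- their difference is a null sequence.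
IsCauchy : (ℕ → ℚ) → Set
IsCauchy x = ∀ ε → 0ℚ < ε →
  ∃[ N ] (∀ {m n} → N ℕ.≤ m → N ℕ.≤ n → ∣ x m - x n ∣ < ε)

record ℝ : Set where
  constructor mkℝ
  field
    seq    : ℕ → ℚ
    cauchy : IsCauchy seq

open ℝ public

infix 4 _≃ᴿ_
_≃ᴿ_ : ℝ → ℝ → Set
x ≃ᴿ y = ∀ ε → 0ℚ < ε → ∃[ N ] (∀ {n} → N ℕ.≤ n → ∣ seq x n - seq y n ∣ < ε)

private
  open CommutativeSemigroupProperties
    (CommutativeMonoid.commutativeSemigroup ℚₚ.+-0-commutativeMonoid) using (interchange)

  +-difference : ∀ a b c d → (a + b) - (c + d) ≡ (a - c) + (b - d)
  +-difference a b c d =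
    trans (cong (a + b +_) (ℚₚ.neg-distrib-+ c d)) (interchange a b (- c) (- d))

  neg-difference : ∀ a b → (- a) - (- b) ≡ - (a - b)
  neg-difference a b = sym (ℚₚ.neg-distrib-+ a (- b))

  cancel-middle : ∀ a b c → (a - b) + (b + c) ≡ a + c
  cancel-middle a b c = begin
    (a - b) + (b + c)      ≡⟨ ℚₚ.+-assoc a (- b) (b + c) ⟩
    a + (- b + (b + c))    ≡⟨ cong (a +_) (sym (ℚₚ.+-assoc (- b) b c)) ⟩
    a + ((- b + b) + c)    ≡⟨ cong (λ z → a + (z + c)) (ℚₚ.+-inverseˡ b) ⟩
    a + (0ℚ + c)           ≡⟨ cong (a +_) (ℚₚ.+-identityˡ c) ⟩
    a + c                  ∎
    where open ≡-Reasoning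

  *-difference : ∀ a b c d → a * b - c * d ≡ a * (b - d) + d * (a - c)
  *-difference a b c d = sym (begin
    a * (b - d) + d * (a - c)
      ≡⟨ cong₂ _+_ (ℚₚ.*-distribˡ-+ a b (- d)) (ℚₚ.*-distribˡ-+ d a (- c)) ⟩
    (a * b + a * - d) + (d * a + d * - c)
      ≡⟨ cong₂ (λ y z → (a * b + y) + (d * a + z))
           (sym (ℚₚ.neg-distribʳ-* a d)) (sym (ℚₚ.neg-distribʳ-* d c)) ⟩
    (a * b - a * d) + (d * a - d * c)
      ≡⟨ cong₂ (λ y z → (a * b - a * d) + (y - z)) (ℚₚ.*-comm d a) (ℚₚ.*-comm d c) ⟩
    (a * b - a * d) + (a * d - c * d)
      ≡⟨ cancel-middle (a * b) (a * d) (- (c * d)) ⟩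
    a * b - c * d ∎)
    where open ≡-Reasoning

  half-pos : ∀ {ε} → 0ℚ < ε → 0ℚ < ½ * ε
  half-pos {ε} 0<ε = subst (_< ½ * ε) (ℚₚ.*-zeroʳ ½) (ℚₚ.*-monoʳ-<-pos ½ 0<ε)

  halves : ∀ ε → ½ * ε + ½ * ε ≡ ε
  halves ε = trans (sym (ℚₚ.*-distribʳ-+ ε ½ ½)) (ℚₚ.*-identityˡ ε)

  ∣+∣<ε : ∀ {ε} a b → ∣ a ∣ < ½ * ε → ∣ b ∣ < ½ * ε → ∣ a + b ∣ < ε
  ∣+∣<ε {ε} a b p q = subst (∣ a + b ∣ <_) (halves ε)
    (ℚₚ.≤-<-trans (ℚₚ.∣p+q∣≤∣p∣+∣q∣ a b) (ℚₚ.+-mono-< p q))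

  scale : ∀ {η B} → 0ℚ < η → 0ℚ < B →
          ∃[ δ ] (0ℚ < δ × (∀ a b → ∣ a ∣ < B → ∣ b ∣ < δ → ∣ a * b ∣ < η))
  scale {η} {B} 0<η 0<B = δ , 0<δ , bound
    where
    instance
      B⁺ : Positive B
      B⁺ = positive 0<B
      B≢0 : NonZero B
      B≢0 = ℚₚ.pos⇒nonZero B
      B≥0 : NonNegative B
      B≥0 = ℚₚ.pos⇒nonNeg B
      B⁻¹⁺ : Positive (1/ B)
      B⁻¹⁺ = ℚₚ.1/pos⇒pos B
    δ : ℚ
    δ = 1/ B * η
    0<δ : 0ℚ < δ
    0<δ = subst (_< δ) (ℚₚ.*-zeroʳ (1/ B)) (ℚₚ.*-monoʳ-<-pos (1/ B) 0<η)
    Bδ≡η : B * δ ≡ η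
    Bδ≡η = trans (sym (ℚₚ.*-assoc B (1/ B) η))
                 (trans (cong (_* η) (ℚₚ.*-inverseʳ B)) (ℚₚ.*-identityˡ η))
    bound : ∀ a b → ∣ a ∣ < B → ∣ b ∣ < δ → ∣ a * b ∣ < η
    bound a b a<B b<δ = begin-strict
      ∣ a * b ∣      ≡⟨ ℚₚ.∣p*q∣≡∣p∣*∣q∣ a b ⟩
      ∣ a ∣ * ∣ b ∣  ≤⟨ ℚₚ.*-monoʳ-≤-nonNeg ∣ b ∣ {{ℚₚ.∣-∣-nonNeg b}} (ℚₚ.<⇒≤ a<B) ⟩
      B * ∣ b ∣      <⟨ ℚₚ.*-monoʳ-<-pos B b<δ ⟩
      B * δ          ≡⟨ Bδ≡η ⟩
      η              ∎
      where open ℚₚ.≤-Reasoning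

  eventually-bounded : ∀ x → IsCauchy x →
    ∃[ B ] ∃[ N ] (0ℚ < B × (∀ {m} → N ℕ.≤ m → ∣ x m ∣ < B))
  eventually-bounded x cx = B , N , 0<B , bound
    where
    0<1 : 0ℚ < 1ℚ
    0<1 = ℚₚ.positive⁻¹ 1ℚ
    N : ℕ
    N = proj₁ (cx 1ℚ 0<1)
    B : ℚ
    B = 1ℚ + ∣ x N ∣
    0<B : 0ℚ < B
    0<B = ℚₚ.+-mono-<-≤ 0<1 (ℚₚ.0≤∣p∣ (x N))
    split : ∀ a b → a ≡ (a - b) + b
    split a b = sym (trans (ℚₚ.+-assoc a (- b) b)
      (trans (cong (a +_) (ℚₚ.+-inverseˡ b)) (ℚₚ.+-identityʳ a)))
    bound : ∀ {m} → N ℕ.≤ m → ∣ x m ∣ < B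
    bound {m} N≤m = begin-strict
      ∣ x m ∣                  ≡⟨ cong ∣_∣ (split (x m) (x N)) ⟩
      ∣ (x m - x N) + x N ∣    ≤⟨ ℚₚ.∣p+q∣≤∣p∣+∣q∣ (x m - x N) (x N) ⟩
      ∣ x m - x N ∣ + ∣ x N ∣  <⟨ ℚₚ.+-monoˡ-< ∣ x N ∣ (proj₂ (cx 1ℚ 0<1) N≤m ℕₚ.≤-refl) ⟩
      B                        ∎
      where open ℚₚ.≤-Reasoning

  +-cauchy : ∀ x y → IsCauchy x → IsCauchy y → IsCauchy (λ n → x n + y n)
  +-cauchy x y cx cy ε 0<ε with cx (½ * ε) (half-pos 0<ε) | cy (½ * ε) (half-pos 0<ε)
  ... | M , p | N , q = M ℕ.⊔ N , λ {m} {n} ≤m ≤n →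
    subst (λ z → ∣ z ∣ < ε) (sym (+-difference (x m) (y m) (x n) (y n)))
      (∣+∣<ε (x m - x n) (y m - y n)
        (p (ℕₚ.m⊔n≤o⇒m≤o M N ≤m) (ℕₚ.m⊔n≤o⇒m≤o M N ≤n))
        (q (ℕₚ.m⊔n≤o⇒n≤o M N ≤m) (ℕₚ.m⊔n≤o⇒n≤o M N ≤n)))

  neg-cauchy : ∀ x → IsCauchy x → IsCauchy (λ n → - x n)
  neg-cauchy x cx ε 0<ε with cx ε 0<ε
  ... | N , p = N , λ {m} {n} ≤m ≤n →
    subst (_< ε) (sym (trans (cong ∣_∣ (neg-difference (x m) (x n))) (ℚₚ.∣-p∣≡∣p∣ (x m - x n))))
      (p ≤m ≤n)

  *-cauchy : ∀ x y → IsCauchy x → IsCauchy y → IsCauchy (λ n → x n * y n)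
  *-cauchy x y cx cy ε 0<ε
    with eventually-bounded x cx | eventually-bounded y cy
  ... | B , K , 0<B , x<B | C , L , 0<C , y<C
    with scale (half-pos 0<ε) 0<B | scale (half-pos 0<ε) 0<C
  ... | δ , 0<δ , small | γ , 0<γ , small′
    with cy δ 0<δ | cx γ 0<γ
  ... | M , p | N , q = (K ℕ.⊔ L) ℕ.⊔ (M ℕ.⊔ N) , λ {m} {n} ≤m ≤n →
    subst (λ z → ∣ z ∣ < ε) (sym (*-difference (x m) (y m) (x n) (y n)))
      (∣+∣<ε (x m * (y m - y n)) (y n * (x m - x n))
        (small (x m) (y m - y n) (x<B (ℕₚ.m⊔n≤o⇒m≤o K L (left ≤m)))
          (p (ℕₚ.m⊔n≤o⇒m≤o M N (right ≤m)) (ℕₚ.m⊔n≤o⇒m≤o M N (right ≤n))))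
        (small′ (y n) (x m - x n) (y<C (ℕₚ.m⊔n≤o⇒n≤o K L (left ≤n)))
          (q (ℕₚ.m⊔n≤o⇒n≤o M N (right ≤m)) (ℕₚ.m⊔n≤o⇒n≤o M N (right ≤n)))))
    where
    left : ∀ {k} → (K ℕ.⊔ L) ℕ.⊔ (M ℕ.⊔ N) ℕ.≤ k → K ℕ.⊔ L ℕ.≤ k
    left = ℕₚ.m⊔n≤o⇒m≤o (K ℕ.⊔ L) (M ℕ.⊔ N)
    right : ∀ {k} → (K ℕ.⊔ L) ℕ.⊔ (M ℕ.⊔ N) ℕ.≤ k → M ℕ.⊔ N ℕ.≤ k
    right = ℕₚ.m⊔n≤o⇒n≤o (K ℕ.⊔ L) (M ℕ.⊔ N)

fromℚ : ℚ → ℝ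
fromℚ q = mkℝ (λ _ → q) λ ε 0<ε →
  0 , λ _ _ → subst (λ z → ∣ z ∣ < ε) (sym (ℚₚ.+-inverseʳ q)) 0<ε

infixl 6 _+ᴿ_
infixl 7 _*ᴿ_
infix  8 -ᴿ_

_+ᴿ_ _*ᴿ_ : ℝ → ℝ → ℝ
x +ᴿ y = mkℝ (λ n → seq x n + seq y n) (+-cauchy (seq x) (seq y) (cauchy x) (cauchy y))
x *ᴿ y = mkℝ (λ n → seq x n * seq y n) (*-cauchy (seq x) (seq y) (cauchy x) (cauchy y))

-ᴿ_ : ℝ → ℝ
-ᴿ x = mkℝ (λ n → - seq x n) (neg-cauchy (seq x) (cauchy x))

ℝ-rawRing : RawRing 0ℓ 0ℓ
ℝ-rawRing = record
  { Carrier = ℝ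
  ; _≈_     = _≃ᴿ_
  ; _+_     = _+ᴿ_
  ; _*_     = _*ᴿ_
  ; -_      = -ᴿ_
  ; 0#      = fromℚ 0ℚ
  ; 1#      = fromℚ 1ℚ
  }

module Spectral {c ℓ} (R : RawRing c ℓ) where
  open RawRing R using (Carrier; _≈_; 0#; 1#; rawSemiring)
    renaming (_+_ to _⊕_; _*_ to _⊗_; -_ to ⊖_)
  open RawSemiringDefs rawSemiring using (sum; _^_)

  Matrix : ℕ → Set c
  Matrix n = Fin n → Fin n → Carrier

  minor : ∀ {n} → Matrix (suc n) → Fin (suc n) → Matrix n
  minor M j a b = M (suc a) (punchIn j b)

  det : ∀ {n} → Matrix n → Carrier
  det {zero}  M = 1#
  det {suc n} M = sum λ j → (⊖ 1#) ^ toℕ j ⊗ (M zero j ⊗ det (minor M j))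

  charMatrix : ∀ {n} → Matrix n → Carrier → Matrix n
  charMatrix M t i j = (if does (i ≟ j) then t else 0#) ⊕ ⊖ M i j

  charPoly : ∀ {n} → Matrix n → Carrier → Carrier
  charPoly M t = det (charMatrix M t)

  -- The list holds all eigenvalues with multiplicity, i.e. all roots of the
  -- characteristic polynomial.  Over an infinite field such as ℝ it is
  -- enough to compare the two sides as polynomial functions.
  HasEigenvalues : ∀ {n} → Matrix n → List Carrier → Set (c ⊔ ℓ)
  HasEigenvalues {n} M λs = length λs ≡ n ×
    (∀ t → charPoly M t ≈ List.foldr (λ x p → (t ⊕ ⊖ x) ⊗ p) 1# λs)

  infix 4 _↭_
  _↭_ : List Carrier → List Carrier → Set (c ⊔ ℓ)
  _↭_ = Permutation _≈_

record Graph : Set where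
  field
    order      : ℕ
    adj        : Fin order → Fin order → Bool
    adj-sym    : ∀ u v → adj u v ≡ adj v u
    adj-irrefl : ∀ v → adj v v ≡ false

  Adjacent : Fin order → Fin order → Set
  Adjacent u v = adj u v ≡ true

open Graph public

adjacencyMatrix : (G : Graph) → Spectral.Matrix ℝ-rawRing (order G)
adjacencyMatrix G u v = if adj G u v then fromℚ 1ℚ else fromℚ 0ℚ

-- Adjacency matrices are symmetric, so all their eigenvalues are real.
Cospectral : Graph → Graph → Set
Cospectral G H = ∃[ λs ] ∃[ μs ]
  (HasEigenvalues (adjacencyMatrix G) λs ×
   HasEigenvalues (adjacencyMatrix H) μs ×
   λs ↭ μs)
  where open Spectral ℝ-rawRing

-- The graph without vertices does not count as connected.
Connected : Graph → Set
Connected G = 1 ℕ.≤ order G × (∀ u v → Star (Adjacent G) u v)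

infix 4 _≅_
_≅_ : Graph → Graph → Set
G ≅ H = Σ (Fin (order G) ↔ Fin (order H)) λ f →
  ∀ u v → adj G u v ≡ adj H (Inverse.to f u) (Inverse.to f v)

private
  ≟-sym : ∀ {n} (i j : Fin n) → does (i ≟ j) ≡ does (j ≟ i)
  ≟-sym i j with i ≟ j | j ≟ i
  ... | yes _ | yes _ = refl
  ... | no  _ | no  _ = refl
  ... | yes p | no ¬q = contradiction (sym p) ¬q
  ... | no ¬p | yes q = contradiction (sym q) ¬p

  ≟-refl : ∀ {n} (i : Fin n) → does (i ≟ i) ≡ true
  ≟-refl i with i ≟ i
  ... | yes _ = refl
  ... | no ¬p = contradiction refl ¬p

complete : ℕ → Graph
complete n = record
  { order      = n
  ; adj        = λ u v → not (does (u ≟ v))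
  ; adj-sym    = λ u v → cong not (≟-sym u v)
  ; adj-irrefl = λ v → cong not (≟-refl v)
  }

K₂ : Graph
K₂ = complete 2

infixr 5 _⊎ᴳ_
_⊎ᴳ_ : Graph → Graph → Graph
G ⊎ᴳ H = record
  { order      = order G ℕ.+ order H
  ; adj        = λ u v → adj⊎ (splitAt (order G) u) (splitAt (order G) v)
  ; adj-sym    = λ u v → adj⊎-sym (splitAt (order G) u) (splitAt (order G) v)
  ; adj-irrefl = λ v → adj⊎-irrefl (splitAt (order G) v)
  }
  where
  V : Set
  V = Fin (order G) ⊎ Fin (order H)

  adj⊎ : V → V → Bool
  adj⊎ (inj₁ u) (inj₁ v) = adj G u v
  adj⊎ (inj₂ u) (inj₂ v) = adj H u v
  adj⊎ _        _        = false

  adj⊎-sym : ∀ u v → adj⊎ u v ≡ adj⊎ v u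
  adj⊎-sym (inj₁ u) (inj₁ v) = adj-sym G u v
  adj⊎-sym (inj₁ u) (inj₂ v) = refl
  adj⊎-sym (inj₂ u) (inj₁ v) = refl
  adj⊎-sym (inj₂ u) (inj₂ v) = adj-sym H u v

  adj⊎-irrefl : ∀ v → adj⊎ v v ≡ false
  adj⊎-irrefl (inj₁ v) = adj-irrefl G v
  adj⊎-irrefl (inj₂ v) = adj-irrefl H v

copies : ℕ → Graph → Graph
copies zero    G = complete 0
copies (suc k) G = G ⊎ᴳ copies k G

-- Vertex zero is the common vertex.  Vertex suc u, where remQuot 2 u = (i , a),
-- is the a-th of the two remaining vertices of the i-th triangle.
friendship : ℕ → Graph
friendship n = record
  { order      = suc (n ℕ.* 2)
  ; adj        = adjF
  ; adj-sym    = adjF-sym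
  ; adj-irrefl = adjF-irrefl
  }
  where
  sameTriangle : Fin n × Fin 2 → Fin n × Fin 2 → Bool
  sameTriangle (i , a) (j , b) = does (i ≟ j) ∧ not (does (a ≟ b))

  sameTriangle-sym : ∀ p q → sameTriangle p q ≡ sameTriangle q p
  sameTriangle-sym (i , a) (j , b) = cong₂ _∧_ (≟-sym i j) (cong not (≟-sym a b))

  sameTriangle-irrefl : ∀ p → sameTriangle p p ≡ false
  sameTriangle-irrefl (i , a) =
    trans (cong (λ z → does (i ≟ i) ∧ not z) (≟-refl a)) (∧-zeroʳ (does (i ≟ i)))

  adjF : Fin (suc (n ℕ.* 2)) → Fin (suc (n ℕ.* 2)) → Bool
  adjF zero    zero    = false
  adjF zero    (suc v) = true
  adjF (suc u) zero    = true
  adjF (suc u) (suc v) = sameTriangle (remQuot 2 u) (remQuot 2 v)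

  adjF-sym : ∀ u v → adjF u v ≡ adjF v u
  adjF-sym zero    zero    = refl
  adjF-sym zero    (suc v) = refl
  adjF-sym (suc u) zero    = refl
  adjF-sym (suc u) (suc v) = sameTriangle-sym (remQuot 2 u) (remQuot 2 v)

  adjF-irrefl : ∀ v → adjF v v ≡ false
  adjF-irrefl zero    = refl
  adjF-irrefl (suc v) = sameTriangle-irrefl (remQuot 2 v)

{-# OPTIONS --safe #-}
-- The friendship graph with a triangles has its eigenvalues among ±1 and the
-- two roots of x² - x - 2a, the positive root being simple.  Characteristic
-- polynomials determine the traces of all powers: modulo y = x ^ L one has
-- det ((1 + y) I - x A) ≡ det (I - x A) (1 + y Σ_{k < L} x ^ k tr (A ^ k)),
-- up to terms in y².  Hence a cospectral graph satisfies
-- tr Q(A)² = 0, and so Q(A) = 0, for Q = (x² - 1)(x² - x - 2a), and the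
-- eigenspace of the positive root θ of x² - x - 2a is one-dimensional.  Let X be
-- (A² - 1)(A + θ - 1), a multiple of the projection onto that line.  A vertex of
-- degree at least 2 has a positive diagonal entry in X, so two such vertices i, j
-- with X i j = 0 would give two orthogonal directions in a line.  Thus X i j ≠ 0,
-- which yields a walk of length at most 3 from i to j.  There is no isolated
-- vertex, as Q(0) ≠ 0, so whatever is not linked to a vertex of degree at least 2
-- is a copy of K₂.
module Submission where

open import Algebra.Bundles using (RawRing; CommutativeRing)
import Algebra.Definitions.RawSemiring as RawSemiringDefs
import Algebra.Properties.Semiring.Sum as SemiringSum
import Algebra.Solver.Ring as RingNormalForm
import Algebra.Solver.Ring.AlmostCommutativeRing as Coefficients
open import Algebra.Structures using (IsCommutativeRing)
open import Data.Bool.Base using (true; false; _∧_; not; if_then_else_)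
import Data.Bool.Properties as Bool
open import Data.Fin.Base using (Fin; zero; suc; toℕ; punchIn; punchOut; inject₁; splitAt; remQuot; combine)
open import Data.Fin.Induction using (<-weakInduction)
import Data.Fin.Permutation as Permutation
open import Data.Fin.Properties using (_≟_; any?; punchIn-punchOut; punchInᵢ≢i; toℕ-inject₁; suc-injective; punchIn-injective; remQuot-combine; combine-remQuot)
open import Data.Integer.Base as ℤ using (ℤ; +_; -[1+_]; _+_; _*_; _-_; -_; 0ℤ; 1ℤ; NonZero; ≢-nonZero)
open import Data.Integer.Divisibility.Signed using (_∣_; divides; ∣m∣n⇒∣m+n; ∣m⇒∣m*n; ∣n⇒∣m*n; *-cancelʳ-∣; ∣⇒∣ᵤ)
import Data.Integer.Properties as ℤ
open import Data.Integer.Tactic.RingSolver using (solve-∀)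
open import Data.List.Base as List using (List; length)
open import Data.List.Relation.Binary.Permutation.Homogeneous as Perm using (Permutation)
open import Data.List.Relation.Binary.Pointwise.Base as Pointwise using (Pointwise)
open import Data.List.Relation.Binary.Pointwise.Properties using (Pointwise-length)
open import Data.Nat.Base as ℕ using (ℕ; zero; suc; _≤_)
import Data.Nat.Coprimality as Coprimality
import Data.Nat.Divisibility as ℕ
import Data.Nat.Properties as ℕ
open import Data.Product.Base using (Σ; _×_; ∃-syntax; _,_; proj₁; proj₂)
open import Data.Rational.Base as ℚ using (ℚ; mkℚ; 0ℚ; 1ℚ; ½)
import Data.Rational.Properties as ℚ
import Data.Rational.Unnormalised.Properties as ℚᵘ
import Data.Rational.Unnormalised.Base as ℚᵘ
open import Data.Sum.Base using (_⊎_; inj₁; inj₂)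
open import Data.Vec.Functional using (updateAt; insertAt; _∷_; tail)
open import Data.Vec.Functional.Properties using (map-updateAt; updateAt-updates; updateAt-minimal; updateAt-id-local; updateAt-commutes; insertAt-lookup; insertAt-punchIn)
open import Defs
open import Function.Base using (_∘_; const)
open import Function.Bundles using (_↔_; Inverse)
open import Level using (0ℓ)
open import Relation.Binary.Construct.Closure.ReflexiveTransitive using (Star; ε; _◅_; _◅◅_; reverse)
open import Relation.Binary.PropositionalEquality
open import Relation.Nullary using (Dec; ¬_; ¬?; _×-dec_; does; yes; no; contradiction)
open import Relation.Nullary.Decidable using (dec⇒maybe; decidable-stable; map′)
import Tactic.RingSolver as RingSolver
import Tactic.RingSolver.Core.AlmostCommutativeRing as ACR

open ≡-Reasoning

-- Equality of Cauchy reals is undecidable, so eigenvalues and eigenvectors are never handled: only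
-- the lengths of the two eigenvalue lists and the values of the characteristic polynomials at
-- rational points are taken from the hypothesis. At a rational point both determinants are constant
-- sequences, hence equal in `ℚ` and, after clearing denominators, in `ℤ`. No polynomial
-- coefficients are extracted from these values either. Congruences modulo powers of an integer x
-- take their place, because an integer divisible by every positive x is zero.
--
-- The root θ enters as 1 + η, with η a formal symbol satisfying η² = 2a - η. The ring `ℤ[η]` may
-- have zero divisors (x² + x - 2a splits for a = 1), so nothing is divided there. Positivity of
-- squares, on which orthogonality arguments rest, is recovered from the coefficient `constant`: on
-- the square of c + bη it equals c² + 2ab². It is a positive combination of the two real values of
-- c + bη, because the roots of x² + x - 2a have opposite signs.

module RawRingHom (R S : RawRing 0ℓ 0ℓ) (h : RawRing.Carrier R → RawRing.Carrier S)
  (+-homo : ∀ x y → h (RawRing._+_ R x y) ≡ RawRing._+_ S (h x) (h y))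
  (*-homo : ∀ x y → h (RawRing._*_ R x y) ≡ RawRing._*_ S (h x) (h y))
  (-‿homo : ∀ x → h (RawRing.-_ R x) ≡ RawRing.-_ S (h x))
  (0-homo : h (RawRing.0# R) ≡ RawRing.0# S)
  (1-homo : h (RawRing.1# R) ≡ RawRing.1# S)
  where
  private
    module R = RawRing R
    module S = RawRing S
    module SR = Spectral R
    module SS = Spectral S
    module DR = RawSemiringDefs R.rawSemiring
    module DS = RawSemiringDefs S.rawSemiring

  sum-homo : ∀ {n} {f : Fin n → R.Carrier} {g} → (∀ i → h (f i) ≡ g i) → h (DR.sum f) ≡ DS.sum g
  sum-homo {zero}  e = 0-homo
  sum-homo {suc n} e = trans (+-homo _ _) (cong₂ S._+_ (e zero) (sum-homo (e ∘ suc)))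

  ^-homo : ∀ x k → h (x DR.^ k) ≡ h x DS.^ k
  ^-homo x zero    = 1-homo
  ^-homo x (suc k) = trans (*-homo _ _) (cong (h x S.*_) (^-homo x k))

  -- No ring laws are assumed, so `ℝ-rawRing` qualifies. The map will be the identity of `ℤ` (which
  -- gives congruence), the k-th term of a Cauchy sequence, and the embedding of `ℤ` in `ℚ`.
  det-homo : ∀ {n} {M : SR.Matrix n} {N : SS.Matrix n} →
             (∀ i j → h (M i j) ≡ N i j) → h (SR.det M) ≡ SS.det N
  det-homo {zero}  e = 1-homo
  det-homo {suc n} e = sum-homo λ j → trans (*-homo _ _) (cong₂ S._*_
    (trans (^-homo (R.- R.1#) (toℕ j))
      (cong (DS._^ toℕ j) (trans (-‿homo _) (cong S.-_ 1-homo))))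
    (trans (*-homo _ _) (cong₂ S._*_ (e zero j) (det-homo λ a b → e (suc a) (punchIn j b)))))

open SemiringSum (CommutativeRing.semiring ℤ.+-*-commutativeRing) using (sum; sum-cong-≗; ∑-distrib-+; ∑-comm; *-distribˡ-sum; *-distribʳ-sum; sum-replicate-zero; sum-remove)
open RawSemiringDefs (RawRing.rawSemiring ℤ.+-*-rawRing) using (_^_)
open Spectral ℤ.+-*-rawRing using (Matrix; minor; det)

private
  variable
    m n : ℕ

Row : ℕ → Set
Row n = Fin n → ℤ

-- Finite sums

sum-zero : {f : Row n} → (∀ i → f i ≡ 0ℤ) → sum f ≡ 0ℤ
sum-zero {n} e = trans (sum-cong-≗ e) (sum-replicate-zero n)

sum-linear : ∀ c {f g h : Row n} → (∀ i → h i ≡ c * f i + g i) → sum h ≡ c * sum f + sum g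
sum-linear c {f} {g} e = trans (sum-cong-≗ e) (trans (∑-distrib-+ (λ i → c * f i) g)
  (cong (_+ sum g) (sym (*-distribˡ-sum c f))))

I : Matrix n
I i j = if does (i ≟ j) then 1ℤ else 0ℤ

I-diagonal : ∀ (i : Fin n) → I i i ≡ 1ℤ
I-diagonal i with i ≟ i
... | yes _  = refl
... | no i≢i = contradiction refl i≢i

I-off-diagonal : ∀ {i j : Fin n} → i ≢ j → I i j ≡ 0ℤ
I-off-diagonal {i = i} {j} i≢j with i ≟ j
... | yes i≡j = contradiction i≡j i≢j
... | no _    = refl

I-sym : ∀ (i j : Fin n) → I i j ≡ I j i
I-sym i j with i ≟ j
... | yes refl = sym (I-diagonal i)
... | no  i≢j  = sym (I-off-diagonal (i≢j ∘ sym))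

sum-I : ∀ (f : Row n) i → sum (λ j → I i j * f j) ≡ f i
sum-I {suc n} f zero    = trans (cong₂ _+_ (ℤ.*-identityˡ (f zero)) (sum-zero {n} λ _ → refl)) (ℤ.+-identityʳ _)
sum-I {suc n} f (suc i) = trans (ℤ.+-identityˡ _) (sum-I (f ∘ suc) i)

-- Determinants

sign : Fin n → ℤ
sign j = (- 1ℤ) ^ toℕ j

det-cong : {M N : Matrix n} → (∀ i j → M i j ≡ N i j) → det M ≡ det N
det-cong = RawRingHom.det-homo ℤ.+-*-rawRing ℤ.+-*-rawRing (λ x → x)
  (λ _ _ → refl) (λ _ _ → refl) (λ _ → refl) refl refl

infixl 9 _[_≔_]
_[_≔_] : (Fin m → Row n) → Fin m → Row n → Fin m → Row n
M [ i ≔ r ] = updateAt M i (const r)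

≔-∘ : ∀ {k} (p : Fin k → Fin n) (M : Fin m → Row n) i r a b →
      (M [ i ≔ r ]) a (p b) ≡ ((λ a b → M a (p b)) [ i ≔ r ∘ p ]) a b
≔-∘ p M i r a b = cong (λ f → f b) (map-updateAt {f = _∘ p} {g = const r} {h = const (r ∘ p)} (λ _ → refl) M i a)

≔-self : ∀ (M : Fin m → Row n) i a b → (M [ i ≔ M i ]) a b ≡ M a b
≔-self M i a b = cong (λ f → f b) (updateAt-id-local i {const (M i)} M refl a)

-- `D` is kept abstract because, besides `det`, the forms `restrict j` and `λ M → det (M ⊡ N)` are
-- treated. The one equation for c u + v covers additivity and homogeneity.
record Multilinear (D : Matrix n → ℤ) : Set where
  field
    D-cong : ∀ {M N} → (∀ i j → M i j ≡ N i j) → D M ≡ D N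
    linear : ∀ M i c u v → D (M [ i ≔ (λ j → c * u j + v j) ]) ≡ c * D (M [ i ≔ u ]) + D (M [ i ≔ v ])

  ≔-cong : ∀ M i {u v} → (∀ j → u j ≡ v j) → D (M [ i ≔ u ]) ≡ D (M [ i ≔ v ])
  ≔-cong M i {u} {v} e = D-cong pointwise
    where
    pointwise : ∀ a b → (M [ i ≔ u ]) a b ≡ (M [ i ≔ v ]) a b
    pointwise a b with a ≟ i
    ... | yes refl = trans (cong (λ f → f b) (updateAt-updates a M))
                       (trans (e b) (cong (λ f → f b) (sym (updateAt-updates a M))))
    ... | no  a≢i  = trans (cong (λ f → f b) (updateAt-minimal a i M a≢i))
                       (cong (λ f → f b) (sym (updateAt-minimal a i M a≢i)))

  linear-sum : ∀ M i {k} (c : Row k) (u : Fin k → Row n) →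
               D (M [ i ≔ (λ l → sum (λ j → c j * u j l)) ]) ≡ sum (λ j → c j * D (M [ i ≔ u j ]))
  -- The zero row is 1 · 0 + 0, so its value x satisfies x = 1 · x + x.
  linear-sum M i {zero} c u = zero-row (trans (≔-cong M i (λ _ → refl)) (linear M i 1ℤ (const 0ℤ) (const 0ℤ)))
    where
    zero-row : ∀ {x} → x ≡ 1ℤ * x + x → x ≡ 0ℤ
    zero-row {x} e = trans (subtract x) (ℤ.i≡j⇒i-j≡0 (sym e))
      where
      subtract : ∀ x → x ≡ 1ℤ * x + x - x
      subtract = solve-∀
  linear-sum M i {suc k} c u = trans (linear M i (c zero) (u zero) _)
    (cong (λ x → c zero * D (M [ i ≔ u zero ]) + x) (linear-sum M i (c ∘ suc) (u ∘ suc)))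

  row-expansion : ∀ M i w → D (M [ i ≔ w ]) ≡ sum (λ j → w j * D (M [ i ≔ I j ]))
  row-expansion M i w = trans (≔-cong M i expand) (linear-sum M i w I)
    where
    expand : ∀ l → w l ≡ sum (λ j → w j * I j l)
    expand l = trans (sym (sum-I w l)) (sum-cong-≗ λ j → trans (ℤ.*-comm (I l j) (w j)) (cong (w j *_) (I-sym l j)))

  module _ {p q} (p≢q : p ≢ q) (alt : ∀ M → (∀ k → M p k ≡ M q k) → D M ≡ 0ℤ) where

    -- Polarisation: with the row x + y at both p and q the form vanishes, and so do the two
    -- diagonal terms of its expansion. Vanishing is required only for the one pair p, q, so that
    -- the lemma is available before `det` is known to be alternating.
    exchange : ∀ M → D (M [ p ≔ M q ] [ q ≔ M p ]) ≡ - D M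
    exchange M = begin
      F y x          ≡⟨ cancel (F x x) (F x y) (F y x) (F y y) (diag x) (diag y) total ⟩
      - F x y        ≡⟨ cong -_ (D-cong λ a b → trans (restore a b) (≔-self M p a b)) ⟩
      - D M          ∎
      where
      x y : Row n
      x = M p
      y = M q
      F : Row n → Row n → ℤ
      F u v = D (M [ p ≔ u ] [ q ≔ v ])
      s : Row n
      s j = 1ℤ * x j + y j
      diag : ∀ u → F u u ≡ 0ℤ
      diag u = alt _ λ k → cong (λ f → f k)
        (trans (updateAt-minimal p q (M [ p ≔ u ]) p≢q)
          (trans (updateAt-updates p M) (sym (updateAt-updates q (M [ p ≔ u ])))))
      flip-update : ∀ u v → F u v ≡ D (M [ q ≔ v ] [ p ≔ u ])
      flip-update u v = D-cong λ a b → cong (λ f → f b) (updateAt-commutes q p (p≢q ∘ sym) M a)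
      linearˡ : ∀ v → F s v ≡ 1ℤ * F x v + F y v
      linearˡ v = trans (flip-update s v) (trans (linear (M [ q ≔ v ]) p 1ℤ x y)
        (sym (cong₂ (λ a b → 1ℤ * a + b) (flip-update x v) (flip-update y v))))
      total : 1ℤ * (1ℤ * F x x + F y x) + (1ℤ * F x y + F y y) ≡ 0ℤ
      total = trans (sym (trans (linear (M [ p ≔ s ]) q 1ℤ x y)
        (cong₂ (λ a b → 1ℤ * a + b) (linearˡ x) (linearˡ y)))) (diag s)
      cancel : ∀ a b c d → a ≡ 0ℤ → d ≡ 0ℤ → 1ℤ * (1ℤ * a + c) + (1ℤ * b + d) ≡ 0ℤ → c ≡ - b
      cancel a b c d refl refl e = trans (split b c) (trans (cong (_- b) e) (ℤ.+-identityˡ (- b)))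
        where
        split : ∀ b c → c ≡ (1ℤ * (1ℤ * 0ℤ + c) + (1ℤ * b + 0ℤ)) - b
        split = solve-∀
      restore : ∀ a b → (M [ p ≔ x ] [ q ≔ y ]) a b ≡ (M [ p ≔ x ]) a b
      restore a b = cong (λ f → f b) (updateAt-id-local q {const y} (M [ p ≔ x ])
        (sym (updateAt-minimal q p M (p≢q ∘ sym))) a)

det-multilinear : Multilinear (det {n})
det-multilinear {n} = record { D-cong = det-cong ; linear = det-linear n }
  where
  distrib : ∀ s c u v d → s * ((c * u + v) * d) ≡ c * (s * (u * d)) + s * (v * d)
  distrib = solve-∀
  distrib′ : ∀ s c u x y → s * (u * (c * x + y)) ≡ c * (s * (u * x)) + s * (u * y)
  distrib′ = solve-∀
  det-linear : ∀ n (M : Matrix n) i c u v →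
    det (M [ i ≔ (λ j → c * u j + v j) ]) ≡ c * det (M [ i ≔ u ]) + det (M [ i ≔ v ])
  det-linear (suc n) M zero c u v =
    sum-linear c λ j → distrib (sign j) c (u j) (v j) (det (minor M j))
  det-linear (suc (suc n)) M (suc i) c u v = sum-linear c λ j → begin
    sign j * (M zero j * det (minor (M [ suc i ≔ (λ l → c * u l + v l) ]) j))
      ≡⟨ cong (λ d → sign j * (M zero j * d)) (trans (det-cong (≔-∘ (punchIn j) (tail M) i _))
           (det-linear (suc n) (minor M j) i c (u ∘ punchIn j) (v ∘ punchIn j))) ⟩
    sign j * (M zero j * (c * det (minor M j [ i ≔ u ∘ punchIn j ]) + det (minor M j [ i ≔ v ∘ punchIn j ])))
      ≡⟨ distrib′ (sign j) c (M zero j) _ _ ⟩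
    c * (sign j * (M zero j * det (minor M j [ i ≔ u ∘ punchIn j ]))) + sign j * (M zero j * det (minor M j [ i ≔ v ∘ punchIn j ]))
      ≡⟨ cong₂ (λ x y → c * (sign j * (M zero j * x)) + sign j * (M zero j * y))
           (det-cong (≔-∘ (punchIn j) (tail M) i u)) (det-cong (≔-∘ (punchIn j) (tail M) i v)) ⟨
    c * (sign j * (M zero j * det (minor (M [ suc i ≔ u ]) j))) + sign j * (M zero j * det (minor (M [ suc i ≔ v ]) j))
      ∎

-- The terms for the ordered pairs of columns (a, b) and (b, a) cancel.
double-expansion : ∀ m (c : Fin (2 ℕ.+ m) → Fin (2 ℕ.+ m) → ℤ) (d : (Fin m → Fin (2 ℕ.+ m)) → ℤ) →
  (∀ a b → c a b ≡ c b a) → (∀ {e e′} → (∀ b → e b ≡ e′ b) → d e ≡ d e′) →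
  sum (λ j → sum (λ k → sign j * (sign k * (c j (punchIn j k) * d (λ b → punchIn j (punchIn k b)))))) ≡ 0ℤ
-- The pairs that contain column zero cancel by `opposite`; those that avoid it form the same kind
-- of sum with one column fewer.
double-expansion m c d c-sym d-cong = begin
  sum (term zero) + sum (λ j → term (suc j) zero + sum (term (suc j) ∘ suc))
    ≡⟨ cong (λ x → sum (term zero) + x) (∑-distrib-+ (λ j → term (suc j) zero) (λ j → sum (term (suc j) ∘ suc))) ⟩
  sum (term zero) + (sum (λ j → term (suc j) zero) + sum (λ j → sum (term (suc j) ∘ suc)))
    ≡⟨ ℤ.+-assoc (sum (term zero)) _ _ ⟨
  sum (term zero) + sum (λ j → term (suc j) zero) + sum (λ j → sum (term (suc j) ∘ suc))
    ≡⟨ cong₂ _+_ (trans (sym (∑-distrib-+ (term zero) (λ j → term (suc j) zero))) (sum-zero opposite)) (rest m c d c-sym d-cong) ⟩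
  0ℤ ∎
  where
  term : Fin (2 ℕ.+ m) → Fin (1 ℕ.+ m) → ℤ
  term j k = sign j * (sign k * (c j (punchIn j k) * d (λ b → punchIn j (punchIn k b))))
  cancel : ∀ s x → 1ℤ * (s * x) + (- 1ℤ) * s * (1ℤ * x) ≡ 0ℤ
  cancel = solve-∀
  opposite : ∀ j → term zero j + term (suc j) zero ≡ 0ℤ
  opposite j = trans (cong (λ x → 1ℤ * (sign j * (x * d (λ b → suc (punchIn j b)))) + term (suc j) zero) (c-sym zero (suc j)))
                     (cancel (sign j) (c (suc j) zero * d (λ b → suc (punchIn j b))))
  rest : ∀ m (c : Fin (2 ℕ.+ m) → Fin (2 ℕ.+ m) → ℤ) (d : (Fin m → Fin (2 ℕ.+ m)) → ℤ) →
    (∀ a b → c a b ≡ c b a) → (∀ {e e′} → (∀ b → e b ≡ e′ b) → d e ≡ d e′) →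
    sum (λ j → sum (λ k → sign (suc j) * (sign (suc k) * (c (suc j) (suc (punchIn j k)) * d (λ b → punchIn (suc j) (punchIn (suc k) b)))))) ≡ 0ℤ
  rest zero    c d c-sym d-cong = refl
  rest (suc m) c d c-sym d-cong = trans
    (sum-cong-≗ λ j → sum-cong-≗ λ k → trans
      (signs (sign j) (sign k) (c (suc j) (suc (punchIn j k))) (d (λ b → punchIn (suc j) (punchIn (suc k) b))))
      (cong (λ x → sign j * (sign k * (c (suc j) (suc (punchIn j k)) * x))) (d-cong (shifted j k))))
    (double-expansion m (λ a b → c (suc a) (suc b)) (λ e → d (shift e)) (λ a b → c-sym (suc a) (suc b))
      (λ e → d-cong λ { zero → refl ; (suc b) → cong suc (e b) }))
    where
    -- When both removed columns are positive, column zero remains and comes first. `d` is arbitrary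
    -- so that its composite with `shift` can take its place in the recursion.
    shift : (Fin m → Fin (2 ℕ.+ m)) → Fin (suc m) → Fin (3 ℕ.+ m)
    shift e zero    = zero
    shift e (suc b) = suc (e b)
    shifted : ∀ j k b → punchIn (suc j) (punchIn (suc k) b) ≡ shift (λ b → punchIn j (punchIn k b)) b
    shifted j k zero    = refl
    shifted j k (suc b) = refl
    signs : ∀ s t x y → (- 1ℤ) * s * ((- 1ℤ) * t * (x * y)) ≡ s * (t * (x * y))
    signs = solve-∀

first-rows-equal : ∀ (M : Matrix (2 ℕ.+ n)) → (∀ k → M zero k ≡ M (suc zero) k) → det M ≡ 0ℤ
first-rows-equal {n} M e = begin
  sum (λ j → sign j * (M zero j * sum (λ k → sign k * (M (suc zero) (punchIn j k) * d j k))))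
    ≡⟨ sum-cong-≗ (λ j → begin
         sign j * (M zero j * sum (λ k → sign k * (M (suc zero) (punchIn j k) * d j k)))
           ≡⟨ ℤ.*-assoc (sign j) (M zero j) (sum (λ k → sign k * (M (suc zero) (punchIn j k) * d j k))) ⟨
         sign j * M zero j * sum (λ k → sign k * (M (suc zero) (punchIn j k) * d j k))
           ≡⟨ *-distribˡ-sum (sign j * M zero j) (λ k → sign k * (M (suc zero) (punchIn j k) * d j k)) ⟩
         sum (λ k → sign j * M zero j * (sign k * (M (suc zero) (punchIn j k) * d j k)))
           ≡⟨ sum-cong-≗ (λ k → regroup (sign j) (M zero j) (sign k) (M (suc zero) (punchIn j k)) (d j k)) ⟩
         sum (λ k → sign j * (sign k * (M zero j * M (suc zero) (punchIn j k) * d j k))) ∎) ⟩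
  sum (λ j → sum (λ k → sign j * (sign k * (M zero j * M (suc zero) (punchIn j k) * d j k))))
    ≡⟨ double-expansion n (λ a b → M zero a * M (suc zero) b) (λ f → det (λ a b → M (suc (suc a)) (f b)))
         (λ a b → trans (cong₂ _*_ (e a) (sym (e b))) (ℤ.*-comm (M (suc zero) a) (M zero b)))
         (λ f≗g → det-cong λ a b → cong (M (suc (suc a))) (f≗g b)) ⟩
  0ℤ ∎
  where
  d : Fin (2 ℕ.+ n) → Fin (1 ℕ.+ n) → ℤ
  d j k = det (λ a b → M (suc (suc a)) (punchIn j (punchIn k b)))
  regroup : ∀ s x t y z → s * x * (t * (y * z)) ≡ s * (t * (x * y * z))
  regroup = solve-∀

-- The repeated row is brought to position one by exchanging two rows below the first. `below`
-- supplies the alternation needed for that exchange, and `first-rows-equal` finishes.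
first-row-repeated : (∀ (M : Matrix (suc n)) p q → p ≢ q → (∀ k → M (suc p) k ≡ M (suc q) k) → det M ≡ 0ℤ) →
                     ∀ (M : Matrix (suc n)) q → (∀ k → M zero k ≡ M (suc q) k) → det M ≡ 0ℤ
first-row-repeated {suc n}       below M zero    e = first-rows-equal M e
first-row-repeated {suc (suc n)} below M (suc r) e = begin
  det M        ≡⟨ ℤ.neg-involutive (det M) ⟨
  - (- det M)  ≡⟨ cong -_ (exchange {suc zero} {suc (suc r)} (λ ()) (λ N → below N zero (suc r) (λ ())) M) ⟨
  - det M′     ≡⟨ cong -_ (first-rows-equal M′ e) ⟩
  0ℤ           ∎
  where
  open Multilinear (det-multilinear {suc (suc (suc n))})
  M′ : Matrix (suc (suc (suc n)))
  M′ = M [ suc zero ≔ M (suc (suc r)) ] [ suc (suc r) ≔ M (suc zero) ]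

det-alternating : ∀ (M : Matrix n) p q → p ≢ q → (∀ k → M p k ≡ M q k) → det M ≡ 0ℤ
det-alternating {suc n} M = cases
  where
  vanish : ∀ s x → s * (x * 0ℤ) ≡ 0ℤ
  vanish = solve-∀
  below : ∀ (M : Matrix (suc n)) p q → p ≢ q → (∀ k → M (suc p) k ≡ M (suc q) k) → det M ≡ 0ℤ
  below M p q p≢q e = sum-zero λ j → trans
    (cong (λ d → sign j * (M zero j * d)) (det-alternating (minor M j) p q p≢q (λ k → e (punchIn j k))))
    (vanish (sign j) (M zero j))
  cases : ∀ p q → p ≢ q → (∀ k → M p k ≡ M q k) → det M ≡ 0ℤ
  cases zero    zero    p≢q e = contradiction refl p≢q
  cases zero    (suc q) p≢q e = first-row-repeated below M q e
  cases (suc p) zero    p≢q e = first-row-repeated below M p (sym ∘ e)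
  cases (suc p) (suc q) p≢q e = below M p q (p≢q ∘ cong suc) e

-- Alternating forms and multiplicativity of the determinant

_∷ʳᵒʷ_ : Row n → (Fin m → Row n) → Fin (suc m) → Row n
_∷ʳᵒʷ_ = _∷_

-- Invariance under a change of one row extends to all rows. The number of rows is independent of
-- their length because the induction freezes rows one at a time while the length stays fixed.
replace-rows : (f : (Fin m → Row n) → ℤ) (_~_ : Row n → Row n → Set) →
  (∀ {S T} → (∀ a b → S a b ≡ T a b) → f S ≡ f T) →
  (∀ T a {x y} → x ~ y → f (T [ a ≔ x ]) ≡ f (T [ a ≔ y ])) →
  ∀ {S T} → (∀ a → S a ~ T a) → f S ≡ f T
replace-rows {zero}  f _~_ ext inv e = ext λ ()
replace-rows {suc m} {n} f _~_ ext inv {S} {T} e = begin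
  f S                         ≡⟨ ext (λ { zero b → refl ; (suc a) b → refl }) ⟩
  f (S [ zero ≔ S zero ])     ≡⟨ inv S zero (e zero) ⟩
  f (S [ zero ≔ T zero ])     ≡⟨ ext (λ { zero b → refl ; (suc a) b → refl }) ⟩
  f (T zero ∷ʳᵒʷ tail S)      ≡⟨ replace-rows (λ U → f (T zero ∷ʳᵒʷ U)) _~_
                                   (λ e → ext λ { zero b → refl ; (suc a) b → e a b })
                                   (λ U a {x} {y} x~y → trans (push U a x) (trans (inv (T zero ∷ʳᵒʷ U) (suc a) x~y) (sym (push U a y))))
                                   (λ a → e (suc a)) ⟩
  f (T zero ∷ʳᵒʷ tail T)      ≡⟨ ext (λ { zero b → refl ; (suc a) b → refl }) ⟩
  f T                         ∎
  where
  push : ∀ U a (x : Row n) → f (T zero ∷ʳᵒʷ (U [ a ≔ x ])) ≡ f ((T zero ∷ʳᵒʷ U) [ suc a ≔ x ])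
  push U a x = ext λ { zero b → refl ; (suc a) b → refl }

punchIn-view : ∀ (j l : Fin (suc n)) → j ≡ l ⊎ ∃[ b ] punchIn j b ≡ l
punchIn-view j l with j ≟ l
... | yes j≡l = inj₁ j≡l
... | no  j≢l = inj₂ (punchOut j≢l , punchIn-punchOut j≢l)

insertAt-unique : ∀ (j : Fin (suc n)) (r : Row n) (f : Row (suc n)) →
  f j ≡ 0ℤ → (∀ b → f (punchIn j b) ≡ r b) → ∀ l → insertAt r j 0ℤ l ≡ f l
insertAt-unique j r f e₁ e₂ l with punchIn-view j l
... | inj₁ refl       = trans (insertAt-lookup r j 0ℤ) (sym e₁)
... | inj₂ (b , refl) = trans (insertAt-punchIn r j 0ℤ b) (sym (e₂ b))

I-punchIn : ∀ (j : Fin (suc n)) a b → I (punchIn j a) (punchIn j b) ≡ I a b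
I-punchIn j a b with a ≟ b
... | yes refl = I-diagonal (punchIn j a)
... | no  a≢b  = I-off-diagonal (a≢b ∘ punchIn-injective j a b)

punchIn-inject₁ : ∀ (i : Fin n) → punchIn (inject₁ i) i ≡ suc i
punchIn-inject₁ zero    = refl
punchIn-inject₁ (suc i) = cong suc (punchIn-inject₁ i)

punchIn-suc : ∀ (i : Fin n) → punchIn (suc i) i ≡ inject₁ i
punchIn-suc zero    = refl
punchIn-suc (suc i) = cong suc (punchIn-suc i)

punchIn-neighbours : ∀ (i a : Fin n) → a ≢ i → punchIn (suc i) a ≡ punchIn (inject₁ i) a
punchIn-neighbours zero    zero    a≢i = contradiction refl a≢i
punchIn-neighbours zero    (suc a) a≢i = refl
punchIn-neighbours (suc i) zero    a≢i = refl
punchIn-neighbours (suc i) (suc a) a≢i = cong suc (punchIn-neighbours i a (a≢i ∘ cong suc))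

record Alternating (D : Matrix n → ℤ) : Set where
  field
    multilinear : Multilinear D
    alternating : ∀ M p q → p ≢ q → (∀ k → M p k ≡ M q k) → D M ≡ 0ℤ
  open Multilinear multilinear public

det-Alternating : Alternating (det {n})
det-Alternating = record { multilinear = det-multilinear ; alternating = det-alternating }

-- The cofactor step for an arbitrary alternating form: once the first row is the unit vector at j,
-- column j of the other rows is irrelevant, and an alternating form of one size less remains.
module FirstRowUnit {D : Matrix (suc n) → ℤ} (D-form : Alternating D) where
  open Alternating D-form

  pad : Fin (suc n) → Matrix n → Fin n → Row (suc n)
  pad j N a = insertAt (N a) j 0ℤ

  restrict : Fin (suc n) → Matrix n → ℤ
  restrict j N = D (I j ∷ʳᵒʷ pad j N)

  restrict-Alternating : ∀ j → Alternating (restrict j)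
  restrict-Alternating j = record
    { multilinear = record { D-cong = λ e → D-cong λ { zero b → refl ; (suc a) b → pad-cong (e a) b } ; linear = pad-linear }
    ; alternating = λ M p q p≢q e → alternating (I j ∷ʳᵒʷ pad j M) (suc p) (suc q) (p≢q ∘ suc-injective) (pad-cong e)
    }
    where
    pad-cong : ∀ {r s : Row n} → (∀ b → r b ≡ s b) → ∀ l → insertAt r j 0ℤ l ≡ insertAt s j 0ℤ l
    pad-cong {r} {s} e = insertAt-unique j r (insertAt s j 0ℤ) (insertAt-lookup s j 0ℤ)
      λ b → trans (insertAt-punchIn s j 0ℤ b) (sym (e b))
    pad-≔ : ∀ M i r → restrict j (M [ i ≔ r ]) ≡ D ((I j ∷ʳᵒʷ pad j M) [ suc i ≔ insertAt r j 0ℤ ])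
    pad-≔ M i r = D-cong λ
      { zero b    → refl
      ; (suc a) b → cong (λ f → f b) (map-updateAt {f = λ s → insertAt s j 0ℤ} {g = const r} {h = const (insertAt r j 0ℤ)} (λ _ → refl) M i a) }
    pad-linear : ∀ M i c u v → restrict j (M [ i ≔ (λ l → c * u l + v l) ]) ≡ c * restrict j (M [ i ≔ u ]) + restrict j (M [ i ≔ v ])
    pad-linear M i c u v = begin
      restrict j (M [ i ≔ (λ l → c * u l + v l) ])
        ≡⟨ pad-≔ M i (λ l → c * u l + v l) ⟩
      D (P [ suc i ≔ insertAt (λ l → c * u l + v l) j 0ℤ ])
        ≡⟨ ≔-cong P (suc i) (insertAt-unique j (λ l → c * u l + v l) (λ l → c * u′ l + v′ l)
             (trans (cong₂ (λ x y → c * x + y) (insertAt-lookup u j 0ℤ) (insertAt-lookup v j 0ℤ)) (trans (ℤ.+-identityʳ (c * 0ℤ)) (ℤ.*-zeroʳ c)))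
             (λ b → cong₂ (λ x y → c * x + y) (insertAt-punchIn u j 0ℤ b) (insertAt-punchIn v j 0ℤ b))) ⟩
      D (P [ suc i ≔ (λ l → c * u′ l + v′ l) ])
        ≡⟨ linear P (suc i) c u′ v′ ⟩
      c * D (P [ suc i ≔ u′ ]) + D (P [ suc i ≔ v′ ])
        ≡⟨ cong₂ (λ x y → c * x + y) (pad-≔ M i u) (pad-≔ M i v) ⟨
      c * restrict j (M [ i ≔ u ]) + restrict j (M [ i ≔ v ]) ∎
      where
      P : Matrix (suc n)
      P = I j ∷ʳᵒʷ pad j M
      u′ v′ : Row (suc n)
      u′ = insertAt u j 0ℤ
      v′ = insertAt v j 0ℤ

  -- Adding multiples of the first row to the others clears column j.
  clear-column : ∀ j (T : Fin n → Row (suc n)) → D (I j ∷ʳᵒʷ T) ≡ restrict j (λ a b → T a (punchIn j b))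
  clear-column j T = replace-rows (λ S → D (I j ∷ʳᵒʷ S)) (λ x y → ∃[ c ] ∀ l → x l ≡ c * I j l + y l)
    (λ e → D-cong λ { zero b → refl ; (suc a) b → e a b }) add-multiple
    λ a → T a j , λ l → decompose (T a) l
    where
    push : ∀ (S : Fin n → Row (suc n)) a x → D (I j ∷ʳᵒʷ (S [ a ≔ x ])) ≡ D ((I j ∷ʳᵒʷ S) [ suc a ≔ x ])
    push S a x = D-cong λ { zero b → refl ; (suc a) b → refl }
    add-multiple : ∀ (S : Fin n → Row (suc n)) a {x y} → ∃[ c ] (∀ l → x l ≡ c * I j l + y l) →
      D (I j ∷ʳᵒʷ (S [ a ≔ x ])) ≡ D (I j ∷ʳᵒʷ (S [ a ≔ y ]))
    add-multiple S a {x} {y} (c , e) = begin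
      D (I j ∷ʳᵒʷ (S [ a ≔ x ]))                            ≡⟨ push S a x ⟩
      D (P [ suc a ≔ x ])                                   ≡⟨ ≔-cong P (suc a) e ⟩
      D (P [ suc a ≔ (λ l → c * I j l + y l) ])             ≡⟨ linear P (suc a) c (I j) y ⟩
      c * D (P [ suc a ≔ I j ]) + D (P [ suc a ≔ y ])
        ≡⟨ cong (λ z → c * z + D (P [ suc a ≔ y ])) (alternating (P [ suc a ≔ I j ]) zero (suc a) (λ ())
             λ k → cong (λ f → f k) (sym (updateAt-updates a S))) ⟩
      c * 0ℤ + D (P [ suc a ≔ y ])                          ≡⟨ cong (λ z → z + D (P [ suc a ≔ y ])) (ℤ.*-zeroʳ c) ⟩
      0ℤ + D (P [ suc a ≔ y ])                              ≡⟨ ℤ.+-identityˡ _ ⟩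
      D (P [ suc a ≔ y ])                                   ≡⟨ push S a y ⟨
      D (I j ∷ʳᵒʷ (S [ a ≔ y ]))                            ∎
      where
      P : Matrix (suc n)
      P = I j ∷ʳᵒʷ S
    decompose : ∀ (x : Row (suc n)) l → x l ≡ x j * I j l + insertAt (λ b → x (punchIn j b)) j 0ℤ l
    decompose x l with punchIn-view j l
    ... | inj₁ refl = sym (trans (cong₂ (λ p q → x j * p + q) (I-diagonal j) (insertAt-lookup (λ b → x (punchIn j b)) j 0ℤ))
                            (trans (ℤ.+-identityʳ (x j * 1ℤ)) (ℤ.*-identityʳ (x j))))
    ... | inj₂ (b , refl) = sym (trans (cong₂ (λ p q → x j * p + q) (I-off-diagonal (punchInᵢ≢i j b ∘ sym)) (insertAt-punchIn (λ b → x (punchIn j b)) j 0ℤ b))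
                            (trans (cong (λ z → z + x (punchIn j b)) (ℤ.*-zeroʳ (x j))) (ℤ.+-identityˡ _)))

  -- The identity with row j moved to the front. Passing from j to j + 1 is one exchange, of the
  -- front row with row j + 1, and this produces the cofactor sign.
  cycle : Fin (suc n) → Matrix (suc n)
  cycle j = I j ∷ʳᵒʷ λ a → I (punchIn j a)

  D-cycle : ∀ j → D (cycle j) ≡ sign j * D I
  D-cycle = <-weakInduction (λ j → D (cycle j) ≡ sign j * D I)
    (trans (D-cong λ { zero b → refl ; (suc a) b → refl }) (sym (ℤ.*-identityˡ (D I)))) step
    where
    step : ∀ i → D (cycle (inject₁ i)) ≡ sign (inject₁ i) * D I → D (cycle (suc i)) ≡ sign (suc i) * D I
    step i ih = begin
      D (cycle (suc i))
        ≡⟨ D-cong swapped ⟩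
      D (cycle j [ zero ≔ cycle j (suc i) ] [ suc i ≔ cycle j zero ])
        ≡⟨ exchange {zero} {suc i} (λ ()) (λ M → alternating M zero (suc i) (λ ())) (cycle j) ⟩
      - D (cycle j)          ≡⟨ cong -_ ih ⟩
      - (sign j * D I)       ≡⟨ cong (λ k → - ((- 1ℤ) ^ k * D I)) (toℕ-inject₁ i) ⟩
      - (sign i * D I)       ≡⟨ negate (sign i) (D I) ⟩
      sign (suc i) * D I     ∎
      where
      j : Fin (suc n)
      j = inject₁ i
      negate : ∀ s d → - (s * d) ≡ (- 1ℤ) * s * d
      negate = solve-∀
      swapped : ∀ a b → cycle (suc i) a b ≡ (cycle j [ zero ≔ cycle j (suc i) ] [ suc i ≔ cycle j zero ]) a b
      swapped zero b = cong (λ k → I k b) (sym (punchIn-inject₁ i))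
      swapped (suc a) b with a ≟ i
      ... | yes refl = trans (cong (λ k → I k b) (punchIn-suc a)) (cong (λ f → f b) (sym (updateAt-updates a (tail (cycle j)))))
      ... | no a≢i   = trans (cong (λ k → I k b) (punchIn-neighbours i a a≢i))
                         (cong (λ f → f b) (sym (updateAt-minimal a i (tail (cycle j)) a≢i)))

  restrict-I : ∀ j → restrict j I ≡ sign j * D I
  restrict-I j = trans (D-cong λ { zero b → refl ; (suc a) b → insertAt-unique j (I a) (I (punchIn j a))
    (I-off-diagonal (punchInᵢ≢i j a)) (I-punchIn j a) b }) (D-cycle j)

-- In the expansion along the first row, `clear-column` turns each term into `restrict j`, an
-- alternating form one size smaller. The induction hypothesis and `restrict-I` then give the signed
-- cofactor.
alternating-unique : ∀ {D : Matrix n → ℤ} → Alternating D → ∀ M → D M ≡ det M * D I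
alternating-unique {zero}  {D} D-form M = trans (Alternating.D-cong D-form {M} {I} λ ()) (sym (ℤ.*-identityˡ (D I)))
alternating-unique {suc n} {D} D-form M = begin
  D M                                                       ≡⟨ D-cong (λ a b → sym (≔-self M zero a b)) ⟩
  D (M [ zero ≔ M zero ])                                   ≡⟨ row-expansion M zero (M zero) ⟩
  sum (λ j → M zero j * D (M [ zero ≔ I j ]))               ≡⟨ sum-cong-≗ (λ j → cong (M zero j *_) (expand j)) ⟩
  sum (λ j → M zero j * (det (minor M j) * (sign j * D I)))
    ≡⟨ sum-cong-≗ (λ j → regroup (M zero j) (det (minor M j)) (sign j) (D I)) ⟩
  sum (λ j → sign j * (M zero j * det (minor M j)) * D I)   ≡⟨ *-distribʳ-sum (D I) (λ j → sign j * (M zero j * det (minor M j))) ⟨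
  det M * D I                                               ∎
  where
  open Alternating D-form
  open FirstRowUnit D-form
  regroup : ∀ x d s y → x * (d * (s * y)) ≡ s * (x * d) * y
  regroup = solve-∀
  expand : ∀ j → D (M [ zero ≔ I j ]) ≡ det (minor M j) * (sign j * D I)
  expand j = begin
    D (M [ zero ≔ I j ])                  ≡⟨ D-cong (λ { zero b → refl ; (suc a) b → refl }) ⟩
    D (I j ∷ʳᵒʷ tail M)                   ≡⟨ clear-column j (tail M) ⟩
    restrict j (minor M j)                ≡⟨ alternating-unique (restrict-Alternating j) (minor M j) ⟩
    det (minor M j) * restrict j I        ≡⟨ cong (det (minor M j) *_) (restrict-I j) ⟩
    det (minor M j) * (sign j * D I)      ∎

infixl 7 _⊡_
_⊡_ : Matrix n → Matrix n → Matrix n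
(M ⊡ N) i j = sum λ k → M i k * N k j

-- For fixed N, `λ M → det (M ⊡ N)` is alternating in the rows of M and has the value `det N` at
-- `I`, so uniqueness gives the product formula.
det-⊡ : ∀ (M N : Matrix n) → det (M ⊡ N) ≡ det M * det N
det-⊡ {n} M N = trans (alternating-unique form M) (cong (det M *_) (det-cong λ i j → sum-I (λ k → N k j) i))
  where
  open Alternating (det-Alternating {n})
  ⊡-≔ : ∀ M i r → det ((M [ i ≔ r ]) ⊡ N) ≡ det ((M ⊡ N) [ i ≔ (λ j → sum λ k → r k * N k j) ])
  ⊡-≔ M i r = D-cong λ a b → cong (λ f → f b) (map-updateAt {f = λ s j → sum λ k → s k * N k j} {g = const r}
    {h = const (λ j → sum λ k → r k * N k j)} (λ _ → refl) M i a)
  distrib : ∀ c u v x → (c * u + v) * x ≡ c * (u * x) + v * x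
  distrib = solve-∀
  form : Alternating (λ M → det (M ⊡ N))
  form = record
    { multilinear = record
      { D-cong = λ e → det-cong λ i j → sum-cong-≗ λ k → cong (_* N k j) (e i k)
      ; linear = λ M i c u v → begin
          det ((M [ i ≔ (λ j → c * u j + v j) ]) ⊡ N)
            ≡⟨ ⊡-≔ M i (λ j → c * u j + v j) ⟩
          det ((M ⊡ N) [ i ≔ (λ j → sum λ k → (c * u k + v k) * N k j) ])
            ≡⟨ ≔-cong (M ⊡ N) i (λ j → sum-linear c λ k → distrib c (u k) (v k) (N k j)) ⟩
          det ((M ⊡ N) [ i ≔ (λ j → c * sum (λ k → u k * N k j) + sum (λ k → v k * N k j)) ])
            ≡⟨ linear (M ⊡ N) i c (λ j → sum λ k → u k * N k j) (λ j → sum λ k → v k * N k j) ⟩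
          c * det ((M ⊡ N) [ i ≔ (λ j → sum λ k → u k * N k j) ]) + det ((M ⊡ N) [ i ≔ (λ j → sum λ k → v k * N k j) ])
            ≡⟨ cong₂ (λ x y → c * x + y) (⊡-≔ M i u) (⊡-≔ M i v) ⟨
          c * det ((M [ i ≔ u ]) ⊡ N) + det ((M [ i ≔ v ]) ⊡ N) ∎
      }
    ; alternating = λ M p q p≢q e → det-alternating (M ⊡ N) p q p≢q λ j → sum-cong-≗ λ k → cong (_* N k j) (e k)
    }

-- First-order perturbation of the identity

trace : Matrix n → ℤ
trace M = sum λ i → M i i

∣-sum : ∀ {y} {f : Row n} → (∀ i → y ∣ f i) → y ∣ sum f
∣-sum {zero}  e = divides 0ℤ refl
∣-sum {suc n} e = ∣m∣n⇒∣m+n (e zero) (∣-sum (e ∘ suc))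

∣-det-first-column : ∀ {y} (M : Matrix (suc n)) → (∀ a → y ∣ M a zero) → y ∣ det M
∣-det-first-column {zero}  M e = ∣-sum {f = λ j → sign j * (M zero j * 1ℤ)} λ { zero → ∣n⇒∣m*n 1ℤ (∣m⇒∣m*n 1ℤ (e zero)) }
∣-det-first-column {suc n} {y} M e = ∣-sum terms
  where
  terms : ∀ j → y ∣ sign j * (M zero j * det (minor M j))
  terms zero    = ∣n⇒∣m*n 1ℤ (∣m⇒∣m*n (det (minor M zero)) (e zero))
  terms (suc j) = ∣n⇒∣m*n (sign (suc j)) (∣n⇒∣m*n (M zero (suc j)) (∣-det-first-column (minor M (suc j)) (e ∘ suc)))

-- In the expansion along the first row an off-diagonal entry carries one factor y. Its minor
-- retains column zero without the diagonal 1, which carries a second.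
det-I+yB : ∀ y (B : Matrix n) → ∃[ z ] det (λ i j → I i j + y * B i j) ≡ 1ℤ + y * trace B + y * y * z
det-I+yB {zero}  y B = 0ℤ , constant y
  where
  constant : ∀ y → 1ℤ ≡ 1ℤ + y * 0ℤ + y * y * 0ℤ
  constant = solve-∀
det-I+yB {suc n} y B with det-I+yB y (λ a b → B (suc a) (suc b))
... | z , e with ∣-sum {y = y * y} (off-diagonal n B)
  where
  off-diagonal : ∀ n (B : Matrix (suc n)) → ∀ j → y * y ∣ sign (suc j) * ((0ℤ + y * B zero (suc j)) * det (minor (λ i j → I i j + y * B i j) (suc j)))
  off-diagonal (suc n) B j with ∣-det-first-column {y = y} (minor (λ i j → I i j + y * B i j) (suc j))
    (λ a → divides (B (suc a) zero) (trans (ℤ.+-identityˡ (y * B (suc a) zero)) (ℤ.*-comm y (B (suc a) zero))))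
  ... | divides q eq = divides (sign (suc j) * (B zero (suc j) * q)) (trans (cong (λ d → sign (suc j) * ((0ℤ + y * B zero (suc j)) * d)) eq)
    (regroup (sign (suc j)) y (B zero (suc j)) q))
    where
    regroup : ∀ s y b q → s * ((0ℤ + y * b) * (q * y)) ≡ s * (b * q) * (y * y)
    regroup = solve-∀
... | divides q eq = z + B zero zero * t + y * B zero zero * z + q , trans
    (cong₂ (λ x w → 1ℤ * ((1ℤ + y * B zero zero) * x) + w) e eq) (collect y (B zero zero) t z q)
  where
  t : ℤ
  t = trace λ a b → B (suc a) (suc b)
  collect : ∀ y b t z q → 1ℤ * ((1ℤ + y * b) * (1ℤ + y * t + y * y * z)) + q * (y * y)
            ≡ 1ℤ + y * (b + t) + y * y * (z + b * t + y * b * z + q)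
  collect = solve-∀

-- Traces of powers from the characteristic polynomial

_⇑_ : Matrix n → ℕ → Matrix n
A ⇑ zero  = I
A ⇑ suc k = A ⊡ (A ⇑ k)

geometric : Matrix n → ℕ → Matrix n
geometric W zero    i j = 0ℤ
geometric W (suc k) i j = geometric W k i j + (W ⇑ k) i j

-- The telescoping identity (W - I) G = W ^ k - I, solved for W G.
⊡-geometric : ∀ (W : Matrix n) k i j → (W ⊡ geometric W k) i j ≡ geometric W k i j - I i j + (W ⇑ k) i j
⊡-geometric W zero i j = trans (sum-zero λ l → ℤ.*-zeroʳ (W i l)) (cancel (I i j))
  where
  cancel : ∀ x → 0ℤ ≡ 0ℤ - x + x
  cancel = solve-∀
⊡-geometric W (suc k) i j = begin
  sum (λ l → W i l * (geometric W k l j + (W ⇑ k) l j))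
    ≡⟨ sum-cong-≗ (λ l → ℤ.*-distribˡ-+ (W i l) (geometric W k l j) ((W ⇑ k) l j)) ⟩
  sum (λ l → W i l * geometric W k l j + W i l * (W ⇑ k) l j)
    ≡⟨ ∑-distrib-+ (λ l → W i l * geometric W k l j) (λ l → W i l * (W ⇑ k) l j) ⟩
  (W ⊡ geometric W k) i j + (W ⇑ suc k) i j
    ≡⟨ cong (λ x → x + (W ⇑ suc k) i j) (⊡-geometric W k i j) ⟩
  geometric W k i j - I i j + (W ⇑ k) i j + (W ⇑ suc k) i j
    ≡⟨ rearrange (geometric W k i j) (I i j) ((W ⇑ k) i j) ((W ⇑ suc k) i j) ⟩
  geometric W k i j + (W ⇑ k) i j - I i j + (W ⇑ suc k) i j ∎
  where
  rearrange : ∀ g e p q → g - e + p + q ≡ g + p - e + q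
  rearrange = solve-∀

⇑-scale : ∀ x (A : Matrix n) k i j → ((λ i j → x * A i j) ⇑ k) i j ≡ x ^ k * (A ⇑ k) i j
⇑-scale x A zero    i j = sym (ℤ.*-identityˡ (I i j))
⇑-scale x A (suc k) i j = begin
  sum (λ l → x * A i l * ((λ i j → x * A i j) ⇑ k) l j)
    ≡⟨ sum-cong-≗ (λ l → trans (cong (x * A i l *_) (⇑-scale x A k l j)) (regroup x (A i l) (x ^ k) ((A ⇑ k) l j))) ⟩
  sum (λ l → x ^ suc k * (A i l * (A ⇑ k) l j))
    ≡⟨ *-distribˡ-sum (x ^ suc k) (λ l → A i l * (A ⇑ k) l j) ⟨
  x ^ suc k * (A ⇑ suc k) i j ∎
  where
  regroup : ∀ x a p b → x * a * (p * b) ≡ x * p * (a * b)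
  regroup = solve-∀

-- The homogenised characteristic matrix: the pair s, x stands for the rational argument s / x, so
-- that all entries remain integers.
pencil : ℤ → ℤ → Matrix n → Matrix n
pencil s x A i j = s * I i j - x * A i j

pencil-⊡-geometric : ∀ s x (A : Matrix n) k i j → let W = λ i j → x * A i j in
  (pencil s x A ⊡ geometric W k) i j ≡ I i j + ((s - 1ℤ) * geometric W k i j - x ^ k * (A ⇑ k) i j)
pencil-⊡-geometric {n} s x A k i j = begin
  sum (λ l → (s * I i l - x * A i l) * G l j)
    ≡⟨ sum-linear s (λ l → distrib s (I i l) (x * A i l) (G l j)) ⟩
  s * sum (λ l → I i l * G l j) + sum (λ l → (- 1ℤ) * (W i l * G l j))
    ≡⟨ cong₂ (λ p q → s * p + q) (sum-I (λ l → G l j) i) (sym (*-distribˡ-sum (- 1ℤ) (λ l → W i l * G l j))) ⟩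
  s * G i j + (- 1ℤ) * (W ⊡ G) i j
    ≡⟨ cong (λ p → s * G i j + (- 1ℤ) * p) (trans (⊡-geometric W k i j) (cong (λ p → G i j - I i j + p) (⇑-scale x A k i j))) ⟩
  s * G i j + (- 1ℤ) * (G i j - I i j + x ^ k * (A ⇑ k) i j)
    ≡⟨ collect s (G i j) (I i j) (x ^ k * (A ⇑ k) i j) ⟩
  I i j + ((s - 1ℤ) * G i j - x ^ k * (A ⇑ k) i j) ∎
  where
  W G : Matrix n
  W i j = x * A i j
  G = geometric W k
  distrib : ∀ s e w g → (s * e - w) * g ≡ s * (e * g) + (- 1ℤ) * (w * g)
  distrib = solve-∀
  collect : ∀ s g e p → s * g + (- 1ℤ) * (g - e + p) ≡ e + ((s - 1ℤ) * g - p)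
  collect = solve-∀

-- Modulo y² the quotient p₁ / p₀ is 1 + y t. The multiplier g stands in for the division by p₀, and
-- a is the first-order term common to both products.
record Expansion (y p₀ p₁ t : ℤ) : Set where
  field
    g a z₀ z₁ : ℤ
    first  : p₀ * g ≡ 1ℤ + y * a + y * y * z₀
    second : p₁ * g ≡ 1ℤ + y * (t + a) + y * y * z₁

-- With y = x ^ k, multiplying both pencils by the geometric series leaves
-- I + O(y), so the first-order term in y exposes the trace of the series.
pencil-expansion : ∀ x (A : Matrix n) k →
  Expansion (x ^ k) (det (pencil 1ℤ x A)) (det (pencil (1ℤ + x ^ k) x A)) (trace (geometric (λ i j → x * A i j) k))
pencil-expansion {n} x A k = record
  { g = det G ; a = trace B₀ ; z₀ = proj₁ e₀ ; z₁ = proj₁ e₁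
  ; first = trans (sym (det-⊡ (pencil 1ℤ x A) G)) (trans (det-cong λ i j → trans (pencil-⊡-geometric 1ℤ x A k i j)
      (cong (λ p → I i j + p) (simplify₀ (G i j) y ((A ⇑ k) i j)))) (proj₂ e₀))
  ; second = trans (sym (det-⊡ (pencil (1ℤ + y) x A) G)) (trans (det-cong λ i j → trans (pencil-⊡-geometric (1ℤ + y) x A k i j)
      (cong (λ p → I i j + p) (simplify₁ (G i j) y ((A ⇑ k) i j)))) (trans (proj₂ e₁)
      (cong (λ t → 1ℤ + y * t + y * y * proj₁ e₁) (∑-distrib-+ (λ i → G i i) (λ i → B₀ i i)))))
  }
  where
  y : ℤ
  y = x ^ k
  G B₀ B₁ : Matrix n
  G = geometric (λ i j → x * A i j) k
  B₀ i j = - (A ⇑ k) i j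
  B₁ i j = G i j + B₀ i j
  e₀ : ∃[ z ] det (λ i j → I i j + y * B₀ i j) ≡ 1ℤ + y * trace B₀ + y * y * z
  e₀ = det-I+yB y B₀
  e₁ : ∃[ z ] det (λ i j → I i j + y * B₁ i j) ≡ 1ℤ + y * trace B₁ + y * y * z
  e₁ = det-I+yB y B₁
  simplify₀ : ∀ g y p → (1ℤ - 1ℤ) * g - y * p ≡ y * (- p)
  simplify₀ = solve-∀
  simplify₁ : ∀ g y p → (1ℤ + y - 1ℤ) * g - y * p ≡ y * (g + (- p))
  simplify₁ = solve-∀

-- The products (p₁ g)(p₀ h) and (p₁ h)(p₀ g) agree. Comparing their expansions makes y (t - s) a
-- multiple of y², and one factor y is cancelled.
Expansion-∣ : ∀ {y p₀ p₁ t s} .{{_ : NonZero y}} → Expansion y p₀ p₁ t → Expansion y p₀ p₁ s → y ∣ t - s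
Expansion-∣ {y} {p₀} {p₁} {t} {s} E F = divides q (trans (ℤ.*-cancelˡ-≡ y (t - s) (y * q) scaled) (ℤ.*-comm y q))
  where
  open Expansion E
  open Expansion F using () renaming (g to h; a to b; z₀ to w₀; z₁ to w₁; first to first′; second to second′)
  -- Everything beyond first order in the product of two such expansions, divided by y².
  higher : ℤ → ℤ → ℤ → ℤ → ℤ → ℤ
  higher y c d z w = z * (1ℤ + y * d + y * y * w) + w * (1ℤ + y * c) + c * d
  q : ℤ
  q = higher y (s + b) a w₁ z₀ - higher y (t + a) b z₁ w₀
  product : ∀ y c d z w → (1ℤ + y * c + y * y * z) * (1ℤ + y * d + y * y * w)
    ≡ 1ℤ + y * (c + d) + y * y * (z * (1ℤ + y * d + y * y * w) + w * (1ℤ + y * c) + c * d)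
  product = solve-∀
  swap : ∀ p g r h → p * g * (r * h) ≡ p * h * (r * g)
  swap = solve-∀
  cross : (1ℤ + y * (t + a) + y * y * z₁) * (1ℤ + y * b + y * y * w₀) ≡ (1ℤ + y * (s + b) + y * y * w₁) * (1ℤ + y * a + y * y * z₀)
  cross = trans (sym (cong₂ _*_ second first′)) (trans (swap p₁ g p₀ h) (cong₂ _*_ second′ first))
  isolate : ∀ y t a b s k → y * (t - s) ≡ (1ℤ + y * (t + a + b) + y * y * k) - (1ℤ + y * (s + b + a)) - y * y * k
  isolate = solve-∀
  collect : ∀ y u k l → (u + y * y * k) - u - y * y * l ≡ y * (y * (k - l))
  collect = solve-∀
  scaled : y * (t - s) ≡ y * (y * q)
  scaled = begin
    y * (t - s)
      ≡⟨ isolate y t a b s (higher y (t + a) b z₁ w₀) ⟩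
    (1ℤ + y * (t + a + b) + y * y * higher y (t + a) b z₁ w₀) - (1ℤ + y * (s + b + a)) - y * y * higher y (t + a) b z₁ w₀
      ≡⟨ cong (λ u → u - (1ℤ + y * (s + b + a)) - y * y * higher y (t + a) b z₁ w₀)
           (trans (sym (product y (t + a) b z₁ w₀)) (trans cross (product y (s + b) a w₁ z₀))) ⟩
    (1ℤ + y * (s + b + a) + y * y * higher y (s + b) a w₁ z₀) - (1ℤ + y * (s + b + a)) - y * y * higher y (t + a) b z₁ w₀
      ≡⟨ collect y (1ℤ + y * (s + b + a)) (higher y (s + b) a w₁ z₀) (higher y (t + a) b z₁ w₀) ⟩
    y * (y * q) ∎

^-nonZero : ∀ m k → NonZero ((+ suc m) ^ k)
^-nonZero m zero    = _
^-nonZero m (suc k) = ≢-nonZero λ e → case-product (ℤ.i*j≡0⇒i≡0∨j≡0 (+ suc m) e)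
  where
  case-product : ¬ (+ suc m ≡ 0ℤ ⊎ (+ suc m) ^ k ≡ 0ℤ)
  case-product (inj₂ e) = ℕ.≢-nonZero⁻¹ ℤ.∣ (+ suc m) ^ k ∣ {{^-nonZero m k}} (cong ℤ.∣_∣ e)

module _ (A B : Matrix n) (same-det : ∀ s m → det (pencil s (+ suc m) A) ≡ det (pencil s (+ suc m) B)) where

  geometric-trace-≡ : ∀ m k →
    (+ suc m) ^ k ∣ trace (geometric (λ i j → + suc m * A i j) k) - trace (geometric (λ i j → + suc m * B i j) k)
  geometric-trace-≡ m k = Expansion-∣ {{^-nonZero m k}} (pencil-expansion (+ suc m) A k)
    (subst₂ (λ p₀ p₁ → Expansion ((+ suc m) ^ k) p₀ p₁ (trace (geometric (λ i j → + suc m * B i j) k)))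
      (sym (same-det 1ℤ m)) (sym (same-det (1ℤ + (+ suc m) ^ k) m)) (pencil-expansion (+ suc m) B k))

  difference : ℤ → ℕ → ℤ
  difference x k = trace (geometric (λ i j → x * A i j) k) - trace (geometric (λ i j → x * B i j) k)

  difference-suc : ∀ x k → difference x (suc k) ≡ difference x k + x ^ k * (trace (A ⇑ k) - trace (B ⇑ k))
  difference-suc x k = trans (cong₂ _-_ (expand A) (expand B))
    (collect (trace (geometric (λ i j → x * A i j) k)) (trace (geometric (λ i j → x * B i j) k)) (x ^ k) (trace (A ⇑ k)) (trace (B ⇑ k)))
    where
    expand : ∀ (C : Matrix n) → trace (geometric (λ i j → x * C i j) (suc k)) ≡ trace (geometric (λ i j → x * C i j) k) + x ^ k * trace (C ⇑ k)
    expand C = trans (∑-distrib-+ (λ i → geometric (λ i j → x * C i j) k i i) (λ i → ((λ i j → x * C i j) ⇑ k) i i))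
      (cong (λ u → trace (geometric (λ i j → x * C i j) k) + u) (trans (sum-cong-≗ λ i → ⇑-scale x C k i i)
        (sym (*-distribˡ-sum (x ^ k) (λ i → (C ⇑ k) i i)))))
    collect : ∀ t s y a b → t + y * a - (s + y * b) ≡ t - s + y * (a - b)
    collect = solve-∀

  -- A joint induction on k. Once the traces of the powers below k agree, the two series of length k
  -- + 1 differ by x ^ k d, with d the difference of the k-th traces. This is divisible by x ^ (k +
  -- 1), so every positive x divides d.
  difference≡0 : ∀ m k → difference (+ suc m) k ≡ 0ℤ
  trace-⇑-≡ : ∀ k → trace (A ⇑ k) ≡ trace (B ⇑ k)

  difference≡0 m zero    = ℤ.+-inverseʳ (trace {n} λ _ _ → 0ℤ)
  difference≡0 m (suc k) = trans (difference-suc (+ suc m) k) (trans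
    (cong₂ (λ u v → u + (+ suc m) ^ k * v) (difference≡0 m k) (ℤ.i≡j⇒i-j≡0 (trace-⇑-≡ k)))
    (trans (ℤ.+-identityˡ ((+ suc m) ^ k * 0ℤ)) (ℤ.*-zeroʳ ((+ suc m) ^ k))))

  trace-⇑-≡ k = ℤ.i-j≡0⇒i≡j (trace (A ⇑ k)) (trace (B ⇑ k)) (only-0 ℤ.∣ d ∣ refl)
    where
    d : ℤ
    d = trace (A ⇑ k) - trace (B ⇑ k)
    divisible : ∀ m → + suc m ∣ d
    divisible m = *-cancelʳ-∣ (x ^ k) {{^-nonZero m k}}
      (subst (x * x ^ k ∣_) (trans (difference-suc x k) (trans (cong (λ u → u + x ^ k * d) (difference≡0 m k))
        (trans (ℤ.+-identityˡ (x ^ k * d)) (ℤ.*-comm (x ^ k) d)))) (geometric-trace-≡ m (suc k)))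
      where
      x : ℤ
      x = + suc m
    only-0 : ∀ a → ℤ.∣ d ∣ ≡ a → d ≡ 0ℤ
    only-0 zero    e = ℤ.∣i∣≡0⇒i≡0 e
    -- The divisor chosen is |d| + 1, too large to divide a nonzero d.
    only-0 (suc a) e = contradiction (subst (suc (suc a) ℕ.∣_) e (∣⇒∣ᵤ (divisible (suc a)))) (ℕ.>⇒∤ (ℕ.n<1+n (suc a)))

-- Real numbers

ℚ-ring : ACR.AlmostCommutativeRing 0ℓ 0ℓ
ℚ-ring = ACR.fromCommutativeRing ℚ.+-*-commutativeRing (λ x → dec⇒maybe (0ℚ ℚ.≟ x))

halve : ∀ {ϵ} → 0ℚ ℚ.< ϵ → ∃[ δ ] (0ℚ ℚ.< δ × δ ℚ.+ δ ≡ ϵ)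
halve {ϵ} 0<ϵ = ½ ℚ.* ϵ
  , subst (ℚ._< ½ ℚ.* ϵ) (ℚ.*-zeroʳ ½) (ℚ.*-monoʳ-<-pos ½ 0<ϵ)
  , trans (sym (ℚ.*-distribʳ-+ ϵ ½ ½)) (ℚ.*-identityˡ ϵ)

distance-triangle : ∀ a b c {δ η} → ℚ.∣ a ℚ.- b ∣ ℚ.< δ → ℚ.∣ b ℚ.- c ∣ ℚ.< η → ℚ.∣ a ℚ.- c ∣ ℚ.< δ ℚ.+ η
distance-triangle a b c p q = subst (λ z → ℚ.∣ z ∣ ℚ.< _) (telescope a b c)
  (ℚ.≤-<-trans (ℚ.∣p+q∣≤∣p∣+∣q∣ (a ℚ.- b) (b ℚ.- c)) (ℚ.+-mono-< p q))
  where
  telescope : ∀ a b c → (a ℚ.- b) ℚ.+ (b ℚ.- c) ≡ a ℚ.- c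
  telescope = RingSolver.solve-∀ ℚ-ring

distance-sym : ∀ a b → ℚ.∣ a ℚ.- b ∣ ≡ ℚ.∣ b ℚ.- a ∣
distance-sym a b = trans (sym (ℚ.∣-p∣≡∣p∣ (a ℚ.- b))) (cong ℚ.∣_∣ (flipped a b))
  where
  flipped : ∀ a b → ℚ.- (a ℚ.- b) ≡ b ℚ.- a
  flipped = RingSolver.solve-∀ ℚ-ring

-- A relation between the underlying sequences, so that comparing its sides
-- never compares proofs of convergence.
infix 4 _≐_
record _≐_ (x y : ℕ → ℚ) : Set where
  constructor wrap
  field
    unwrap : ∀ ϵ → 0ℚ ℚ.< ϵ → ∃[ N ] (∀ {n} → N ≤ n → ℚ.∣ x n ℚ.- y n ∣ ℚ.< ϵ)

open _≐_

≐-pointwise : ∀ {x y} → (∀ k → x k ≡ y k) → x ≐ y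
≐-pointwise {x} {y} e = wrap λ ϵ 0<ϵ → 0 , λ {k} _ →
  subst (λ z → ℚ.∣ z ∣ ℚ.< ϵ) (sym (trans (cong (λ z → z ℚ.- y k) (e k)) (ℚ.+-inverseʳ (y k)))) 0<ϵ

≐-sym : ∀ {x y} → x ≐ y → y ≐ x
≐-sym {x} {y} e = wrap λ ϵ 0<ϵ → proj₁ (unwrap e ϵ 0<ϵ) , λ {k} N≤k →
  subst (ℚ._< ϵ) (distance-sym (x k) (y k)) (proj₂ (unwrap e ϵ 0<ϵ) N≤k)

≐-trans : ∀ {x y z} → x ≐ y → y ≐ z → x ≐ z
≐-trans {x} {y} {z} (wrap e) (wrap f) = wrap bound
  where
  bound : ∀ ϵ → 0ℚ ℚ.< ϵ → ∃[ N ] (∀ {n} → N ≤ n → ℚ.∣ x n ℚ.- z n ∣ ℚ.< ϵ)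
  bound ϵ 0<ϵ with halve 0<ϵ
  ... | δ , 0<δ , refl with e δ 0<δ | f δ 0<δ
  ... | M , p | N , q = M ℕ.⊔ N , λ {k} le → distance-triangle (x k) (y k) (z k)
    (p (ℕ.m⊔n≤o⇒m≤o M N le)) (q (ℕ.m⊔n≤o⇒n≤o M N le))

constant-injective : ∀ {p q} → (λ _ → p) ≐ (λ _ → q) → p ≡ q
constant-injective {p} {q} (wrap e) with p ℚ.≟ q
... | yes p≡q = p≡q
... | no  p≢q = contradiction (proj₂ (e d 0<d) ℕ.≤-refl) (ℚ.<-irrefl refl)
  where
  d : ℚ
  d = ℚ.∣ p ℚ.- q ∣
  recover : ∀ p q → p ≡ (p ℚ.- q) ℚ.+ q
  recover = RingSolver.solve-∀ ℚ-ring
  0<d : 0ℚ ℚ.< d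
  0<d = ℚ.≰⇒> λ d≤0 → p≢q (trans (recover p q)
    (trans (cong (ℚ._+ q) (ℚ.∣p∣≡0⇒p≡0 (p ℚ.- q) (ℚ.≤-antisym d≤0 (ℚ.0≤∣p∣ (p ℚ.- q))))) (ℚ.+-identityˡ q)))

-- Merging two equal reals into one Cauchy sequence turns closeness of two sequences into a Cauchy
-- condition on one, so the estimate for products contained in `_*ᴿ_` can be reused.
interleave : (ℕ → ℚ) → (ℕ → ℚ) → ℕ → ℚ
interleave x y zero          = x zero
interleave x y (suc zero)    = y zero
interleave x y (suc (suc k)) = interleave (x ∘ suc) (y ∘ suc) k

interleave-even : ∀ x y k → interleave x y (k ℕ.* 2) ≡ x k
interleave-even x y zero    = refl
interleave-even x y (suc k) = interleave-even (x ∘ suc) (y ∘ suc) k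

interleave-odd : ∀ x y k → interleave x y (suc (k ℕ.* 2)) ≡ y k
interleave-odd x y zero    = refl
interleave-odd x y (suc k) = interleave-odd (x ∘ suc) (y ∘ suc) k

-- Late terms come from late terms: the bound is just strong enough for 2N ≤ k to imply N ≤ j.
interleave-view : ∀ x y k → ∃[ j ] (k ≤ suc (j ℕ.* 2) × (interleave x y k ≡ x j ⊎ interleave x y k ≡ y j))
interleave-view x y zero          = 0 , ℕ.z≤n , inj₁ refl
interleave-view x y (suc zero)    = 0 , ℕ.s≤s ℕ.z≤n , inj₂ refl
interleave-view x y (suc (suc k)) with interleave-view (x ∘ suc) (y ∘ suc) k
... | j , le , e = suc j , ℕ.s≤s (ℕ.s≤s le) , e

interleave-cauchy : ∀ x y → seq x ≐ seq y → IsCauchy (interleave (seq x) (seq y))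
interleave-cauchy x y (wrap x≃y) ϵ 0<ϵ with halve 0<ϵ
... | δ , 0<δ , refl with halve 0<δ
... | η , 0<η , refl with cauchy x η 0<η | x≃y η 0<η
... | M , p | K , q = N ℕ.* 2 , λ {m} {n} N≤m N≤n → distance-triangle (z m) (seq x N) (z n)
    (close m N≤m) (subst (ℚ._< η ℚ.+ η) (distance-sym (z n) (seq x N)) (close n N≤n))
  where
  z : ℕ → ℚ
  z = interleave (seq x) (seq y)
  N : ℕ
  N = M ℕ.⊔ K
  close : ∀ k → N ℕ.* 2 ≤ k → ℚ.∣ z k ℚ.- seq x N ∣ ℚ.< η ℚ.+ η
  close k N≤k with interleave-view (seq x) (seq y) k
  ... | j , k≤ , e = near e
    where
    N≤j : N ≤ j
    N≤j = ℕ.≤-pred (ℕ.*-cancelʳ-< 2 N (suc j) (ℕ.s≤s (ℕ.≤-trans N≤k k≤)))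
    x-near : ℚ.∣ seq x j ℚ.- seq x N ∣ ℚ.< η
    x-near = p (ℕ.≤-trans (ℕ.m≤m⊔n M K) N≤j) (ℕ.m≤m⊔n M K)
    y-near : ℚ.∣ seq y j ℚ.- seq x j ∣ ℚ.< η
    y-near = subst (ℚ._< η) (distance-sym (seq x j) (seq y j)) (q (ℕ.≤-trans (ℕ.m≤n⊔m M K) N≤j))
    zero-near : ℚ.∣ seq x j ℚ.- seq x j ∣ ℚ.< η
    zero-near = subst (λ d → ℚ.∣ d ∣ ℚ.< η) (sym (ℚ.+-inverseʳ (seq x j))) 0<η
    near : z k ≡ seq x j ⊎ z k ≡ seq y j → ℚ.∣ z k ℚ.- seq x N ∣ ℚ.< η ℚ.+ η
    near (inj₁ e) = subst (λ w → ℚ.∣ w ℚ.- seq x N ∣ ℚ.< η ℚ.+ η) (sym e) (distance-triangle (seq x j) (seq x j) (seq x N) zero-near x-near)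
    near (inj₂ e) = subst (λ w → ℚ.∣ w ℚ.- seq x N ∣ ℚ.< η ℚ.+ η) (sym e) (distance-triangle (seq y j) (seq x j) (seq x N) y-near x-near)

-- The product of the two interleavings is again Cauchy, and its neighbouring
-- terms are those of the two products.
*ᴿ-cong : ∀ x x′ p p′ → seq x ≐ seq x′ → seq p ≐ seq p′ → seq (x *ᴿ p) ≐ seq (x′ *ᴿ p′)
*ᴿ-cong x x′ p p′ e f = wrap λ ϵ 0<ϵ → proj₁ (close ϵ 0<ϵ) , λ {k} N≤k → subst₂ (λ a b → ℚ.∣ a ℚ.- b ∣ ℚ.< ϵ)
  (cong₂ ℚ._*_ (interleave-even (seq x) (seq x′) k) (interleave-even (seq p) (seq p′) k))
  (cong₂ ℚ._*_ (interleave-odd (seq x) (seq x′) k) (interleave-odd (seq p) (seq p′) k))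
  (proj₂ (close ϵ 0<ϵ) (ℕ.≤-trans N≤k (ℕ.m≤m*n k 2)) (ℕ.m≤n⇒m≤1+n (ℕ.≤-trans N≤k (ℕ.m≤m*n k 2))))
  where
  z w : ℝ
  z = mkℝ (interleave (seq x) (seq x′)) (interleave-cauchy x x′ e)
  w = mkℝ (interleave (seq p) (seq p′)) (interleave-cauchy p p′ f)
  close : IsCauchy (λ k → seq z k ℚ.* seq w k)
  close = cauchy (z *ᴿ w)

difference-cong : ∀ (t : ℕ → ℚ) {x y} → x ≐ y → (λ k → t k ℚ.+ ℚ.- x k) ≐ (λ k → t k ℚ.+ ℚ.- y k)
difference-cong t {x} {y} (wrap e) = wrap λ ϵ 0<ϵ → proj₁ (e ϵ 0<ϵ) , λ {k} N≤k → subst (ℚ._< ϵ)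
  (trans (distance-sym (x k) (y k)) (cong ℚ.∣_∣ (shift (t k) (x k) (y k)))) (proj₂ (e ϵ 0<ϵ) N≤k)
  where
  shift : ∀ t x y → y ℚ.- x ≡ (t ℚ.- x) ℚ.- (t ℚ.- y)
  shift = RingSolver.solve-∀ ℚ-ring

rootProduct : ℝ → List ℝ → ℝ
rootProduct t = List.foldr (λ x p → (t ⊕ ⊖ x) ⊗ p) 1#
  where open RawRing ℝ-rawRing using (1#) renaming (_+_ to _⊕_; _*_ to _⊗_; -_ to ⊖_)

rootProduct-∷ : ∀ t {x y xs ys} → x ≃ᴿ y → seq (rootProduct t xs) ≐ seq (rootProduct t ys) →
                seq (rootProduct t (x List.∷ xs)) ≐ seq (rootProduct t (y List.∷ ys))
rootProduct-∷ t {x} {y} {xs} {ys} e es =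
  *ᴿ-cong (t +ᴿ -ᴿ x) (t +ᴿ -ᴿ y) (rootProduct t xs) (rootProduct t ys) (difference-cong (seq t) {seq x} {seq y} (wrap e)) es

rootProduct-swap : ∀ t x y xs → seq (rootProduct t (x List.∷ y List.∷ xs)) ≐ seq (rootProduct t (y List.∷ x List.∷ xs))
rootProduct-swap t x y xs = ≐-pointwise λ k → commute (seq (t +ᴿ -ᴿ x) k) (seq (t +ᴿ -ᴿ y) k) (seq (rootProduct t xs) k)
  where
  commute : ∀ a b p → a ℚ.* (b ℚ.* p) ≡ b ℚ.* (a ℚ.* p)
  commute = RingSolver.solve-∀ ℚ-ring

-- The relation permits replacing entries by equal reals as well as permuting them, so congruence of
-- multiplication is needed along with commutativity.
rootProduct-↭ : ∀ t {xs ys} → Permutation _≃ᴿ_ xs ys → seq (rootProduct t xs) ≐ seq (rootProduct t ys)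
rootProduct-↭ t (Perm.refl e) = pointwise e
  where
  pointwise : ∀ {xs ys} → Pointwise _≃ᴿ_ xs ys → seq (rootProduct t xs) ≐ seq (rootProduct t ys)
  pointwise Pointwise.[] = ≐-pointwise λ _ → refl
  pointwise (Pointwise._∷_ {x} {y} {xs} {ys} e es) = rootProduct-∷ t {x} {y} {xs} {ys} e (pointwise es)
rootProduct-↭ t (Perm.prep {xs} {ys} {x} {y} e es) = rootProduct-∷ t {x} {y} {xs} {ys} e (rootProduct-↭ t es)
rootProduct-↭ t (Perm.swap {xs} {ys} {x} {y} {x′} {y′} e f es) = ≐-trans
  (rootProduct-∷ t {x} {x′} {y List.∷ xs} {y′ List.∷ ys} e (rootProduct-∷ t {y} {y′} {xs} {ys} f (rootProduct-↭ t es)))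
  (rootProduct-swap t x′ y′ ys)
rootProduct-↭ t (Perm.trans e f) = ≐-trans (rootProduct-↭ t e) (rootProduct-↭ t f)

↭-length : ∀ {xs ys} → Permutation _≃ᴿ_ xs ys → length xs ≡ length ys
↭-length (Perm.refl e)     = Pointwise-length e
↭-length (Perm.prep _ e)   = cong suc (↭-length e)
↭-length (Perm.swap _ _ e) = cong (λ k → suc (suc k)) (↭-length e)
↭-length (Perm.trans e f)  = trans (↭-length e) (↭-length f)

-- From real to integer determinants

private
  module Detℚ = Spectral ℚ.+-*-rawRing
  module Sumℚ = SemiringSum (CommutativeRing.semiring ℚ.+-*-commutativeRing)
  module Powℚ = RawSemiringDefs (RawRing.rawSemiring ℚ.+-*-rawRing)

-- Built directly from numerator and denominator, so that `ℚ.numerator` recovers the integer by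
-- computation; `cospectral⇒same-pencil` relies on this.
fromℤ : ℤ → ℚ
fromℤ i = mkℚ i 0 (Coprimality.sym (Coprimality.1-coprimeTo _))

fromℤ-+ : ∀ i j → fromℤ (i + j) ≡ fromℤ i ℚ.+ fromℤ j
fromℤ-+ i j = ℚ.toℚᵘ-injective (ℚᵘ.≃-trans (ℚᵘ.*≡* (same i j)) (ℚᵘ.≃-sym (ℚ.toℚᵘ-homo-+ (fromℤ i) (fromℤ j))))
  where
  same : ∀ i j → (i + j) * 1ℤ ≡ (i * 1ℤ + j * 1ℤ) * 1ℤ
  same = solve-∀

fromℤ-* : ∀ i j → fromℤ (i * j) ≡ fromℤ i ℚ.* fromℤ j
fromℤ-* i j = ℚ.toℚᵘ-injective (ℚᵘ.≃-trans (ℚᵘ.*≡* refl) (ℚᵘ.≃-sym (ℚ.toℚᵘ-homo-* (fromℤ i) (fromℤ j))))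

fromℤ-neg : ∀ i → fromℤ (- i) ≡ ℚ.- fromℤ i
fromℤ-neg i = ℚ.toℚᵘ-injective (ℚᵘ.≃-trans (ℚᵘ.*≡* refl) (ℚᵘ.≃-sym (ℚ.toℚᵘ-homo‿- (fromℤ i))))

detℚ-scale : ∀ x (M : Detℚ.Matrix n) → Detℚ.det (λ i j → x ℚ.* M i j) ≡ x Powℚ.^ n ℚ.* Detℚ.det M
detℚ-scale {zero}  x M = refl
detℚ-scale {suc n} x M = trans (Sumℚ.sum-cong-≗ λ j → trans
    (cong (λ d → s j ℚ.* (x ℚ.* M zero j ℚ.* d)) (detℚ-scale x (Detℚ.minor M j)))
    (regroup (s j) x (M zero j) (x Powℚ.^ n) (Detℚ.det (Detℚ.minor M j))))
  (sym (Sumℚ.*-distribˡ-sum (x Powℚ.^ suc n) (λ j → s j ℚ.* (M zero j ℚ.* Detℚ.det (Detℚ.minor M j)))))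
  where
  s : Fin (suc n) → ℚ
  s j = (ℚ.- 1ℚ) Powℚ.^ toℕ j
  regroup : ∀ s x m p d → s ℚ.* (x ℚ.* m ℚ.* (p ℚ.* d)) ≡ x ℚ.* p ℚ.* (s ℚ.* (m ℚ.* d))
  regroup = RingSolver.solve-∀ ℚ-ring

integerAdjacency : (G : Graph) → Matrix (order G)
integerAdjacency G u v = if adj G u v then 1ℤ else 0ℤ

rationalCharMatrix : (G : Graph) → ℚ → Detℚ.Matrix (order G)
rationalCharMatrix G q i j = (if does (i ≟ j) then q else 0ℚ) ℚ.+ ℚ.- (if adj G i j then 1ℚ else 0ℚ)

-- Real addition, multiplication and negation act term by term, so at a constant argument every term
-- of the real determinant is the same rational determinant.
charPoly-rational : ∀ G q → seq (Spectral.charPoly ℝ-rawRing (adjacencyMatrix G) (fromℚ q)) ≐ (λ _ → Detℚ.det (rationalCharMatrix G q))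
charPoly-rational G q = ≐-pointwise λ k →
  RawRingHom.det-homo ℝ-rawRing ℚ.+-*-rawRing (λ x → seq x k) (λ _ _ → refl) (λ _ _ → refl) (λ _ → refl) refl refl (entry k)
  where
  entry : ∀ k i j → seq (Spectral.charMatrix ℝ-rawRing (adjacencyMatrix G) (fromℚ q) i j) k ≡ rationalCharMatrix G q i j
  entry k i j with does (i ≟ j) | adj G i j
  ... | true  | true  = refl
  ... | true  | false = refl
  ... | false | true  = refl
  ... | false | false = refl

-- Multiplying each row by x clears the denominator of q = s / x, at the cost of one factor x per
-- row.
det-pencil : ∀ G s x q → fromℤ x ℚ.* q ≡ fromℤ s →
  fromℤ (det (pencil s x (integerAdjacency G))) ≡ fromℤ x Powℚ.^ order G ℚ.* Detℚ.det (rationalCharMatrix G q)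
det-pencil G s x q e = trans
  (RawRingHom.det-homo ℤ.+-*-rawRing ℚ.+-*-rawRing fromℤ fromℤ-+ fromℤ-* fromℤ-neg refl refl entry)
  (detℚ-scale (fromℤ x) (rationalCharMatrix G q))
  where
  bit : ∀ b r → fromℤ (r * (if b then 1ℤ else 0ℤ)) ≡ fromℤ r ℚ.* (if b then 1ℚ else 0ℚ)
  bit true  r = fromℤ-* r 1ℤ
  bit false r = fromℤ-* r 0ℤ
  diagonal : ∀ b → fromℤ (s * (if b then 1ℤ else 0ℤ)) ≡ fromℤ x ℚ.* (if b then q else 0ℚ)
  diagonal true  = trans (cong fromℤ (ℤ.*-identityʳ s)) (sym e)
  diagonal false = trans (cong fromℤ (ℤ.*-zeroʳ s)) (sym (ℚ.*-zeroʳ (fromℤ x)))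
  distrib : ∀ x a b → x ℚ.* a ℚ.- x ℚ.* b ≡ x ℚ.* (a ℚ.+ ℚ.- b)
  distrib = RingSolver.solve-∀ ℚ-ring
  entry : ∀ i j → fromℤ (pencil s x (integerAdjacency G) i j) ≡ fromℤ x ℚ.* rationalCharMatrix G q i j
  entry i j = begin
    fromℤ (s * I i j - x * integerAdjacency G i j)
      ≡⟨ fromℤ-+ (s * I i j) (- (x * integerAdjacency G i j)) ⟩
    fromℤ (s * I i j) ℚ.+ fromℤ (- (x * integerAdjacency G i j))
      ≡⟨ cong₂ ℚ._+_ (diagonal (does (i ≟ j))) (trans (fromℤ-neg (x * integerAdjacency G i j)) (cong ℚ.-_ (bit (adj G i j) x))) ⟩
    fromℤ x ℚ.* (if does (i ≟ j) then q else 0ℚ) ℚ.- fromℤ x ℚ.* (if adj G i j then 1ℚ else 0ℚ)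
      ≡⟨ distrib (fromℤ x) (if does (i ≟ j) then q else 0ℚ) (if adj G i j then 1ℚ else 0ℚ) ⟩
    fromℤ x ℚ.* rationalCharMatrix G q i j ∎

cospectral⇒same-order : ∀ {G H} → Cospectral G H → order G ≡ order H
cospectral⇒same-order (λs , μs , (|λs| , _) , (|μs| , _) , perm) = trans (sym |λs|) (trans (↭-length perm) |μs|)

factorisation : ∀ G λs → Spectral.HasEigenvalues ℝ-rawRing (adjacencyMatrix G) λs → ∀ q →
  (λ _ → Detℚ.det (rationalCharMatrix G q)) ≐ seq (rootProduct (fromℚ q) λs)
factorisation G λs (_ , f) q = ≐-trans (≐-sym (charPoly-rational G q)) (wrap (f (fromℚ q)))

cospectral⇒same-charPoly : ∀ {G H} → Cospectral G H → ∀ q →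
  Detℚ.det (rationalCharMatrix G q) ≡ Detℚ.det (rationalCharMatrix H q)
cospectral⇒same-charPoly {G} {H} (λs , μs , eG , eH , perm) q = constant-injective
  (≐-trans (factorisation G λs eG q) (≐-trans (rootProduct-↭ (fromℚ q) {λs} {μs} perm) (≐-sym (factorisation H μs eH q))))

cospectral⇒same-pencil : ∀ {G H} → Cospectral G H → ∀ s m →
  det (pencil s (+ suc m) (integerAdjacency G)) ≡ det (pencil s (+ suc m) (integerAdjacency H))
cospectral⇒same-pencil {G} {H} cospectral s m = cong ℚ.numerator (begin
    fromℤ (det (pencil s (+ suc m) (integerAdjacency G)))
      ≡⟨ det-pencil G s (+ suc m) q scaled ⟩
    x Powℚ.^ order G ℚ.* Detℚ.det (rationalCharMatrix G q)
      ≡⟨ cong₂ (λ k d → x Powℚ.^ k ℚ.* d) (cospectral⇒same-order {G} {H} cospectral) (cospectral⇒same-charPoly {G} {H} cospectral q) ⟩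
    x Powℚ.^ order H ℚ.* Detℚ.det (rationalCharMatrix H q)
      ≡⟨ det-pencil H s (+ suc m) q scaled ⟨
    fromℤ (det (pencil s (+ suc m) (integerAdjacency H))) ∎)
  where
  x q : ℚ
  x = fromℤ (+ suc m)
  q = fromℤ s ℚ.* ℚ.1/ x
  regroup : ∀ x s y → x ℚ.* (s ℚ.* y) ≡ s ℚ.* (x ℚ.* y)
  regroup = RingSolver.solve-∀ ℚ-ring
  scaled : x ℚ.* q ≡ fromℤ s
  scaled = trans (regroup x (fromℤ s) (ℚ.1/ x)) (trans (cong (fromℤ s ℚ.*_) (ℚ.*-inverseʳ x)) (ℚ.*-identityʳ (fromℤ s)))

-- Powers and their traces

⊡-assoc : ∀ (A B C : Matrix n) i j → ((A ⊡ B) ⊡ C) i j ≡ (A ⊡ (B ⊡ C)) i j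
⊡-assoc A B C i j = begin
  sum (λ k → sum (λ l → A i l * B l k) * C k j)
    ≡⟨ sum-cong-≗ (λ k → *-distribʳ-sum (C k j) (λ l → A i l * B l k)) ⟩
  sum (λ k → sum (λ l → A i l * B l k * C k j))
    ≡⟨ ∑-comm (λ k l → A i l * B l k * C k j) ⟩
  sum (λ l → sum (λ k → A i l * B l k * C k j))
    ≡⟨ sum-cong-≗ (λ l → trans (sum-cong-≗ λ k → ℤ.*-assoc (A i l) (B l k) (C k j)) (sym (*-distribˡ-sum (A i l) (λ k → B l k * C k j)))) ⟩
  sum (λ l → A i l * sum (λ k → B l k * C k j)) ∎

⇑-+ : ∀ (A : Matrix n) k l i j → ((A ⇑ k) ⊡ (A ⇑ l)) i j ≡ (A ⇑ (k ℕ.+ l)) i j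
⇑-+ A zero    l i j = sum-I (λ k → (A ⇑ l) k j) i
⇑-+ A (suc k) l i j = trans (⊡-assoc A (A ⇑ k) (A ⇑ l) i j) (sum-cong-≗ λ r → cong (A i r *_) (⇑-+ A k l r j))

⇑-1 : ∀ (A : Matrix n) i j → (A ⇑ 1) i j ≡ A i j
⇑-1 A i j = trans (sum-cong-≗ λ k → trans (ℤ.*-comm (A i k) (I k j)) (cong (_* A i k) (I-sym k j))) (sum-I (A i) j)

⇑-sym : ∀ (A : Matrix n) → (∀ i j → A i j ≡ A j i) → ∀ k i j → (A ⇑ k) i j ≡ (A ⇑ k) j i
⇑-sym A A-sym zero    i j = I-sym i j
⇑-sym A A-sym (suc k) i j = begin
  sum (λ l → A i l * (A ⇑ k) l j)        ≡⟨ sum-cong-≗ (λ l → trans (ℤ.*-comm (A i l) ((A ⇑ k) l j))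
                                              (cong₂ _*_ (⇑-sym A A-sym k l j) (trans (A-sym i l) (sym (⇑-1 A l i))))) ⟩
  ((A ⇑ k) ⊡ (A ⇑ 1)) j i                ≡⟨ ⇑-+ A k 1 j i ⟩
  (A ⇑ (k ℕ.+ 1)) j i                    ≡⟨ cong (λ r → (A ⇑ r) j i) (ℕ.+-comm k 1) ⟩
  (A ⇑ suc k) j i                        ∎

trace-comm : ∀ (A B : Matrix n) → trace (A ⊡ B) ≡ trace (B ⊡ A)
trace-comm A B = trans (∑-comm (λ i k → A i k * B k i)) (sum-cong-≗ λ k → sum-cong-≗ λ i → ℤ.*-comm (A i k) (B k i))

polynomial : Row m → Matrix n → Matrix n
polynomial c A i j = sum λ k → c k * (A ⇑ toℕ k) i j

trace-polynomial-⊡ : ∀ (c : Row m) (A N : Matrix n) → trace (polynomial c A ⊡ N) ≡ sum (λ k → c k * trace ((A ⇑ toℕ k) ⊡ N))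
trace-polynomial-⊡ c A N = begin
  sum (λ i → sum (λ l → sum (λ k → c k * (A ⇑ toℕ k) i l) * N l i))
    ≡⟨ sum-cong-≗ (λ i → trans (sum-cong-≗ λ l → trans (*-distribʳ-sum (N l i) (λ k → c k * (A ⇑ toℕ k) i l))
         (sum-cong-≗ λ k → ℤ.*-assoc (c k) ((A ⇑ toℕ k) i l) (N l i)))
         (trans (∑-comm (λ l k → c k * ((A ⇑ toℕ k) i l * N l i))) (sum-cong-≗ λ k → sym (*-distribˡ-sum (c k) (λ l → (A ⇑ toℕ k) i l * N l i))))) ⟩
  sum (λ i → sum (λ k → c k * ((A ⇑ toℕ k) ⊡ N) i i))
    ≡⟨ ∑-comm (λ i k → c k * ((A ⇑ toℕ k) ⊡ N) i i) ⟩
  sum (λ k → sum (λ i → c k * ((A ⇑ toℕ k) ⊡ N) i i))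
    ≡⟨ sum-cong-≗ (λ k → *-distribˡ-sum (c k) (λ i → ((A ⇑ toℕ k) ⊡ N) i i)) ⟨
  sum (λ k → c k * trace ((A ⇑ toℕ k) ⊡ N)) ∎

-- The trace of the square depends on A only through traces of powers, the data that cospectral
-- graphs share.
trace-polynomial² : ∀ (c : Row m) (A : Matrix n) → trace (polynomial c A ⊡ polynomial c A) ≡
  sum (λ k → c k * sum (λ l → c l * trace (A ⇑ (toℕ l ℕ.+ toℕ k))))
trace-polynomial² c A = trans (trace-polynomial-⊡ c A (polynomial c A)) (sum-cong-≗ λ k → cong (c k *_)
  (trans (trace-comm (A ⇑ toℕ k) (polynomial c A)) (trans (trace-polynomial-⊡ c A (A ⇑ toℕ k))
    (sum-cong-≗ λ l → cong (c l *_) (sum-cong-≗ λ i → ⇑-+ A (toℕ l) (toℕ k) i i)))))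

-- Nonnegative integers and sums of squares

square-nonneg : ∀ x → 0ℤ ℤ.≤ x * x
square-nonneg (+ k)      = subst (0ℤ ℤ.≤_) (ℤ.pos-* k k) (ℤ.+≤+ ℕ.z≤n)
square-nonneg -[1+ k ] = ℤ.+≤+ ℕ.z≤n

*-nonneg : ∀ {x y} → 0ℤ ℤ.≤ x → 0ℤ ℤ.≤ y → 0ℤ ℤ.≤ x * y
*-nonneg {+ k} {+ l} _ _ = subst (0ℤ ℤ.≤_) (ℤ.pos-* k l) (ℤ.+≤+ ℕ.z≤n)

square≡0 : ∀ x → x * x ≡ 0ℤ → x ≡ 0ℤ
square≡0 x e with ℤ.i*j≡0⇒i≡0∨j≡0 x e
... | inj₁ x≡0 = x≡0
... | inj₂ x≡0 = x≡0

sum-nonneg : ∀ {f : Row n} → (∀ i → 0ℤ ℤ.≤ f i) → 0ℤ ℤ.≤ sum f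
sum-nonneg {zero}  p = ℤ.≤-refl
sum-nonneg {suc n} p = ℤ.+-mono-≤ (p zero) (sum-nonneg (p ∘ suc))

nonneg-+≡0 : ∀ {x y} → 0ℤ ℤ.≤ x → 0ℤ ℤ.≤ y → x + y ≡ 0ℤ → x ≡ 0ℤ × y ≡ 0ℤ
nonneg-+≡0 {+ zero}  {+ zero} _ _ _ = refl , refl

sum-nonneg≡0 : ∀ {f : Row n} → (∀ i → 0ℤ ℤ.≤ f i) → sum f ≡ 0ℤ → ∀ i → f i ≡ 0ℤ
sum-nonneg≡0 {suc n} {f} p e i with nonneg-+≡0 {f zero} {sum (f ∘ suc)} (p zero) (sum-nonneg (p ∘ suc)) e
sum-nonneg≡0 p e zero    | e₀ , _  = e₀
sum-nonneg≡0 p e (suc i) | _  , eₛ = sum-nonneg≡0 (p ∘ suc) eₛ i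

-- For symmetric P the trace of P² is the sum of the squares of all entries.
symmetric-square≡0 : ∀ (P : Matrix n) → (∀ i j → P i j ≡ P j i) → trace (P ⊡ P) ≡ 0ℤ → ∀ i j → P i j ≡ 0ℤ
symmetric-square≡0 P P-sym e i j = square≡0 (P i j) (trans (cong (P i j *_) (P-sym i j))
  (sum-nonneg≡0 (nonneg i) (sum-nonneg≡0 (λ k → sum-nonneg (nonneg k)) e i) j))
  where
  nonneg : ∀ i j → 0ℤ ℤ.≤ P i j * P j i
  nonneg i j = subst (λ x → 0ℤ ℤ.≤ P i j * x) (P-sym i j) (square-nonneg (P i j))

polynomial-sym : ∀ (c : Row m) (A : Matrix n) → (∀ i j → A i j ≡ A j i) → ∀ i j → polynomial c A i j ≡ polynomial c A j i
polynomial-sym c A A-sym i j = sum-cong-≗ λ k → cong (c k *_) (⇑-sym A A-sym (toℕ k) i j)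

-- The friendship graph

-- The coefficients of (x² - 1)(x² - x - 2a).
annihilator : ℤ → Row 5
annihilator a zero                         = + 2 * a
annihilator a (suc zero)                   = 1ℤ
annihilator a (suc (suc zero))             = - (+ 2 * a + 1ℤ)
annihilator a (suc (suc (suc zero)))       = - 1ℤ
annihilator a (suc (suc (suc (suc zero)))) = 1ℤ

sum-constant : ∀ m c → sum {m} (λ _ → c) ≡ + m * c
sum-constant zero    c = refl
sum-constant (suc m) c = trans (cong (λ x → c + x) (sum-constant m c)) (sym (ℤ.suc-* (+ m) c))

-- Away from its centre the friendship graph is a perfect matching, given here by a fixed-point-free
-- involution. Working with `partner` alone keeps the arithmetic of `remQuot` out of the computation
-- of powers.
module Windmill {m} (partner : Fin m → Fin m) (partner-involutive : ∀ u → partner (partner u) ≡ u)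
  (partner-irrefl : ∀ u → partner u ≢ u) where

  windmill : Matrix (suc m)
  windmill zero    zero    = 0ℤ
  windmill zero    (suc v) = 1ℤ
  windmill (suc u) zero    = 1ℤ
  windmill (suc u) (suc v) = I (partner u) v

  I-partner : ∀ u v → I (partner u) v ≡ I u (partner v)
  I-partner u v with u ≟ partner v
  ... | yes refl = trans (cong (λ w → I w v) (partner-involutive v)) (I-diagonal v)
  ... | no  u≢   = I-off-diagonal λ e → u≢ (trans (sym (partner-involutive u)) (cong partner e))

  sum-I-partner : ∀ v → sum (λ u → I (partner u) v) ≡ 1ℤ
  sum-I-partner v = trans (sum-cong-≗ λ u → trans (I-partner u v) (trans (I-sym u (partner v)) (sym (ℤ.*-identityʳ (I (partner v) u)))))
    (sum-I (λ _ → 1ℤ) (partner v))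

  centre-row : ∀ N v → (windmill ⊡ N) zero v ≡ sum (λ w → N (suc w) v)
  centre-row N v = trans (cong (λ x → x + sum (λ w → 1ℤ * N (suc w) v)) (ℤ.*-zeroˡ (N zero v)))
    (trans (ℤ.+-identityˡ (sum (λ w → 1ℤ * N (suc w) v))) (sum-cong-≗ λ w → ℤ.*-identityˡ (N (suc w) v)))

  outer-row : ∀ N u v → (windmill ⊡ N) (suc u) v ≡ N zero v + N (suc (partner u)) v
  outer-row N u v = cong₂ _+_ (ℤ.*-identityˡ (N zero v)) (sum-I (λ w → N (suc w) v) (partner u))

  M : ℤ
  M = + m

  power : ℕ → Matrix (suc m)
  power k = windmill ⇑ k

  -- On each block cut out by the centre, the powers from 2 to 4 are constant up to adding `I` or
  -- the partner matrix. These closed forms yield both `annihilated` and the traces.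
  square-00 : power 2 zero zero ≡ M
  square-00 = trans (centre-row (power 1) zero) (trans (sum-cong-≗ λ w → ⇑-1 windmill (suc w) zero)
    (trans (sum-constant m 1ℤ) (ℤ.*-identityʳ M)))

  square-0s : ∀ v → power 2 zero (suc v) ≡ 1ℤ
  square-0s v = trans (centre-row (power 1) (suc v)) (trans (sum-cong-≗ λ w → ⇑-1 windmill (suc w) (suc v)) (sum-I-partner v))

  square-s0 : ∀ u → power 2 (suc u) zero ≡ 1ℤ
  square-s0 u = trans (outer-row (power 1) u zero) (cong₂ _+_ (⇑-1 windmill zero zero) (⇑-1 windmill (suc (partner u)) zero))

  square-ss : ∀ u v → power 2 (suc u) (suc v) ≡ 1ℤ + I u v
  square-ss u v = trans (outer-row (power 1) u (suc v)) (cong₂ _+_ (⇑-1 windmill zero (suc v))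
    (trans (⇑-1 windmill (suc (partner u)) (suc v)) (cong (λ w → I w v) (partner-involutive u))))

  cube-00 : power 3 zero zero ≡ M
  cube-00 = trans (centre-row (power 2) zero) (trans (sum-cong-≗ square-s0) (trans (sum-constant m 1ℤ) (ℤ.*-identityʳ M)))

  cube-0s : ∀ v → power 3 zero (suc v) ≡ M + 1ℤ
  cube-0s v = trans (centre-row (power 2) (suc v)) (trans (sum-cong-≗ λ w → square-ss w v)
    (trans (∑-distrib-+ (λ _ → 1ℤ) (λ w → I w v)) (cong₂ _+_ (trans (sum-constant m 1ℤ) (ℤ.*-identityʳ M))
      (trans (sum-cong-≗ λ w → trans (I-sym w v) (sym (ℤ.*-identityʳ (I v w)))) (sum-I (λ _ → 1ℤ) v)))))

  cube-s0 : ∀ u → power 3 (suc u) zero ≡ M + 1ℤ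
  cube-s0 u = trans (outer-row (power 2) u zero) (cong₂ _+_ square-00 (square-s0 (partner u)))

  cube-ss : ∀ u v → power 3 (suc u) (suc v) ≡ + 2 + I (partner u) v
  cube-ss u v = trans (outer-row (power 2) u (suc v)) (trans (cong₂ _+_ (square-0s v) (square-ss (partner u) v))
    (sym (ℤ.+-assoc 1ℤ 1ℤ (I (partner u) v))))

  fourth-00 : power 4 zero zero ≡ M * (M + 1ℤ)
  fourth-00 = trans (centre-row (power 3) zero) (trans (sum-cong-≗ cube-s0) (sum-constant m (M + 1ℤ)))

  fourth-0s : ∀ v → power 4 zero (suc v) ≡ M * + 2 + 1ℤ
  fourth-0s v = trans (centre-row (power 3) (suc v)) (trans (sum-cong-≗ λ w → cube-ss w v)
    (trans (∑-distrib-+ (λ _ → + 2) (λ w → I (partner w) v)) (cong₂ _+_ (sum-constant m (+ 2)) (sum-I-partner v))))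

  fourth-s0 : ∀ u → power 4 (suc u) zero ≡ M + (M + 1ℤ)
  fourth-s0 u = trans (outer-row (power 3) u zero) (cong₂ _+_ cube-00 (cube-s0 (partner u)))

  fourth-ss : ∀ u v → power 4 (suc u) (suc v) ≡ (M + 1ℤ) + (+ 2 + I u v)
  fourth-ss u v = trans (outer-row (power 3) u (suc v)) (cong₂ _+_ (cube-0s v)
    (trans (cube-ss (partner u) v) (cong (λ w → + 2 + I w v) (partner-involutive u))))

  module _ (a : ℤ) (M≡2a : M ≡ + 2 * a) where

    private
      combination-cong : ∀ {x₀ x₁ x₂ x₃ x₄ y₁ y₂ y₃ y₄} → x₁ ≡ y₁ → x₂ ≡ y₂ → x₃ ≡ y₃ → x₄ ≡ y₄ →
        + 2 * a * x₀ + (1ℤ * x₁ + (- (+ 2 * a + 1ℤ) * x₂ + (- 1ℤ * x₃ + (1ℤ * x₄ + 0ℤ)))) ≡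
        + 2 * a * x₀ + (1ℤ * y₁ + (- (+ 2 * a + 1ℤ) * y₂ + (- 1ℤ * y₃ + (1ℤ * y₄ + 0ℤ))))
      combination-cong refl refl refl refl = refl

      case-00 : ∀ a → + 2 * a * 1ℤ + (1ℤ * 0ℤ + (- (+ 2 * a + 1ℤ) * (+ 2 * a) + (- 1ℤ * (+ 2 * a) + (1ℤ * (+ 2 * a * (+ 2 * a + 1ℤ)) + 0ℤ)))) ≡ 0ℤ
      case-00 = solve-∀
      case-0s : ∀ a → + 2 * a * 0ℤ + (1ℤ * 1ℤ + (- (+ 2 * a + 1ℤ) * 1ℤ + (- 1ℤ * (+ 2 * a + 1ℤ) + (1ℤ * (+ 2 * a * + 2 + 1ℤ) + 0ℤ)))) ≡ 0ℤ
      case-0s = solve-∀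
      case-s0 : ∀ a → + 2 * a * 0ℤ + (1ℤ * 1ℤ + (- (+ 2 * a + 1ℤ) * 1ℤ + (- 1ℤ * (+ 2 * a + 1ℤ) + (1ℤ * (+ 2 * a + (+ 2 * a + 1ℤ)) + 0ℤ)))) ≡ 0ℤ
      case-s0 = solve-∀
      case-ss : ∀ a x y → + 2 * a * x + (1ℤ * y + (- (+ 2 * a + 1ℤ) * (1ℤ + x) + (- 1ℤ * (+ 2 + y) + (1ℤ * ((+ 2 * a + 1ℤ) + (+ 2 + x)) + 0ℤ)))) ≡ 0ℤ
      case-ss = solve-∀

    annihilated : ∀ i j → polynomial (annihilator a) windmill i j ≡ 0ℤ
    annihilated zero zero = trans (combination-cong {1ℤ} {power 1 zero zero} {power 2 zero zero} {power 3 zero zero} {power 4 zero zero}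
      (⇑-1 windmill zero zero) (trans square-00 M≡2a) (trans cube-00 M≡2a) (trans fourth-00 (cong (λ z → z * (z + 1ℤ)) M≡2a))) (case-00 a)
    annihilated zero (suc v) = trans (combination-cong {0ℤ} {power 1 zero (suc v)} {power 2 zero (suc v)} {power 3 zero (suc v)} {power 4 zero (suc v)}
      (⇑-1 windmill zero (suc v)) (square-0s v) (trans (cube-0s v) (cong (λ z → z + 1ℤ) M≡2a))
      (trans (fourth-0s v) (cong (λ z → z * + 2 + 1ℤ) M≡2a))) (case-0s a)
    annihilated (suc u) zero = trans (combination-cong {0ℤ} {power 1 (suc u) zero} {power 2 (suc u) zero} {power 3 (suc u) zero} {power 4 (suc u) zero}
      (⇑-1 windmill (suc u) zero) (square-s0 u) (trans (cube-s0 u) (cong (λ z → z + 1ℤ) M≡2a))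
      (trans (fourth-s0 u) (cong (λ z → z + (z + 1ℤ)) M≡2a))) (case-s0 a)
    annihilated (suc u) (suc v) = trans (combination-cong {I u v} {power 1 (suc u) (suc v)} {power 2 (suc u) (suc v)} {power 3 (suc u) (suc v)} {power 4 (suc u) (suc v)}
      (⇑-1 windmill (suc u) (suc v)) (square-ss u v) (cube-ss u v)
      (trans (fourth-ss u v) (cong (λ z → (z + 1ℤ) + (+ 2 + I u v)) M≡2a))) (case-ss a (I u v) (I (partner u) v))

  trace-I : trace (power 0) ≡ M + 1ℤ
  trace-I = trans (cong (λ x → 1ℤ + x) (trans (sum-cong-≗ {m} λ i → I-diagonal (suc i)) (trans (sum-constant m 1ℤ) (ℤ.*-identityʳ M)))) (ℤ.+-comm 1ℤ M)

  trace-power-1 : trace (power 1) ≡ 0ℤ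
  trace-power-1 = cong₂ _+_ (⇑-1 windmill zero zero)
    (sum-zero λ u → trans (⇑-1 windmill (suc u) (suc u)) (I-off-diagonal (partner-irrefl u)))

  trace-power-2 : trace (power 2) ≡ M + M * + 2
  trace-power-2 = cong₂ _+_ square-00 (trans (sum-cong-≗ λ u → trans (square-ss u u) (cong (λ x → 1ℤ + x) (I-diagonal u))) (sum-constant m (+ 2)))

  trace-power-3 : trace (power 3) ≡ M + M * + 2
  trace-power-3 = cong₂ _+_ cube-00 (trans (sum-cong-≗ λ u → trans (cube-ss u u) (cong (λ x → + 2 + x) (I-off-diagonal (partner-irrefl u)))) (sum-constant m (+ 2)))

module FriendshipPartner (n : ℕ) where

  other : Fin 2 → Fin 2
  other zero       = suc zero
  other (suc zero) = zero

  other-involutive : ∀ a → other (other a) ≡ a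
  other-involutive zero       = refl
  other-involutive (suc zero) = refl

  other-irrefl : ∀ a → other a ≢ a
  other-irrefl zero       ()
  other-irrefl (suc zero) ()

  other-unique : ∀ a b → a ≢ b → other a ≡ b
  other-unique zero       zero       a≢b = contradiction refl a≢b
  other-unique zero       (suc zero) a≢b = refl
  other-unique (suc zero) zero       a≢b = refl
  other-unique (suc zero) (suc zero) a≢b = contradiction refl a≢b

  triangle : Fin (n ℕ.* 2) → Fin n
  triangle u = proj₁ (remQuot {n} 2 u)

  corner : Fin (n ℕ.* 2) → Fin 2
  corner u = proj₂ (remQuot {n} 2 u)

  partner : Fin (n ℕ.* 2) → Fin (n ℕ.* 2)
  partner u = combine (triangle u) (other (corner u))

  triangle-partner : ∀ u → triangle (partner u) ≡ triangle u
  triangle-partner u = cong proj₁ (remQuot-combine (triangle u) (other (corner u)))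

  corner-partner : ∀ u → corner (partner u) ≡ other (corner u)
  corner-partner u = cong proj₂ (remQuot-combine (triangle u) (other (corner u)))

  partner-involutive : ∀ u → partner (partner u) ≡ u
  partner-involutive u = trans (cong₂ combine (triangle-partner u) (trans (cong other (corner-partner u)) (other-involutive (corner u))))
    (combine-remQuot {n} 2 u)

  partner-irrefl : ∀ u → partner u ≢ u
  partner-irrefl u e = other-irrefl (corner u) (trans (sym (corner-partner u)) (cong corner e))

  open Windmill partner partner-involutive partner-irrefl public

  friendship-windmill : ∀ i j → integerAdjacency (friendship n) i j ≡ windmill i j
  friendship-windmill zero    zero    = refl
  friendship-windmill zero    (suc v) = refl
  friendship-windmill (suc u) zero    = refl
  friendship-windmill (suc u) (suc v) = outer
    where
    outer : (if does (triangle u ≟ triangle v) ∧ not (does (corner u ≟ corner v)) then 1ℤ else 0ℤ) ≡ I (partner u) v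
    outer with triangle u ≟ triangle v | corner u ≟ corner v
    ... | yes t≡ | no c≢  = sym (trans (cong (λ w → I w v)
            (trans (cong₂ combine t≡ (other-unique (corner u) (corner v) c≢)) (combine-remQuot {n} 2 v))) (I-diagonal v))
    ... | yes t≡ | yes c≡ = sym (I-off-diagonal λ e → other-irrefl (corner u) (trans (sym (corner-partner u)) (trans (cong corner e) (sym c≡))))
    ... | no  t≢ | _      = sym (I-off-diagonal λ e → t≢ (trans (sym (triangle-partner u)) (cong triangle e)))

-- Matrices annihilated by (x² - 1)(x² - x - 2a)

module Annihilated (A : Matrix n) (a : ℤ) (annihilated : ∀ i j → polynomial (annihilator a) A i j ≡ 0ℤ) where

  -- The annihilating relation times A ^ k, solved for the leading power. It reduces every power to
  -- the first four.
  recurrence : ∀ k i j → (A ⇑ (4 ℕ.+ k)) i j ≡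
    (A ⇑ (3 ℕ.+ k)) i j + (+ 2 * a + 1ℤ) * (A ⇑ (2 ℕ.+ k)) i j - (A ⇑ (1 ℕ.+ k)) i j - + 2 * a * (A ⇑ k) i j
  recurrence zero i j = trans (solve-for (I i j) ((A ⇑ 1) i j) ((A ⇑ 2) i j) ((A ⇑ 3) i j) ((A ⇑ 4) i j) a)
    (trans (cong (λ z → z + rest) (annihilated i j)) (ℤ.+-identityˡ rest))
    where
    rest : ℤ
    rest = (A ⇑ 3) i j + (+ 2 * a + 1ℤ) * (A ⇑ 2) i j - (A ⇑ 1) i j - + 2 * a * I i j
    solve-for : ∀ x₀ x₁ x₂ x₃ x₄ a → x₄ ≡
      (+ 2 * a * x₀ + (1ℤ * x₁ + (- (+ 2 * a + 1ℤ) * x₂ + (- 1ℤ * x₃ + (1ℤ * x₄ + 0ℤ))))) + (x₃ + (+ 2 * a + 1ℤ) * x₂ - x₁ - + 2 * a * x₀)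
    solve-for = solve-∀
  recurrence (suc k) i j = begin
    sum (λ l → A i l * (A ⇑ (4 ℕ.+ k)) l j)
      ≡⟨ sum-linear c {f = λ l → A i l * x₂ l} {g = λ l → (- 1ℤ) * (A i l * x₁ l) + ((- d) * (A i l * x₀ l) + A i l * x₃ l)}
           (λ l → trans (cong (A i l *_) (recurrence k l j)) (distrib (A i l) (x₃ l) c (x₂ l) (x₁ l) d (x₀ l))) ⟩
    c * (A ⇑ (3 ℕ.+ k)) i j + sum (λ l → (- 1ℤ) * (A i l * x₁ l) + ((- d) * (A i l * x₀ l) + A i l * x₃ l))
      ≡⟨ cong (λ z → c * (A ⇑ (3 ℕ.+ k)) i j + z) (sum-linear (- 1ℤ) {f = λ l → A i l * x₁ l} {g = λ l → (- d) * (A i l * x₀ l) + A i l * x₃ l} λ _ → refl) ⟩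
    c * (A ⇑ (3 ℕ.+ k)) i j + ((- 1ℤ) * (A ⇑ (2 ℕ.+ k)) i j + sum (λ l → (- d) * (A i l * x₀ l) + A i l * x₃ l))
      ≡⟨ cong (λ z → c * (A ⇑ (3 ℕ.+ k)) i j + ((- 1ℤ) * (A ⇑ (2 ℕ.+ k)) i j + z)) (sum-linear (- d) {f = λ l → A i l * x₀ l} {g = λ l → A i l * x₃ l} λ _ → refl) ⟩
    c * (A ⇑ (3 ℕ.+ k)) i j + ((- 1ℤ) * (A ⇑ (2 ℕ.+ k)) i j + ((- d) * (A ⇑ (1 ℕ.+ k)) i j + (A ⇑ (4 ℕ.+ k)) i j))
      ≡⟨ reorder c d ((A ⇑ (3 ℕ.+ k)) i j) ((A ⇑ (2 ℕ.+ k)) i j) ((A ⇑ (1 ℕ.+ k)) i j) ((A ⇑ (4 ℕ.+ k)) i j) ⟩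
    (A ⇑ (4 ℕ.+ k)) i j + c * (A ⇑ (3 ℕ.+ k)) i j - (A ⇑ (2 ℕ.+ k)) i j - d * (A ⇑ (1 ℕ.+ k)) i j ∎
    where
    c d : ℤ
    c = + 2 * a + 1ℤ
    d = + 2 * a
    x₀ x₁ x₂ x₃ : Row n
    x₀ l = (A ⇑ k) l j
    x₁ l = (A ⇑ (1 ℕ.+ k)) l j
    x₂ l = (A ⇑ (2 ℕ.+ k)) l j
    x₃ l = (A ⇑ (3 ℕ.+ k)) l j
    distrib : ∀ w x₃ c x₂ x₁ d x₀ → w * (x₃ + c * x₂ - x₁ - d * x₀) ≡ c * (w * x₂) + ((- 1ℤ) * (w * x₁) + ((- d) * (w * x₀) + w * x₃))
    distrib = solve-∀
    reorder : ∀ c d p q r s → c * p + ((- 1ℤ) * q + ((- d) * r + s)) ≡ s + c * p - q - d * r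
    reorder = solve-∀

  difference-⊡ : ∀ p q r s i j → sum (λ l → ((A ⇑ p) i l - (A ⇑ q) i l) * ((A ⇑ r) l j - (A ⇑ s) l j)) ≡
    (A ⇑ (p ℕ.+ r)) i j - (A ⇑ (p ℕ.+ s)) i j - (A ⇑ (q ℕ.+ r)) i j + (A ⇑ (q ℕ.+ s)) i j
  difference-⊡ p q r s i j = begin
    sum (λ l → (x l - y l) * (u l - v l))
      ≡⟨ sum-linear (- 1ℤ) {f = λ l → x l * v l} {g = λ l → (- 1ℤ) * (y l * u l) + (1ℤ * (x l * u l) + y l * v l)} (λ l → distrib (x l) (y l) (u l) (v l)) ⟩
    (- 1ℤ) * sum (λ l → x l * v l) + sum (λ l → (- 1ℤ) * (y l * u l) + (1ℤ * (x l * u l) + y l * v l))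
      ≡⟨ cong (λ z → (- 1ℤ) * sum (λ l → x l * v l) + z) (trans
           (sum-linear (- 1ℤ) {f = λ l → y l * u l} {g = λ l → 1ℤ * (x l * u l) + y l * v l} λ _ → refl)
           (cong (λ z → (- 1ℤ) * sum (λ l → y l * u l) + z) (sum-linear 1ℤ {f = λ l → x l * u l} {g = λ l → y l * v l} λ _ → refl))) ⟩
    (- 1ℤ) * sum (λ l → x l * v l) + ((- 1ℤ) * sum (λ l → y l * u l) + (1ℤ * sum (λ l → x l * u l) + sum (λ l → y l * v l)))
      ≡⟨ reorder (sum (λ l → x l * v l)) (sum (λ l → y l * u l)) (sum (λ l → x l * u l)) (sum (λ l → y l * v l)) ⟩
    sum (λ l → x l * u l) - sum (λ l → x l * v l) - sum (λ l → y l * u l) + sum (λ l → y l * v l)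
      ≡⟨ cong₂ _+_ (cong₂ _-_ (cong₂ _-_ (⇑-+ A p r i j) (⇑-+ A p s i j)) (⇑-+ A q r i j)) (⇑-+ A q s i j) ⟩
    (A ⇑ (p ℕ.+ r)) i j - (A ⇑ (p ℕ.+ s)) i j - (A ⇑ (q ℕ.+ r)) i j + (A ⇑ (q ℕ.+ s)) i j ∎
    where
    x y u v : Row n
    x l = (A ⇑ p) i l
    y l = (A ⇑ q) i l
    u l = (A ⇑ r) l j
    v l = (A ⇑ s) l j
    distrib : ∀ x y u v → (x - y) * (u - v) ≡ (- 1ℤ) * (x * v) + ((- 1ℤ) * (y * u) + (1ℤ * (x * u) + y * v))
    distrib = solve-∀
    reorder : ∀ xv yu xu yv → (- 1ℤ) * xv + ((- 1ℤ) * yu + (1ℤ * xu + yv)) ≡ xu - xv - yu + yv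
    reorder = solve-∀

  -- `R` = A² - I and `Y` = A R span the multiples of x² - 1 modulo the annihilator. On this span A
  -- satisfies x² = x + 2a, which determines the product formulas below.
  R Y : Matrix n
  R i j = (A ⇑ 2) i j - (A ⇑ 0) i j
  Y i j = (A ⇑ 3) i j - (A ⇑ 1) i j

  R⊡R : ∀ i j → (R ⊡ R) i j ≡ Y i j + (+ 2 * a - 1ℤ) * R i j
  R⊡R i j = trans (difference-⊡ 2 0 2 0 i j) (trans (cong (λ z → z - x 2 - x 2 + x 0) (recurrence 0 i j)) (simplify a (x 0) (x 1) (x 2) (x 3)))
    where
    x : ℕ → ℤ
    x k = (A ⇑ k) i j
    simplify : ∀ a x₀ x₁ x₂ x₃ → (x₃ + (+ 2 * a + 1ℤ) * x₂ - x₁ - + 2 * a * x₀) - x₂ - x₂ + x₀ ≡ x₃ - x₁ + (+ 2 * a - 1ℤ) * (x₂ - x₀)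
    simplify = solve-∀

  fifth-power : ∀ i j → (A ⇑ 5) i j - (A ⇑ 3) i j - (A ⇑ 3) i j + (A ⇑ 1) i j ≡ + 2 * a * Y i j + + 2 * a * R i j
  fifth-power i j = trans (cong (λ z → z - x 3 - x 3 + x 1) (trans (recurrence 1 i j) (cong (λ z → z + (+ 2 * a + 1ℤ) * x 3 - x 2 - + 2 * a * x 1) (recurrence 0 i j))))
    (simplify a (x 0) (x 1) (x 2) (x 3))
    where
    x : ℕ → ℤ
    x k = (A ⇑ k) i j
    simplify : ∀ a x₀ x₁ x₂ x₃ → ((x₃ + (+ 2 * a + 1ℤ) * x₂ - x₁ - + 2 * a * x₀) + (+ 2 * a + 1ℤ) * x₃ - x₂ - + 2 * a * x₁) - x₃ - x₃ + x₁
      ≡ + 2 * a * (x₃ - x₁) + + 2 * a * (x₂ - x₀)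
    simplify = solve-∀

  Y⊡R : ∀ i j → (Y ⊡ R) i j ≡ + 2 * a * Y i j + + 2 * a * R i j
  Y⊡R i j = trans (difference-⊡ 3 1 2 0 i j) (fifth-power i j)

  R⊡Y : ∀ i j → (R ⊡ Y) i j ≡ + 2 * a * Y i j + + 2 * a * R i j
  R⊡Y i j = trans (difference-⊡ 2 0 3 1 i j) (fifth-power i j)

  Y⊡Y : ∀ i j → (Y ⊡ Y) i j ≡ + 4 * a * Y i j + + 4 * a * a * R i j
  Y⊡Y i j = trans (difference-⊡ 3 1 3 1 i j) (trans (expand (x 2) (x 3) (x 4) (x 5) (x 6) (recurrence 2 i j) (recurrence 1 i j) (recurrence 0 i j))
    (simplify a (x 0) (x 1) (x 2) (x 3)))
    where
    x : ℕ → ℤ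
    x k = (A ⇑ k) i j
    expand : ∀ x₂ x₃ x₄ x₅ x₆ → let f = λ x₃ x₂ x₁ x₀ → x₃ + (+ 2 * a + 1ℤ) * x₂ - x₁ - + 2 * a * x₀ in
      x₆ ≡ f x₅ x₄ x₃ x₂ → x₅ ≡ f x₄ x₃ x₂ (x 1) → x₄ ≡ f x₃ x₂ (x 1) (x 0) →
      x₆ - x₄ - x₄ + x₂ ≡ f (f (f x₃ x₂ (x 1) (x 0)) x₃ x₂ (x 1)) (f x₃ x₂ (x 1) (x 0)) x₃ x₂ - f x₃ x₂ (x 1) (x 0) - f x₃ x₂ (x 1) (x 0) + x₂
    expand x₂ x₃ x₄ x₅ x₆ refl refl refl = refl
    simplify : ∀ a x₀ x₁ x₂ x₃ →
      (((x₃ + (+ 2 * a + 1ℤ) * x₂ - x₁ - + 2 * a * x₀) + (+ 2 * a + 1ℤ) * x₃ - x₂ - + 2 * a * x₁)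
        + (+ 2 * a + 1ℤ) * (x₃ + (+ 2 * a + 1ℤ) * x₂ - x₁ - + 2 * a * x₀) - x₃ - + 2 * a * x₂)
      - (x₃ + (+ 2 * a + 1ℤ) * x₂ - x₁ - + 2 * a * x₀) - (x₃ + (+ 2 * a + 1ℤ) * x₂ - x₁ - + 2 * a * x₀) + x₂
      ≡ + 4 * a * (x₃ - x₁) + + 4 * a * a * (x₂ - x₀)
    simplify = solve-∀

-- The ring ℤ[η] with η² = 2a - η

data ℤ[η] : Set where
  _+η_ : ℤ → ℤ → ℤ[η]

constant : ℤ[η] → ℤ
constant (c +η _) = c

module EtaRing (a : ℤ) where

  infixl 6 _⊞_
  infixl 7 _⊠_

  _⊞_ _⊠_ : ℤ[η] → ℤ[η] → ℤ[η]
  (c +η b) ⊞ (c′ +η b′) = (c + c′) +η (b + b′)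
  (c +η b) ⊠ (c′ +η b′) = (c * c′ + b * b′ * (+ 2 * a)) +η (c * b′ + b * c′ - b * b′)

  ⊟_ : ℤ[η] → ℤ[η]
  ⊟ (c +η b) = (- c) +η (- b)

  0η 1η : ℤ[η]
  0η = 0ℤ +η 0ℤ
  1η = 1ℤ +η 0ℤ

  private
    assoc₁ : ∀ a x y z u v w → (x * z + y * u * (+ 2 * a)) * v + (x * u + y * z - y * u) * w * (+ 2 * a)
      ≡ x * (z * v + u * w * (+ 2 * a)) + y * (z * w + u * v - u * w) * (+ 2 * a)
    assoc₁ = solve-∀
    assoc₂ : ∀ a x y z u v w → (x * z + y * u * (+ 2 * a)) * w + (x * u + y * z - y * u) * v - (x * u + y * z - y * u) * w
      ≡ x * (z * w + u * v - u * w) + y * (z * v + u * w * (+ 2 * a)) - y * (z * w + u * v - u * w)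
    assoc₂ = solve-∀
    comm₁ : ∀ a x y z u → x * z + y * u * (+ 2 * a) ≡ z * x + u * y * (+ 2 * a)
    comm₁ = solve-∀
    comm₂ : ∀ x y z u → x * u + y * z - y * u ≡ z * y + u * x - u * y
    comm₂ = solve-∀
    identity₁ : ∀ a x y → 1ℤ * x + 0ℤ * y * (+ 2 * a) ≡ x
    identity₁ = solve-∀
    identity₂ : ∀ x y → 1ℤ * y + 0ℤ * x - 0ℤ * y ≡ y
    identity₂ = solve-∀
    distrib₁ : ∀ a x y z u v w → x * (z + v) + y * (u + w) * (+ 2 * a) ≡ (x * z + y * u * (+ 2 * a)) + (x * v + y * w * (+ 2 * a))
    distrib₁ = solve-∀
    distrib₂ : ∀ x y z u v w → x * (u + w) + y * (z + v) - y * (u + w) ≡ (x * u + y * z - y * u) + (x * w + y * v - y * w)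
    distrib₂ = solve-∀

  ⊠-comm : ∀ x y → x ⊠ y ≡ y ⊠ x
  ⊠-comm (x +η y) (z +η u) = cong₂ _+η_ (comm₁ a x y z u) (comm₂ x y z u)

  ⊠-identityˡ : ∀ x → 1η ⊠ x ≡ x
  ⊠-identityˡ (x +η y) = cong₂ _+η_ (identity₁ a x y) (identity₂ x y)

  ⊠-distribˡ : ∀ x y z → x ⊠ (y ⊞ z) ≡ (x ⊠ y) ⊞ (x ⊠ z)
  ⊠-distribˡ (x +η y) (z +η u) (v +η w) = cong₂ _+η_ (distrib₁ a x y z u v w) (distrib₂ x y z u v w)

  isCommutativeRing : IsCommutativeRing _≡_ _⊞_ _⊠_ ⊟_ 0η 1η
  isCommutativeRing = record
    { isRing = record
      { +-isAbelianGroup = record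
        { isGroup = record
          { isMonoid = record
            { isSemigroup = record
              { isMagma = record { isEquivalence = isEquivalence ; ∙-cong = cong₂ _⊞_ }
              ; assoc = λ { (x +η y) (z +η u) (v +η w) → cong₂ _+η_ (ℤ.+-assoc x z v) (ℤ.+-assoc y u w) } }
            ; identity = (λ { (x +η y) → cong₂ _+η_ (ℤ.+-identityˡ x) (ℤ.+-identityˡ y) })
                       , (λ { (x +η y) → cong₂ _+η_ (ℤ.+-identityʳ x) (ℤ.+-identityʳ y) }) }
          ; inverse = (λ { (x +η y) → cong₂ _+η_ (ℤ.+-inverseˡ x) (ℤ.+-inverseˡ y) })
                    , (λ { (x +η y) → cong₂ _+η_ (ℤ.+-inverseʳ x) (ℤ.+-inverseʳ y) })
          ; ⁻¹-cong = cong ⊟_ }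
        ; comm = λ { (x +η y) (z +η u) → cong₂ _+η_ (ℤ.+-comm x z) (ℤ.+-comm y u) } }
      ; *-cong = cong₂ _⊠_
      ; *-assoc = λ { (x +η y) (z +η u) (v +η w) → cong₂ _+η_ (assoc₁ a x y z u v w) (assoc₂ a x y z u v w) }
      ; *-identity = ⊠-identityˡ , (λ x → trans (⊠-comm x 1η) (⊠-identityˡ x))
      ; distrib = ⊠-distribˡ , (λ x y z → trans (⊠-comm (y ⊞ z) x) (trans (⊠-distribˡ x y z) (cong₂ _⊞_ (⊠-comm x y) (⊠-comm x z)))) }
    ; *-comm = ⊠-comm }

  commutativeRing : CommutativeRing 0ℓ 0ℓ
  commutativeRing = record { isCommutativeRing = isCommutativeRing }

  private
    embed-* : ∀ a i j → i * j ≡ i * j + 0ℤ * 0ℤ * (+ 2 * a)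
    embed-* = solve-∀
    embed-*₂ : ∀ i j → 0ℤ ≡ i * 0ℤ + 0ℤ * j - 0ℤ * 0ℤ
    embed-*₂ = solve-∀

  embedding : ℤ.+-*-rawRing Coefficients.-Raw-AlmostCommutative⟶ Coefficients.fromCommutativeRing commutativeRing
  embedding = record
    { ⟦_⟧    = λ i → i +η 0ℤ
    ; +-homo = λ _ _ → refl
    ; *-homo = λ i j → cong₂ _+η_ (embed-* a i j) (embed-*₂ i j)
    ; -‿homo = λ _ → refl
    ; 0-homo = refl
    ; 1-homo = refl
    }

  module Solver = RingNormalForm ℤ.+-*-rawRing (Coefficients.fromCommutativeRing commutativeRing) embedding
    (λ i j → dec⇒maybe (map′ (cong (_+η 0ℤ)) (cong constant) (i ℤ.≟ j)))

  module Sum = SemiringSum (CommutativeRing.semiring commutativeRing)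

  sumη-linear : ∀ c (f g : Fin n → ℤ[η]) → Sum.sum (λ i → c ⊠ f i ⊞ g i) ≡ c ⊠ Sum.sum f ⊞ Sum.sum g
  sumη-linear c f g = trans (Sum.∑-distrib-+ (λ i → c ⊠ f i) g) (cong (_⊞ Sum.sum g) (sym (Sum.*-distribˡ-sum c f)))

  sumη-components : ∀ (f g : Row n) → Sum.sum (λ i → f i +η g i) ≡ sum f +η sum g
  sumη-components {zero}  f g = refl
  sumη-components {suc n} f g = cong ((f zero +η g zero) ⊞_) (sumη-components (f ∘ suc) (g ∘ suc))

  constant-sum : ∀ (f : Fin n → ℤ[η]) → constant (Sum.sum f) ≡ sum (constant ∘ f)
  constant-sum {zero}  f = refl
  constant-sum {suc n} f = trans (constant-⊞ (f zero) (Sum.sum (f ∘ suc))) (cong (λ x → constant (f zero) + x) (constant-sum (f ∘ suc)))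
    where
    constant-⊞ : ∀ x y → constant (x ⊞ y) ≡ constant x + constant y
    constant-⊞ (_ +η _) (_ +η _) = refl

  -- For X = w P with P a projection of trace one, removing from P the parts
  -- along the orthogonal vectors P eᵢ and P eⱼ leaves a matrix of squared norm
  -- -1, up to a square factor.
  module _ (X : Fin n → Fin n → ℤ[η]) (w : ℤ[η]) (X-sym : ∀ k l → X k l ≡ X l k)
    (X² : ∀ k l → Sum.sum (λ r → X k r ⊠ X r l) ≡ w ⊠ X k l) (X-trace : Sum.sum (λ k → X k k) ≡ w)
    (i j : Fin n) (Xij≡0 : X i j ≡ 0η) where

    private
      α β : ℤ[η]
      α = X i i
      β = X j j
      p q : Fin n → ℤ[η]
      p = X i
      q = X j

    -- With denominators cleared, this is w α β times the matrix P less its projections onto P eᵢ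
    -- and P eⱼ, which are p pᵀ / (w α) and q qᵀ / (w β).
    residue : Fin n → Fin n → ℤ[η]
    residue k l = α ⊠ β ⊠ X k l ⊞ ⊟ (β ⊠ p k ⊠ p l) ⊞ ⊟ (α ⊠ q k ⊠ q l)

    private
      two : ℤ[η]
      two = (+ 2) +η 0ℤ

      expand : ∀ α β x p q p′ q′ → (α ⊠ β ⊠ x ⊞ ⊟ (β ⊠ p ⊠ p′) ⊞ ⊟ (α ⊠ q ⊠ q′)) ⊠ (α ⊠ β ⊠ x ⊞ ⊟ (β ⊠ p ⊠ p′) ⊞ ⊟ (α ⊠ q ⊠ q′)) ≡
        α ⊠ α ⊠ β ⊠ β ⊠ (x ⊠ x) ⊞ (β ⊠ β ⊠ p ⊠ p ⊠ (p′ ⊠ p′) ⊞ (α ⊠ α ⊠ q ⊠ q ⊠ (q′ ⊠ q′) ⊞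
        (⊟ (two ⊠ α ⊠ β ⊠ β ⊠ p) ⊠ (x ⊠ p′) ⊞ (⊟ (two ⊠ α ⊠ α ⊠ β ⊠ q) ⊠ (x ⊠ q′) ⊞ two ⊠ α ⊠ β ⊠ p ⊠ q ⊠ (p′ ⊠ q′)))))
      expand = solve 7 (λ α β x p q p′ q′ → (α :* β :* x :+ :- (β :* p :* p′) :+ :- (α :* q :* q′)) :* (α :* β :* x :+ :- (β :* p :* p′) :+ :- (α :* q :* q′)) :=
        α :* α :* β :* β :* (x :* x) :+ (β :* β :* p :* p :* (p′ :* p′) :+ (α :* α :* q :* q :* (q′ :* q′) :+
        (:- (con (+ 2) :* α :* β :* β :* p) :* (x :* p′) :+ (:- (con (+ 2) :* α :* α :* β :* q) :* (x :* q′) :+ con (+ 2) :* α :* β :* p :* q :* (p′ :* q′)))))) refl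
        where open Solver

      collect : ∀ α β w x p q → α ⊠ α ⊠ β ⊠ β ⊠ (w ⊠ x) ⊞ (β ⊠ β ⊠ p ⊠ p ⊠ (w ⊠ α) ⊞ (α ⊠ α ⊠ q ⊠ q ⊠ (w ⊠ β) ⊞
        (⊟ (two ⊠ α ⊠ β ⊠ β ⊠ p) ⊠ (w ⊠ p) ⊞ (⊟ (two ⊠ α ⊠ α ⊠ β ⊠ q) ⊠ (w ⊠ q) ⊞ two ⊠ α ⊠ β ⊠ p ⊠ q ⊠ (w ⊠ 0η))))) ≡
        w ⊠ α ⊠ α ⊠ β ⊠ β ⊠ x ⊞ (⊟ (w ⊠ α ⊠ β ⊠ β) ⊠ (p ⊠ p) ⊞ ⊟ (w ⊠ α ⊠ α ⊠ β) ⊠ (q ⊠ q))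
      collect = solve 6 (λ α β w x p q → α :* α :* β :* β :* (w :* x) :+ (β :* β :* p :* p :* (w :* α) :+ (α :* α :* q :* q :* (w :* β) :+
        (:- (con (+ 2) :* α :* β :* β :* p) :* (w :* p) :+ (:- (con (+ 2) :* α :* α :* β :* q) :* (w :* q) :+ con (+ 2) :* α :* β :* p :* q :* (w :* con 0ℤ))))) :=
        w :* α :* α :* β :* β :* x :+ (:- (w :* α :* β :* β) :* (p :* p) :+ :- (w :* α :* α :* β) :* (q :* q))) refl
        where open Solver

      total : ∀ α β w → w ⊠ α ⊠ α ⊠ β ⊠ β ⊠ w ⊞ (⊟ (w ⊠ α ⊠ β ⊠ β) ⊠ (w ⊠ α) ⊞ ⊟ (w ⊠ α ⊠ α ⊠ β) ⊠ (w ⊠ β)) ⊞ (w ⊠ (α ⊠ β)) ⊠ (w ⊠ (α ⊠ β)) ≡ 0η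
      total = solve 3 (λ α β w → w :* α :* α :* β :* β :* w :+ (:- (w :* α :* β :* β) :* (w :* α) :+ :- (w :* α :* α :* β) :* (w :* β)) :+ (w :* (α :* β)) :* (w :* (α :* β)) := con 0ℤ) refl
        where open Solver

      sum-p : ∀ k → Sum.sum (λ l → X k l ⊠ p l) ≡ w ⊠ p k
      sum-p k = trans (Sum.sum-cong-≗ λ l → cong (X k l ⊠_) (X-sym i l)) (trans (X² k i) (cong (w ⊠_) (X-sym k i)))

      sum-q : ∀ k → Sum.sum (λ l → X k l ⊠ q l) ≡ w ⊠ q k
      sum-q k = trans (Sum.sum-cong-≗ λ l → cong (X k l ⊠_) (X-sym j l)) (trans (X² k j) (cong (w ⊠_) (X-sym k j)))

      sum-XX : ∀ k → Sum.sum (λ l → X k l ⊠ X k l) ≡ w ⊠ X k k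
      sum-XX k = trans (Sum.sum-cong-≗ λ l → cong (X k l ⊠_) (X-sym k l)) (X² k k)

      row-norm : ∀ k → Sum.sum (λ l → residue k l ⊠ residue k l) ≡
        w ⊠ α ⊠ α ⊠ β ⊠ β ⊠ X k k ⊞ (⊟ (w ⊠ α ⊠ β ⊠ β) ⊠ (p k ⊠ p k) ⊞ ⊟ (w ⊠ α ⊠ α ⊠ β) ⊠ (q k ⊠ q k))
      row-norm k = begin
        Sum.sum (λ l → residue k l ⊠ residue k l)
          ≡⟨ Sum.sum-cong-≗ (λ l → expand α β (X k l) (p k) (q k) (p l) (q l)) ⟩
        Sum.sum (λ l → c₁ ⊠ (X k l ⊠ X k l) ⊞ g₂ l)
          ≡⟨ trans (sumη-linear c₁ (λ l → X k l ⊠ X k l) g₂) (cong₂ (λ u v → c₁ ⊠ u ⊞ v) (sum-XX k)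
            (trans (sumη-linear c₂ (λ l → p l ⊠ p l) g₃) (cong₂ (λ u v → c₂ ⊠ u ⊞ v) (sum-XX i)
            (trans (sumη-linear c₃ (λ l → q l ⊠ q l) g₄) (cong₂ (λ u v → c₃ ⊠ u ⊞ v) (sum-XX j)
            (trans (sumη-linear c₄ (λ l → X k l ⊠ p l) g₅) (cong₂ (λ u v → c₄ ⊠ u ⊞ v) (sum-p k)
            (trans (sumη-linear c₅ (λ l → X k l ⊠ q l) g₆) (cong₂ (λ u v → c₅ ⊠ u ⊞ v) (sum-q k)
            (trans (sym (Sum.*-distribˡ-sum c₆ (λ l → p l ⊠ q l)))
            (cong (c₆ ⊠_) (trans (sum-q i) (cong (w ⊠_) (trans (X-sym j i) Xij≡0)))))))))))))) ⟩
        c₁ ⊠ (w ⊠ X k k) ⊞ (c₂ ⊠ (w ⊠ α) ⊞ (c₃ ⊠ (w ⊠ β) ⊞ (c₄ ⊠ (w ⊠ p k) ⊞ (c₅ ⊠ (w ⊠ q k) ⊞ c₆ ⊠ (w ⊠ 0η)))))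
          ≡⟨ collect α β w (X k k) (p k) (q k) ⟩
        w ⊠ α ⊠ α ⊠ β ⊠ β ⊠ X k k ⊞ (⊟ (w ⊠ α ⊠ β ⊠ β) ⊠ (p k ⊠ p k) ⊞ ⊟ (w ⊠ α ⊠ α ⊠ β) ⊠ (q k ⊠ q k)) ∎
        where
        c₁ c₂ c₃ c₄ c₅ c₆ : ℤ[η]
        c₁ = α ⊠ α ⊠ β ⊠ β
        c₂ = β ⊠ β ⊠ p k ⊠ p k
        c₃ = α ⊠ α ⊠ q k ⊠ q k
        c₄ = ⊟ (two ⊠ α ⊠ β ⊠ β ⊠ p k)
        c₅ = ⊟ (two ⊠ α ⊠ α ⊠ β ⊠ q k)
        c₆ = two ⊠ α ⊠ β ⊠ p k ⊠ q k
        g₂ g₃ g₄ g₅ g₆ : Fin n → ℤ[η]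
        g₆ l = c₆ ⊠ (p l ⊠ q l)
        g₅ l = c₅ ⊠ (X k l ⊠ q l) ⊞ g₆ l
        g₄ l = c₄ ⊠ (X k l ⊠ p l) ⊞ g₅ l
        g₃ l = c₃ ⊠ (q l ⊠ q l) ⊞ g₄ l
        g₂ l = c₂ ⊠ (p l ⊠ p l) ⊞ g₃ l

    residue-norm : Sum.sum (λ k → Sum.sum (λ l → residue k l ⊠ residue k l)) ⊞ (w ⊠ (α ⊠ β)) ⊠ (w ⊠ (α ⊠ β)) ≡ 0η
    residue-norm = trans (cong (_⊞ (w ⊠ (α ⊠ β)) ⊠ (w ⊠ (α ⊠ β))) (begin
      Sum.sum (λ k → Sum.sum (λ l → residue k l ⊠ residue k l))
        ≡⟨ Sum.sum-cong-≗ row-norm ⟩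
      Sum.sum (λ k → d₁ ⊠ X k k ⊞ (d₂ ⊠ (p k ⊠ p k) ⊞ d₃ ⊠ (q k ⊠ q k)))
        ≡⟨ sumη-linear d₁ (λ k → X k k) (λ k → d₂ ⊠ (p k ⊠ p k) ⊞ d₃ ⊠ (q k ⊠ q k)) ⟩
      d₁ ⊠ Sum.sum (λ k → X k k) ⊞ Sum.sum (λ k → d₂ ⊠ (p k ⊠ p k) ⊞ d₃ ⊠ (q k ⊠ q k))
        ≡⟨ cong₂ (λ u v → d₁ ⊠ u ⊞ v) X-trace (trans (sumη-linear d₂ (λ k → p k ⊠ p k) (λ k → d₃ ⊠ (q k ⊠ q k)))
             (cong₂ (λ u v → d₂ ⊠ u ⊞ v) (sum-XX i) (trans (sym (Sum.*-distribˡ-sum d₃ (λ k → q k ⊠ q k))) (cong (d₃ ⊠_) (sum-XX j))))) ⟩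
      d₁ ⊠ w ⊞ (d₂ ⊠ (w ⊠ α) ⊞ d₃ ⊠ (w ⊠ β)) ∎))
      (total α β w)
      where
      d₁ d₂ d₃ : ℤ[η]
      d₁ = w ⊠ α ⊠ α ⊠ β ⊠ β
      d₂ = ⊟ (w ⊠ α ⊠ β ⊠ β)
      d₃ = ⊟ (w ⊠ α ⊠ α ⊠ β)

    -- Taking `constant` in `residue-norm` leaves a vanishing sum of terms c² + 2ab², each
    -- nonnegative because 0 ≤ a. So every term is zero, in particular the one of the last square,
    -- and its c is zero.
    constant-vanishes : 0ℤ ℤ.≤ a → constant (w ⊠ (X i i ⊠ X j j)) ≡ 0ℤ
    constant-vanishes 0≤a = constant-square≡0 (w ⊠ (α ⊠ β)) (proj₂ (nonneg-+≡0 (subst (0ℤ ℤ.≤_) (sym norm-constant)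
        (sum-nonneg λ k → subst (0ℤ ℤ.≤_) (sym (constant-sum (λ l → residue k l ⊠ residue k l))) (sum-nonneg λ l → constant-square (residue k l))))
      (constant-square (w ⊠ (α ⊠ β))) (trans (sym (constant-⊞ norm ((w ⊠ (α ⊠ β)) ⊠ (w ⊠ (α ⊠ β))))) (cong constant residue-norm))))
      where
      norm : ℤ[η]
      norm = Sum.sum (λ k → Sum.sum (λ l → residue k l ⊠ residue k l))
      norm-constant : constant norm ≡ sum (λ k → constant (Sum.sum (λ l → residue k l ⊠ residue k l)))
      norm-constant = constant-sum (λ k → Sum.sum (λ l → residue k l ⊠ residue k l))
      constant-⊞ : ∀ x y → constant (x ⊞ y) ≡ constant x + constant y
      constant-⊞ (_ +η _) (_ +η _) = refl
      second-nonneg : ∀ b → 0ℤ ℤ.≤ b * b * (+ 2 * a)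
      second-nonneg b = *-nonneg (square-nonneg b) (*-nonneg {+ 2} (ℤ.+≤+ ℕ.z≤n) 0≤a)
      constant-square : ∀ z → 0ℤ ℤ.≤ constant (z ⊠ z)
      constant-square (c +η b) = ℤ.+-mono-≤ (square-nonneg c) (second-nonneg b)
      constant-square≡0 : ∀ z → constant (z ⊠ z) ≡ 0ℤ → constant z ≡ 0ℤ
      constant-square≡0 (c +η b) e = square≡0 c (proj₁ (nonneg-+≡0 (square-nonneg c) (second-nonneg b) e))

-- Adjacency matrices and walks

sum≢0 : ∀ {f : Row n} → sum f ≢ 0ℤ → ∃[ i ] f i ≢ 0ℤ
sum≢0 {f = f} s≢0 with any? (λ i → ¬? (f i ℤ.≟ 0ℤ))
... | yes found = found
... | no  none  = contradiction (sum-zero λ i → decidable-stable (f i ℤ.≟ 0ℤ) λ fi≢0 → none (i , fi≢0)) s≢0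

term≤sum : ∀ {f : Row n} → (∀ i → 0ℤ ℤ.≤ f i) → ∀ i → f i ℤ.≤ sum f
term≤sum {suc n} {f} p i = subst (f i ℤ.≤_) (sym (sum-remove {i = i} f))
  (subst (ℤ._≤ f i + sum (f ∘ punchIn i)) (ℤ.+-identityʳ (f i)) (ℤ.+-monoʳ-≤ (f i) (sum-nonneg (p ∘ punchIn i))))

two-terms≤sum : ∀ {f : Row n} → (∀ i → 0ℤ ℤ.≤ f i) → ∀ {i j} → i ≢ j → f i + f j ℤ.≤ sum f
two-terms≤sum {suc n} {f} p {i} {j} i≢j = subst (f i + f j ℤ.≤_) (sym (sum-remove {i = i} f))
  (ℤ.+-monoʳ-≤ (f i) (subst (λ k → f k ℤ.≤ sum (f ∘ punchIn i)) (punchIn-punchOut i≢j) (term≤sum (p ∘ punchIn i) (punchOut i≢j))))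

module Walks (G : Graph) where

  A : Matrix (order G)
  A = integerAdjacency G

  A-adjacent : ∀ {u v} → adj G u v ≡ true → A u v ≡ 1ℤ
  A-adjacent e = cong (λ b → if b then 1ℤ else 0ℤ) e

  A≢0 : ∀ {u v} → A u v ≢ 0ℤ → adj G u v ≡ true
  A≢0 {u} {v} A≢ with adj G u v
  ... | true  = refl
  ... | false = contradiction refl A≢

  A-non-adjacent : ∀ {u v} → adj G u v ≢ true → A u v ≡ 0ℤ
  A-non-adjacent {u} {v} ¬e = decidable-stable (A u v ℤ.≟ 0ℤ) λ A≢ → ¬e (A≢0 A≢)

  A-nonneg : ∀ u v → 0ℤ ℤ.≤ A u v
  A-nonneg u v with adj G u v
  ... | true  = ℤ.+≤+ ℕ.z≤n
  ... | false = ℤ.+≤+ ℕ.z≤n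

  A-idempotent : ∀ u v → A u v * A u v ≡ A u v
  A-idempotent u v with adj G u v
  ... | true  = refl
  ... | false = refl

  A-sym : ∀ u v → A u v ≡ A v u
  A-sym u v = cong (λ b → if b then 1ℤ else 0ℤ) (adj-sym G u v)

  ⇑-nonneg : ∀ k u v → 0ℤ ℤ.≤ (A ⇑ k) u v
  ⇑-nonneg zero u v with does (u ≟ v)
  ... | true  = ℤ.+≤+ ℕ.z≤n
  ... | false = ℤ.+≤+ ℕ.z≤n
  ⇑-nonneg (suc k) u v = sum-nonneg λ w → *-nonneg (A-nonneg u w) (⇑-nonneg k w v)

  walk : ∀ k {u v} → (A ⇑ k) u v ≢ 0ℤ → Star (Adjacent G) u v
  walk zero {u} {v} p with u ≟ v
  ... | yes refl = ε
  ... | no  u≢v  = contradiction refl p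
  walk (suc k) {u} {v} p with sum≢0 {f = λ w → A u w * (A ⇑ k) w v} p
  ... | w , q = A≢0 (λ e → q (trans (cong (_* (A ⇑ k) w v) e) (ℤ.*-zeroˡ ((A ⇑ k) w v))))
              ◅ walk k (λ e → q (trans (cong (A u w *_) e) (ℤ.*-zeroʳ (A u w))))

  degree : ∀ v → (A ⇑ 2) v v ≡ sum (A v)
  degree v = sum-cong-≗ λ w → trans (cong (A v w *_) (trans (⇑-1 A w v) (A-sym w v))) (A-idempotent v w)

  Branching : Fin (order G) → Set
  Branching v = ∃[ u ] ∃[ w ] (u ≢ w × adj G v u ≡ true × adj G v w ≡ true)

  branching? : ∀ v → Dec (Branching v)
  branching? v = any? λ u → any? λ w → ¬? (u ≟ w) ×-dec ((adj G v u Bool.≟ true) ×-dec (adj G v w Bool.≟ true))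

  unique-neighbour : ∀ {v u} → ¬ Branching v → adj G v u ≡ true → ∀ w → adj G v w ≡ true → w ≡ u
  unique-neighbour {v} {u} ¬branching e w e′ = decidable-stable (w ≟ u) λ w≢u → ¬branching (w , u , w≢u , e′ , e)

  degree-branching : ∀ {v} → Branching v → + 2 ℤ.≤ (A ⇑ 2) v v
  degree-branching {v} (u , w , u≢w , e , e′) = subst (+ 2 ℤ.≤_) (sym (degree v))
    (subst (ℤ._≤ sum (A v)) (cong₂ _+_ (A-adjacent e) (A-adjacent e′)) (two-terms≤sum (A-nonneg v) u≢w))

  degree-non-branching : ∀ {v u} → ¬ Branching v → adj G v u ≡ true → (A ⇑ 2) v v ≡ 1ℤ
  degree-non-branching {v} {u} ¬branching e = trans (degree v) (trans (sum-cong-≗ row)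
    (sum-I (λ _ → 1ℤ) u))
    where
    row : ∀ w → A v w ≡ I u w * 1ℤ
    row w with u ≟ w
    ... | yes refl = A-adjacent e
    ... | no  u≢w  = A-non-adjacent λ e′ → u≢w (sym (unique-neighbour ¬branching e w e′))

  isolated-row : ∀ {v} → (∀ u → adj G v u ≢ true) → ∀ k w → (A ⇑ suc k) v w ≡ 0ℤ
  isolated-row {v} none k w = sum-zero λ u → trans (cong (_* (A ⇑ k) u w) (A-non-adjacent (none u))) (ℤ.*-zeroˡ ((A ⇑ k) u w))

  difference-walk : ∀ p q {i j} → (A ⇑ p) i j - (A ⇑ q) i j ≢ 0ℤ → Star (Adjacent G) i j
  difference-walk p q {i} {j} d≢0 with (A ⇑ p) i j ℤ.≟ 0ℤ
  ... | no  p≢0 = walk p {i} {j} p≢0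
  ... | yes p≡0 = walk q {i} {j} λ q≡0 → d≢0 (cong₂ _-_ p≡0 q≡0)

IsolatedEdge : (G : Graph) → Fin (order G) → Fin (order G) → Set
IsolatedEdge G v u = adj G v u ≡ true × (∀ w → adj G v w ≡ true → w ≡ u) × (∀ w → adj G u w ≡ true → w ≡ v)

-- Every vertex is linked to b or lies on an isolated edge avoiding b.
OneLargeComponent : (G : Graph) → Fin (order G) → Set
OneLargeComponent G b = ∀ v → Star (Adjacent G) b v ⊎ ∃[ u ] (IsolatedEdge G v u × v ≢ b × u ≢ b)

-- The sizes are arbitrary so that their equality can be eliminated before `A` and `C` are compared
-- as matrices of one size.
same-traces : ∀ {m n} (A : Matrix m) (B C : Matrix n) → m ≡ n →
  (∀ s x → det (pencil s (+ suc x) A) ≡ det (pencil s (+ suc x) B)) → (∀ i j → B i j ≡ C i j) →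
  ∀ k → trace (A ⇑ k) ≡ trace (C ⇑ k)
same-traces A B C refl same-det B≗C = trace-⇑-≡ A C λ s x →
  trans (same-det s x) (det-cong λ i j → cong (λ z → s * I i j - + suc x * z) (B≗C i j))

polynomial-annihilates : ∀ {k m n} (c : Row k) (A : Matrix m) (B : Matrix n) → (∀ i j → A i j ≡ A j i) →
  (∀ k → trace (A ⇑ k) ≡ trace (B ⇑ k)) → (∀ i j → polynomial c B i j ≡ 0ℤ) → ∀ i j → polynomial c A i j ≡ 0ℤ
polynomial-annihilates c A B A-sym trace-≡ cB≡0 = symmetric-square≡0 (polynomial c A) (polynomial-sym c A A-sym) (begin
  trace (polynomial c A ⊡ polynomial c A)
    ≡⟨ trace-polynomial² c A ⟩
  sum (λ k → c k * sum (λ l → c l * trace (A ⇑ (toℕ l ℕ.+ toℕ k))))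
    ≡⟨ sum-cong-≗ (λ k → cong (c k *_) (sum-cong-≗ λ l → cong (c l *_) (trace-≡ (toℕ l ℕ.+ toℕ k)))) ⟩
  sum (λ k → c k * sum (λ l → c l * trace (B ⇑ (toℕ l ℕ.+ toℕ k))))
    ≡⟨ trace-polynomial² c B ⟨
  trace (polynomial c B ⊡ polynomial c B)
    ≡⟨ sum-zero (λ i → sum-zero λ l → trans (cong (_* polynomial c B l i) (cB≡0 i l)) (ℤ.*-zeroˡ (polynomial c B l i))) ⟩
  0ℤ ∎)

-- Graphs with the spectrum of a friendship graph

module FriendshipSpectrum (n : ℕ) (G : Graph)
  (annihilated : ∀ i j → polynomial (annihilator (+ suc n)) (integerAdjacency G) i j ≡ 0ℤ)
  (trace-0 : trace (integerAdjacency G ⇑ 0) ≡ + 2 * + suc n + 1ℤ) (trace-1 : trace (integerAdjacency G ⇑ 1) ≡ 0ℤ)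
  (trace-2 : trace (integerAdjacency G ⇑ 2) ≡ + 6 * + suc n) (trace-3 : trace (integerAdjacency G ⇑ 3) ≡ + 6 * + suc n)
  where

  open Walks G

  a : ℤ
  a = + suc n

  open Annihilated A a annihilated
  open EtaRing a

  trace-difference : ∀ p q → sum (λ i → (A ⇑ p) i i - (A ⇑ q) i i) ≡ trace (A ⇑ p) - trace (A ⇑ q)
  trace-difference p q = trans
    (sum-linear (- 1ℤ) {f = λ i → (A ⇑ q) i i} {g = λ i → (A ⇑ p) i i} (λ i → flip ((A ⇑ p) i i) ((A ⇑ q) i i)))
    (sym (flip (trace (A ⇑ p)) (trace (A ⇑ q))))
    where
    flip : ∀ x y → x - y ≡ (- 1ℤ) * y + x
    flip = solve-∀

  trace-R : sum (λ i → R i i) ≡ + 4 * a - 1ℤ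
  trace-R = trans (trace-difference 2 0) (trans (cong₂ _-_ trace-2 trace-0) (simplify a))
    where
    simplify : ∀ a → + 6 * a - (+ 2 * a + 1ℤ) ≡ + 4 * a - 1ℤ
    simplify = solve-∀

  trace-Y : sum (λ i → Y i i) ≡ + 6 * a
  trace-Y = trans (trace-difference 3 1) (trans (cong₂ _-_ trace-3 trace-1) (ℤ.+-identityʳ (+ 6 * a)))

  -- With θ = 1 + η the positive root of x² - x - 2a, X = (A² - 1)(A + η) is a
  -- multiple of the projection onto the θ-eigenspace of A.
  X : Fin (order G) → Fin (order G) → ℤ[η]
  X i j = Y i j +η R i j

  -- The value of (x² - 1)(x + η) at θ = 1 + η, reduced by η² = 2a - η. That the trace of `X` equals
  -- it expresses the simplicity of θ.
  w : ℤ[η]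
  w = (+ 6 * a) +η (+ 4 * a - 1ℤ)

  X-sym : ∀ i j → X i j ≡ X j i
  X-sym i j = cong₂ _+η_ (cong₂ _-_ (⇑-sym A A-sym 3 i j) (⇑-sym A A-sym 1 i j)) (cong₂ _-_ (⇑-sym A A-sym 2 i j) (⇑-sym A A-sym 0 i j))

  X-trace : Sum.sum (λ i → X i i) ≡ w
  X-trace = trans (sumη-components (λ i → Y i i) (λ i → R i i)) (cong₂ _+η_ trace-Y trace-R)

  X² : ∀ i j → Sum.sum (λ r → X i r ⊠ X r j) ≡ w ⊠ X i j
  X² i j = trans (sumη-components (λ r → Y i r * Y r j + R i r * R r j * (+ 2 * a)) (λ r → Y i r * R r j + R i r * Y r j - R i r * R r j))
    (cong₂ _+η_ first second)
    where
    first : sum (λ r → Y i r * Y r j + R i r * R r j * (+ 2 * a)) ≡ + 6 * a * Y i j + (+ 4 * a - 1ℤ) * R i j * (+ 2 * a)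
    first = begin
      sum (λ r → Y i r * Y r j + R i r * R r j * (+ 2 * a))
        ≡⟨ ∑-distrib-+ (λ r → Y i r * Y r j) (λ r → R i r * R r j * (+ 2 * a)) ⟩
      (Y ⊡ Y) i j + sum (λ r → R i r * R r j * (+ 2 * a))
        ≡⟨ cong₂ _+_ (Y⊡Y i j) (trans (sym (*-distribʳ-sum (+ 2 * a) (λ r → R i r * R r j))) (cong (_* (+ 2 * a)) (R⊡R i j))) ⟩
      + 4 * a * Y i j + + 4 * a * a * R i j + (Y i j + (+ 2 * a - 1ℤ) * R i j) * (+ 2 * a)
        ≡⟨ simplify a (Y i j) (R i j) ⟩
      + 6 * a * Y i j + (+ 4 * a - 1ℤ) * R i j * (+ 2 * a) ∎
      where
      simplify : ∀ a y r → + 4 * a * y + + 4 * a * a * r + (y + (+ 2 * a - 1ℤ) * r) * (+ 2 * a) ≡ + 6 * a * y + (+ 4 * a - 1ℤ) * r * (+ 2 * a)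
      simplify = solve-∀
    second : sum (λ r → Y i r * R r j + R i r * Y r j - R i r * R r j) ≡ + 6 * a * R i j + (+ 4 * a - 1ℤ) * Y i j - (+ 4 * a - 1ℤ) * R i j
    second = begin
      sum (λ r → Y i r * R r j + R i r * Y r j - R i r * R r j)
        ≡⟨ sum-linear (- 1ℤ) {f = λ r → R i r * R r j} {g = λ r → Y i r * R r j + R i r * Y r j} (λ r → flip (Y i r * R r j) (R i r * Y r j) (R i r * R r j)) ⟩
      (- 1ℤ) * (R ⊡ R) i j + sum (λ r → Y i r * R r j + R i r * Y r j)
        ≡⟨ cong₂ (λ x y → (- 1ℤ) * x + y) (R⊡R i j) (trans (∑-distrib-+ (λ r → Y i r * R r j) (λ r → R i r * Y r j)) (cong₂ _+_ (Y⊡R i j) (R⊡Y i j))) ⟩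
      (- 1ℤ) * (Y i j + (+ 2 * a - 1ℤ) * R i j) + ((+ 2 * a * Y i j + + 2 * a * R i j) + (+ 2 * a * Y i j + + 2 * a * R i j))
        ≡⟨ simplify a (Y i j) (R i j) ⟩
      + 6 * a * R i j + (+ 4 * a - 1ℤ) * Y i j - (+ 4 * a - 1ℤ) * R i j ∎
      where
      flip : ∀ x y z → x + y - z ≡ (- 1ℤ) * z + (x + y)
      flip = solve-∀
      simplify : ∀ a y r → (- 1ℤ) * (y + (+ 2 * a - 1ℤ) * r) + ((+ 2 * a * y + + 2 * a * r) + (+ 2 * a * y + + 2 * a * r))
        ≡ + 6 * a * r + (+ 4 * a - 1ℤ) * y - (+ 4 * a - 1ℤ) * r
      simplify = solve-∀

  -- Here y, y′ and 1 + s, 1 + s′ are diagonal entries of `Y` and `R`. The relation η² = 2a - η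
  -- brings in one negative term, -2a (4a - 1)(1 + s)(1 + s′); the term 12a² (1 + s)(1 + s′), from
  -- the coefficient 6a of `w`, outweighs it.
  constant-positive : ∀ {y y′ s s′} → 0ℤ ℤ.≤ y → 0ℤ ℤ.≤ y′ → 0ℤ ℤ.≤ s → 0ℤ ℤ.≤ s′ →
    constant (w ⊠ ((y +η (1ℤ + s)) ⊠ (y′ +η (1ℤ + s′)))) ≢ 0ℤ
  constant-positive {+ y} {+ y′} {+ s} {+ s′} _ _ _ _ e = 6+-≢0 rest-nonneg (trans (sym (expand (+ n) (+ y) (+ y′) (+ s) (+ s′))) e)
    where
    6+-≢0 : ∀ {x} → 0ℤ ℤ.≤ x → + 6 + x ≢ 0ℤ
    6+-≢0 {+ k} _ ()
    -- With a = 1 + m, the net coefficient 4a² + 2a of (1 + s)(1 + s′) is 6 + 10m + 4m². Its part 6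
    -- (1 + s)(1 + s′) supplies the leading 6.
    expand : ∀ m y y′ s s′ → + 6 * (1ℤ + m) * (y * y′ + (1ℤ + s) * (1ℤ + s′) * (+ 2 * (1ℤ + m)))
      + (+ 4 * (1ℤ + m) - 1ℤ) * (y * (1ℤ + s′) + (1ℤ + s) * y′ - (1ℤ + s) * (1ℤ + s′)) * (+ 2 * (1ℤ + m))
      ≡ + 6 + (+ 6 * (1ℤ + m) * (y * y′) + (+ 2 * (1ℤ + m) * (+ 3 + + 4 * m) * (y * (1ℤ + s′) + (1ℤ + s) * y′)
        + ((+ 10 * m + + 4 * (m * m)) * ((1ℤ + s) * (1ℤ + s′)) + + 6 * (s + s′ + s * s′))))
    expand = solve-∀
    pos : ∀ k → 0ℤ ℤ.≤ + k
    pos k = ℤ.+≤+ ℕ.z≤n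
    infixr 6 _⊹_
    _⊹_ : ∀ {x y} → 0ℤ ℤ.≤ x → 0ℤ ℤ.≤ y → 0ℤ ℤ.≤ x + y
    _⊹_ = ℤ.+-mono-≤
    rest-nonneg : 0ℤ ℤ.≤ + 6 * (1ℤ + + n) * (+ y * + y′) + (+ 2 * (1ℤ + + n) * (+ 3 + + 4 * + n) * (+ y * (1ℤ + + s′) + (1ℤ + + s) * + y′)
        + ((+ 10 * + n + + 4 * (+ n * + n)) * ((1ℤ + + s) * (1ℤ + + s′)) + + 6 * (+ s + + s′ + + s * + s′)))
    rest-nonneg =
      *-nonneg (*-nonneg (pos 6) (pos (1 ℕ.+ n))) (*-nonneg (pos y) (pos y′))
      ⊹ *-nonneg (*-nonneg (*-nonneg (pos 2) (pos (1 ℕ.+ n))) (pos 3 ⊹ *-nonneg (pos 4) (pos n)))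
          (*-nonneg (pos y) (pos (1 ℕ.+ s′)) ⊹ *-nonneg (pos (1 ℕ.+ s)) (pos y′))
      ⊹ *-nonneg (*-nonneg (pos 10) (pos n) ⊹ *-nonneg (pos 4) (*-nonneg (pos n) (pos n))) (*-nonneg (pos (1 ℕ.+ s)) (pos (1 ℕ.+ s′)))
      ⊹ *-nonneg (pos 6) (pos (s ℕ.+ s′) ⊹ *-nonneg (pos s) (pos s′))

  Y-diagonal-nonneg : ∀ i → 0ℤ ℤ.≤ Y i i
  Y-diagonal-nonneg i = subst (0ℤ ℤ.≤_) (sym (trans (cong (λ z → (A ⇑ 3) i i - z)
      (trans (⇑-1 A i i) (A-non-adjacent λ e → contradiction (trans (sym e) (adj-irrefl G i)) λ ()))) (ℤ.+-identityʳ ((A ⇑ 3) i i))))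
    (⇑-nonneg 3 i i)

  X-branching : ∀ {i} → Branching i → ∃[ s ] (0ℤ ℤ.≤ s × X i i ≡ Y i i +η (1ℤ + s))
  X-branching {i} branching = (A ⇑ 2) i i - + 2 , ℤ.i≤j⇒0≤j-i (degree-branching branching)
    , cong (Y i i +η_) (trans (cong (λ z → (A ⇑ 2) i i - z) (I-diagonal i)) (shift ((A ⇑ 2) i i)))
    where
    shift : ∀ x → x - 1ℤ ≡ 1ℤ + (x - + 2)
    shift = solve-∀

  X-branching≢0 : ∀ {i j} → Branching i → Branching j → X i j ≢ 0η
  X-branching≢0 {i} {j} i-branching j-branching X≡0 = positive (X-branching i-branching) (X-branching j-branching)
    where
    positive : ∃[ s ] (0ℤ ℤ.≤ s × X i i ≡ Y i i +η (1ℤ + s)) → ¬ (∃[ s ] (0ℤ ℤ.≤ s × X j j ≡ Y j j +η (1ℤ + s)))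
    positive (s , 0≤s , e) (s′ , 0≤s′ , e′) =
      constant-positive {Y i i} {Y j j} {s} {s′} (Y-diagonal-nonneg i) (Y-diagonal-nonneg j) 0≤s 0≤s′
        (subst₂ (λ x y → constant (w ⊠ (x ⊠ y)) ≡ 0ℤ) e e′
          (constant-vanishes X w X-sym X² X-trace i j X≡0 (ℤ.+≤+ ℕ.z≤n)))

  branching-linked : ∀ {i j} → Branching i → Branching j → Star (Adjacent G) i j
  branching-linked {i} {j} i-branching j-branching = cases (R i j ℤ.≟ 0ℤ) (Y i j ℤ.≟ 0ℤ)
    where
    cases : Dec (R i j ≡ 0ℤ) → Dec (Y i j ≡ 0ℤ) → Star (Adjacent G) i j
    cases (no R≢0)  _         = difference-walk 2 0 {i} {j} R≢0
    cases (yes _)   (no Y≢0)  = difference-walk 3 1 {i} {j} Y≢0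
    cases (yes R≡0) (yes Y≡0) = contradiction (cong₂ _+η_ Y≡0 R≡0) (X-branching≢0 {i} {j} i-branching j-branching)

  neighbour : ∀ v → ∃[ u ] adj G v u ≡ true
  neighbour v = decidable-stable (any? λ u → adj G v u Bool.≟ true) λ none →
    contradiction (trans (sym (evaluated λ u e → none (u , e))) (annihilated v v)) λ ()
    where
    combination-cong : ∀ {x₀ x₁ x₂ x₃ x₄} → x₀ ≡ 1ℤ → x₁ ≡ 0ℤ → x₂ ≡ 0ℤ → x₃ ≡ 0ℤ → x₄ ≡ 0ℤ →
      + 2 * a * x₀ + (1ℤ * x₁ + (- (+ 2 * a + 1ℤ) * x₂ + (- 1ℤ * x₃ + (1ℤ * x₄ + 0ℤ)))) ≡ + 2 * a
    combination-cong refl refl refl refl refl = only-constant a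
      where
      only-constant : ∀ a → + 2 * a * 1ℤ + (1ℤ * 0ℤ + (- (+ 2 * a + 1ℤ) * 0ℤ + (- 1ℤ * 0ℤ + (1ℤ * 0ℤ + 0ℤ)))) ≡ + 2 * a
      only-constant = solve-∀
    evaluated : (∀ u → adj G v u ≢ true) → polynomial (annihilator a) A v v ≡ + 2 * a
    evaluated none = combination-cong {I v v} {(A ⇑ 1) v v} {(A ⇑ 2) v v} {(A ⇑ 3) v v} {(A ⇑ 4) v v}
      (I-diagonal v) (isolated-row none 0 v) (isolated-row none 1 v) (isolated-row none 2 v) (isolated-row none 3 v)

  -- Otherwise every vertex, having a neighbour, would have degree exactly one, and `R` would have
  -- zero diagonal, whereas its trace 4a - 1 is nonzero.
  branching-vertex : ∃[ b ] Branching b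
  branching-vertex = decidable-stable (any? branching?) λ none → trace≢0 (trans (sym trace-R) (sum-zero λ v →
      cong₂ _-_ (degree-non-branching {v} {proj₁ (neighbour v)} (λ v-branching → none (v , v-branching)) (proj₂ (neighbour v))) (I-diagonal v)))
    where
    shift : ∀ m → + 4 * (1ℤ + m) - 1ℤ ≡ + 3 + + 4 * m
    shift = solve-∀
    3+-≢0 : ∀ {x} → 0ℤ ℤ.≤ x → + 3 + x ≢ 0ℤ
    3+-≢0 {+ k} _ ()
    trace≢0 : + 4 * a - 1ℤ ≢ 0ℤ
    trace≢0 e = 3+-≢0 {+ 4 * + n} (*-nonneg {+ 4} {+ n} (ℤ.+≤+ ℕ.z≤n) (ℤ.+≤+ ℕ.z≤n)) (trans (sym (shift (+ n))) e)

  one-large-component : ∃[ b ] OneLargeComponent G b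
  one-large-component = b , λ v → cases v (branching? v) (neighbour v)
    where
    b : Fin (order G)
    b = proj₁ branching-vertex
    b-branching : Branching b
    b-branching = proj₂ branching-vertex
    ≢b : ∀ {v} → ¬ Branching v → v ≢ b
    ≢b v-simple v≡b = v-simple (subst Branching (sym v≡b) b-branching)
    pendant : ∀ v u → adj G v u ≡ true → ¬ Branching v → Dec (Branching u) →
      Star (Adjacent G) b v ⊎ ∃[ u ] (IsolatedEdge G v u × v ≢ b × u ≢ b)
    pendant v u e v-simple (yes u-branching) = inj₁ (branching-linked b-branching u-branching ◅◅ (trans (adj-sym G u v) e ◅ ε))
    pendant v u e v-simple (no u-simple) = inj₂ (u
      , (e , unique-neighbour v-simple e , unique-neighbour u-simple (trans (adj-sym G u v) e)) , ≢b v-simple , ≢b u-simple)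
    cases : ∀ v → Dec (Branching v) → ∃[ u ] adj G v u ≡ true →
      Star (Adjacent G) b v ⊎ ∃[ u ] (IsolatedEdge G v u × v ≢ b × u ≢ b)
    cases v (yes v-branching) _       = inj₁ (branching-linked b-branching v-branching)
    cases v (no v-simple)     (u , e) = pendant v u e v-simple (branching? u)

module CospectralFriendship (n : ℕ) (G : Graph) (cospectral : Cospectral G (friendship (suc n))) where

  open Walks G
  open FriendshipPartner (suc n) using (windmill; friendship-windmill; M; trace-I; trace-power-1; trace-power-2; trace-power-3) renaming (annihilated to windmill-annihilated)

  a : ℤ
  a = + suc n

  M≡2a : M ≡ + 2 * a
  M≡2a = trans (ℤ.pos-* (suc n) 2) (ℤ.*-comm a (+ 2))

  trace-≡ : ∀ k → trace (A ⇑ k) ≡ trace (windmill ⇑ k)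
  trace-≡ = same-traces {order G} {order (friendship (suc n))} A (integerAdjacency (friendship (suc n))) windmill
    (cospectral⇒same-order {G} {friendship (suc n)} cospectral)
    (cospectral⇒same-pencil {G} {friendship (suc n)} cospectral) friendship-windmill

  annihilated : ∀ i j → polynomial (annihilator a) A i j ≡ 0ℤ
  annihilated = polynomial-annihilates (annihilator a) A windmill A-sym trace-≡ (windmill-annihilated a M≡2a)

  one-large-component : ∃[ b ] OneLargeComponent G b
  one-large-component = FriendshipSpectrum.one-large-component n G annihilated
    (trans (trace-≡ 0) (trans trace-I (cong (λ z → z + 1ℤ) M≡2a)))
    (trans (trace-≡ 1) trace-power-1)
    (trans (trace-≡ 2) (trans trace-power-2 tripled))
    (trans (trace-≡ 3) (trans trace-power-3 tripled))
    where
    simplify : ∀ a → + 2 * a + + 2 * a * + 2 ≡ + 6 * a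
    simplify = solve-∀
    tripled : M + M * + 2 ≡ + 6 * a
    tripled = trans (cong (λ z → z + z * + 2) M≡2a) (simplify a)

-- Splitting off isolated edges

-- Positions zero and one are those of `K₂` in a disjoint union that begins with `K₂`.
two-points-first : ∀ {n} {v u : Fin n} → v ≢ u →
  ∃[ r ] Σ (Permutation.Permutation n (2 ℕ.+ r)) λ f → Inverse.from f zero ≡ v × Inverse.from f (suc zero) ≡ u
two-points-first {suc zero} {zero} {zero} v≢u = contradiction refl v≢u
two-points-first {suc (suc r)} {v} {u} v≢u =
  r , Permutation.insert v zero (Permutation.insert (punchOut v≢u) zero Permutation.id) , refl , punchIn-punchOut v≢u

-- The bracketing is the one to which `copies (suc k) K₂ ⊎ᴳ H` unfolds.
adj-join-zero : ∀ C H q → adj ((K₂ ⊎ᴳ C) ⊎ᴳ H) zero (suc (suc q)) ≡ false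
adj-join-zero C H q with splitAt (order C) q
... | inj₁ _ = refl
... | inj₂ _ = refl

adj-join-one : ∀ C H q → adj ((K₂ ⊎ᴳ C) ⊎ᴳ H) (suc zero) (suc (suc q)) ≡ false
adj-join-one C H q with splitAt (order C) q
... | inj₁ _ = refl
... | inj₂ _ = refl

adj-join-rest : ∀ C H p q → adj ((K₂ ⊎ᴳ C) ⊎ᴳ H) (suc (suc p)) (suc (suc q)) ≡ adj (C ⊎ᴳ H) p q
adj-join-rest C H p q with splitAt (order C) p | splitAt (order C) q
... | inj₁ _ | inj₁ _ = refl
... | inj₁ _ | inj₂ _ = refl
... | inj₂ _ | inj₁ _ = refl
... | inj₂ _ | inj₂ _ = refl

module Peel (G : Graph) {v u : Fin (order G)} (edge : IsolatedEdge G v u) {r : ℕ}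
  (f : Permutation.Permutation (order G) (2 ℕ.+ r)) (e₀ : Inverse.from f zero ≡ v) (e₁ : Inverse.from f (suc zero) ≡ u) where

  open Inverse f using (to; from; strictlyInverseˡ; strictlyInverseʳ)

  inner : Fin r → Fin (order G)
  inner p = from (suc (suc p))

  rest : Graph
  rest = record
    { order      = r
    ; adj        = λ p q → adj G (inner p) (inner q)
    ; adj-sym    = λ p q → adj-sym G (inner p) (inner q)
    ; adj-irrefl = λ p → adj-irrefl G (inner p)
    }

  from-injective : ∀ {p q} → from p ≡ from q → p ≡ q
  from-injective {p} {q} e = trans (sym (strictlyInverseˡ p)) (trans (cong to e) (strictlyInverseˡ q))

  inner-injective : ∀ {p q} → inner p ≡ inner q → p ≡ q
  inner-injective e = suc-injective (suc-injective (from-injective e))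

  inner≢v : ∀ p → inner p ≢ v
  inner≢v p e with from-injective {suc (suc p)} {zero} (trans e (sym e₀))
  ... | ()

  inner≢u : ∀ p → inner p ≢ u
  inner≢u p e with from-injective {suc (suc p)} {suc zero} (trans e (sym e₁))
  ... | ()

  inner-surjective : ∀ s → s ≢ v → s ≢ u → ∃[ p ] inner p ≡ s
  inner-surjective s s≢v s≢u = locate (to s) (strictlyInverseʳ s)
    where
    locate : ∀ k → from k ≡ s → ∃[ p ] inner p ≡ s
    locate zero          e = contradiction (trans (sym e) e₀) s≢v
    locate (suc zero)    e = contradiction (trans (sym e) e₁) s≢u
    locate (suc (suc p)) e = p , e

  -- No edge leaves the rest, since v and u have only each other as neighbours. Hence walks and
  -- isolated edges of G restrict to it.
  inner-neighbour : ∀ p t → adj G (inner p) t ≡ true → ∃[ q ] inner q ≡ t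
  inner-neighbour p t a = inner-surjective t
    (λ t≡v → inner≢u p (proj₁ (proj₂ edge) (inner p) (trans (adj-sym G v (inner p)) (subst (λ t → adj G (inner p) t ≡ true) t≡v a))))
    (λ t≡u → inner≢v p (proj₂ (proj₂ edge) (inner p) (trans (adj-sym G u (inner p)) (subst (λ t → adj G (inner p) t ≡ true) t≡u a))))

  restrict-walk : ∀ {s t} → Star (Adjacent G) s t → ∀ p q → inner p ≡ s → inner q ≡ t → Star (Adjacent rest) p q
  restrict-walk ε p q refl e = subst (Star (Adjacent rest) p) (inner-injective (sym e)) ε
  restrict-walk (a ◅ walk) p q refl e with inner-neighbour p _ a
  ... | p′ , refl = a ◅ restrict-walk walk p′ q refl e

  rest-large-component : ∀ {b} → OneLargeComponent G b → b ≢ v → b ≢ u → ∃[ b′ ] OneLargeComponent rest b′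
  rest-large-component {b} large b≢v b≢u with inner-surjective b b≢v b≢u
  ... | b′ , refl = b′ , λ p → cases p (large (inner p))
    where
    cases : ∀ p → Star (Adjacent G) b (inner p) ⊎ ∃[ s ] (IsolatedEdge G (inner p) s × inner p ≢ b × s ≢ b) →
      Star (Adjacent rest) b′ p ⊎ ∃[ q ] (IsolatedEdge rest p q × p ≢ b′ × q ≢ b′)
    cases p (inj₁ walk) = inj₁ (restrict-walk walk b′ p refl refl)
    cases p (inj₂ (s , (a , p-nbrs , s-nbrs) , p≢b , s≢b)) with inner-neighbour p s a
    ... | q , refl = inj₂ (q , (a , (λ w e → inner-injective (p-nbrs (inner w) e)) , (λ w e → inner-injective (s-nbrs (inner w) e)))
                        , (λ p≡b → p≢b (cong inner p≡b)) , (λ q≡b → s≢b (cong inner q≡b)))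

  adj-v-inner : ∀ p → adj G v (inner p) ≡ false
  adj-v-inner p = Bool.¬-not λ e → inner≢u p (proj₁ (proj₂ edge) (inner p) e)

  adj-u-inner : ∀ p → adj G u (inner p) ≡ false
  adj-u-inner p = Bool.¬-not λ e → inner≢v p (proj₂ (proj₂ edge) (inner p) e)

  module _ {C H : Graph} (rest≅ : rest ≅ (C ⊎ᴳ H)) where

    private
      g : Fin r ↔ Fin (order C ℕ.+ order H)
      g = proj₁ rest≅
      joined : Graph
      joined = (K₂ ⊎ᴳ C) ⊎ᴳ H
      lifted : Fin (2 ℕ.+ r) ↔ Fin (order joined)
      lifted = Permutation.lift₀ (Permutation.lift₀ g)

    adj-lifted : ∀ p q → adj G (from p) (from q) ≡ adj joined (Inverse.to lifted p) (Inverse.to lifted q)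
    adj-lifted zero zero = adj-irrefl G (from zero)
    adj-lifted zero (suc zero) = trans (cong₂ (adj G) e₀ e₁) (proj₁ edge)
    adj-lifted zero (suc (suc q)) = trans (cong (λ s → adj G s (inner q)) e₀) (trans (adj-v-inner q) (sym (adj-join-zero C H (Inverse.to g q))))
    adj-lifted (suc zero) zero = trans (cong₂ (adj G) e₁ e₀) (trans (adj-sym G u v) (proj₁ edge))
    adj-lifted (suc zero) (suc zero) = adj-irrefl G (from (suc zero))
    adj-lifted (suc zero) (suc (suc q)) = trans (cong (λ s → adj G s (inner q)) e₁) (trans (adj-u-inner q) (sym (adj-join-one C H (Inverse.to g q))))
    adj-lifted (suc (suc p)) zero = trans (adj-sym G (inner p) (from zero)) (trans (adj-lifted zero (suc (suc p))) (adj-sym joined zero (suc (suc (Inverse.to g p)))))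
    adj-lifted (suc (suc p)) (suc zero) = trans (adj-sym G (inner p) (from (suc zero))) (trans (adj-lifted (suc zero) (suc (suc p))) (adj-sym joined (suc zero) (suc (suc (Inverse.to g p)))))
    adj-lifted (suc (suc p)) (suc (suc q)) = trans (proj₂ rest≅ p q) (sym (adj-join-rest C H (Inverse.to g p) (Inverse.to g q)))

    join≅ : G ≅ joined
    join≅ = f Permutation.∘ₚ lifted , λ s t →
      trans (sym (cong₂ (adj G) (strictlyInverseʳ s) (strictlyInverseʳ t))) (adj-lifted (to s) (to t))

-- Linkedness by a walk is never decided: the alternatives already given at the vertices are
-- searched for an isolated edge.
find-right : ∀ {n} {P Q : Fin n → Set} → (∀ i → P i ⊎ Q i) → (∀ i → P i) ⊎ ∃[ i ] Q i
find-right {zero}  d = inj₁ λ ()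
find-right {suc n} d with d zero | find-right (d ∘ suc)
... | inj₂ q | _            = inj₂ (zero , q)
... | inj₁ p | inj₂ (i , q) = inj₂ (suc i , q)
... | inj₁ p | inj₁ ps      = inj₁ λ { zero → p ; (suc i) → ps i }

star⇒connected : ∀ G b → (∀ v → Star (Adjacent G) b v) → Connected G
star⇒connected G b linked = inhabited b , λ u v → reverse (λ {s} {t} e → trans (adj-sym G t s) e) (linked u) ◅◅ linked v
  where
  inhabited : ∀ {n} → Fin n → 1 ≤ n
  inhabited zero    = ℕ.s≤s ℕ.z≤n
  inhabited (suc _) = ℕ.s≤s ℕ.z≤n

Decomposition : Graph → Set
Decomposition G = Connected G ⊎ (∃[ k ] ∃[ H ] (1 ≤ k × Connected H × G ≅ (copies k K₂ ⊎ᴳ H)))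

-- Recursion on a bound `m` for the order. Each round removes one isolated edge, and the vertex b
-- survives because the isolated edges found avoid it.
decompose : ∀ m G → order G ≤ m → ∀ b → OneLargeComponent G b → Decomposition G
decompose m G le b large with find-right large
... | inj₁ linked = inj₁ (star⇒connected G b linked)
... | inj₂ (v , u , edge , v≢b , u≢b) with two-points-first {v = v} {u} (λ { refl → contradiction (trans (sym (adj-irrefl G v)) (proj₁ edge)) λ () })
... | r , f , e₀ , e₁ = peel m le
  where
  open Peel G edge f e₀ e₁ using (rest; rest-large-component; join≅)
  conclude : Decomposition rest → Decomposition G
  -- `copies 1 K₂` ends in the graph without vertices, so the identity serves as isomorphism from
  -- `rest` to `complete 0 ⊎ᴳ rest`.
  conclude (inj₁ connected) = inj₂ (1 , rest , ℕ.s≤s ℕ.z≤n , connected , join≅ {complete 0} {rest} (Permutation.id , λ _ _ → refl))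
  conclude (inj₂ (k , H , _ , connected , iso)) = inj₂ (suc k , H , ℕ.s≤s ℕ.z≤n , connected , join≅ {copies k K₂} {H} iso)
  large′ : ∃[ b′ ] OneLargeComponent rest b′
  large′ = rest-large-component large (v≢b ∘ sym) (u≢b ∘ sym)
  smaller : ∀ {m} → order G ≤ suc m → r ≤ m
  smaller le = ℕ.≤-trans (ℕ.n≤1+n r) (ℕ.≤-pred (subst (_≤ _) (Permutation.↔⇒≡ f) le))
  peel : ∀ m → order G ≤ m → Decomposition G
  peel zero    le = contradiction (subst (_≤ 0) (Permutation.↔⇒≡ f) le) λ ()
  peel (suc m) le = conclude (decompose m rest (smaller le) (proj₁ large′) (proj₂ large′))

theorem2p4 : (n : ℕ) → 1 ≤ n → (G : Graph) → Cospectral G (friendship n) →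
    Connected G ⊎ (∃[ k ] ∃[ H ] (1 ≤ k × Connected H × G ≅ (copies k K₂ ⊎ᴳ H)))
theorem2p4 (suc n) _ G cospectral = decompose (order G) G ℕ.≤-refl (proj₁ component) (proj₂ component)
  where
  component : ∃[ b ] OneLargeComponent G b
  component = CospectralFriendship.one-large-component n G cospectral
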